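{- For every $\delta>0$ there is a constant $C_\delta$ (independent of $p$ and $N$) such that the following holds. Let $p$ be a prime and $\mathbb{F}_p$ the finite field of order $p$. Let $N$ be a positive integer with $N<p$, let $P$ be a set of points in $\mathbb{F}_p^2$ and $L$ a set of lines in $\mathbb{F}_p^2$ with $|P|,|L|\leq N$. Then $$I(P,L)\leq C_\delta\, N^{\frac{3}{2}-\frac{1}{806}+\delta}.$$ (Equivalently, $I(P,L)\ll N^{\frac{3}{2}-\frac{1}{806}+o(1)}$ as $N\to\infty$, with implied constants absolute.)
   Context: $I(P,L)$ denotes the number of incidences between $P$ and $L$, i.e. the number of pairs $(q,\ell)\in P\times L$ with the point $q$ lying on the line $\ell$. -}

module Defs where

open import Data.Nat using (ℕ; zero; suc; _+_; _*_; _≡ᵇ_; NonZero)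
open import Data.Nat.DivMod using (_%_)
open import Data.Fin using (Fin; toℕ)
open import Data.Product using (_×_; _,_)
open import Data.List using (List; length; filterᵇ; cartesianProduct)
open import Data.Bool using (Bool)
open import Relation.Binary.PropositionalEquality using (_≡_)
open import Relation.Nullary using (¬_)
open import Function.Bundles using (_⇔_)

-- A point of 𝔽_p² : coordinates are residues 0..p-1 (Fin p ≅ ℤ/pℤ).
Point : ℕ → Set
Point p = Fin p × Fin p

-- A line of 𝔽_p² is given by an equation a x + b y = c with (a , b) ≠ (0 , 0).
record Line (p : ℕ) : Set where
  constructor line
  field
    a b c   : Fin p
    nondeg  : ¬ (toℕ a ≡ 0 × toℕ b ≡ 0)

onᵇ : ∀ {p} .{{_ : NonZero p}} → Point p → Line p → Bool
onᵇ {p} (x , y) (line a b c _) =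
  ((toℕ a * toℕ x + toℕ b * toℕ y) % p) ≡ᵇ toℕ c

On : ∀ {p} .{{_ : NonZero p}} → Point p → Line p → Set
On {p} (x , y) (line a b c _) = ((toℕ a * toℕ x + toℕ b * toℕ y) % p) ≡ toℕ c

SameLine : ∀ {p} .{{_ : NonZero p}} → Line p → Line p → Set
SameLine {p} ℓ ℓ′ = (q : Point p) → On q ℓ ⇔ On q ℓ′

I : ∀ {p} .{{_ : NonZero p}} → List (Point p) → List (Line p) → ℕ
I P L = length (filterᵇ (λ { (q , ℓ) → onᵇ q ℓ }) (cartesianProduct P L))

{-# OPTIONS --safe #-}
module Submission where

open import Defs
open import Data.Nat using (ℕ; suc; _+_; _*_; _^_; _≤_; _<_; NonZero)
open import Data.Nat.Primality using (Prime)
open import Data.Product using (Σ)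
open import Data.List using (List; length)
open import Data.List.Relation.Unary.Unique.Propositional using (Unique)
open import Data.List.Relation.Unary.AllPairs using (AllPairs)
open import Relation.Nullary using (¬_)
open import Data.Nat as ℕ hiding (_≟_)
open import Data.Nat.Properties as ℕₚ hiding (_≟_)
open import Data.Nat.Coprimality using (prime⇒coprime; coprime-Bézout)
open import Data.Nat.DivMod using (_mod_; m%n<n; m/n*n≤m; m≡m%n+[m/n]*n; m<n⇒m%n≡m; n%n≡0; m*n%n≡0; %-distribˡ-+; %-distribˡ-*)
open import Data.Nat.GCD using (module Bézout)
open import Data.Nat.Tactic.RingSolver using (solve-∀)
open import Data.Integer as ℤ using (ℤ; -[1+_])
import Data.Integer.Properties as ℤₚ
open import Data.Bool using (Bool; true; false; T)
open import Data.Unit using (tt)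
open import Data.Empty using (⊥-elim)
open import Data.Fin using (Fin; toℕ)
import Data.Fin.Properties as Finₚ
open import Data.Maybe as Maybe using ()
open import Data.Product using (∃; _×_; _,_; proj₁; proj₂; swap)
open import Data.Product.Properties using (≡-dec)
open import Data.Sum using (_⊎_; inj₁; inj₂)
open import Data.List using ([]; _∷_; _++_; map; take; filter; filterᵇ; cartesianProduct; allFin)
open import Data.List.Extrema.Nat using (argmin; f[argmin]≤f[xs])
open import Data.List.Membership.Propositional using (_∈_; find; lose)
open import Data.List.Membership.Propositional.Properties
  using (∈-allFin; ∈-cartesianProduct⁺; ∈-cartesianProduct⁻; ∈-filter⁺; ∈-filter⁻; ∈-map⁺; ∈-++⁺ˡ; ∈-++⁺ʳ)
open import Data.List.Properties using (filter-notAll; length-map; length-tabulate; length-take)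
import Data.List.Relation.Unary.All as All
open import Data.List.Relation.Unary.All.Properties using (¬All⇒Any¬)
open import Data.List.Relation.Unary.AllPairs as AllPairs using ([]; _∷_)
import Data.List.Relation.Unary.AllPairs.Properties as AllPairsₚ
open import Data.List.Relation.Unary.Any as Any using (Any; here; there)
open import Data.List.Relation.Unary.Unique.Propositional.Properties using (allFin⁺; cartesianProduct⁺; filter⁺; take⁺)
open import Algebra.Bundles using (CommutativeRing)
open import Algebra.Structures using (IsCommutativeRing)
open import Function.Bundles using (mk⇔)
open import Level using (0ℓ)
open import Relation.Binary.Consequences using (dec⇒weaklyDec)
open import Relation.Binary.Definitions using (DecidableEquality)
open import Relation.Binary.PropositionalEquality
open import Relation.Nullary using (Dec; yes; no; _×-dec_; ¬?; map′)
open import Relation.Unary using (Decidable)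

-- Repeatedly deleting points and lines of low degree leaves a configuration in which every point lies on more than n
-- lines and every line carries more than n points. Send one point q to infinity: n lines through q become rows, each
-- with n points of ordinates A s, and the other lines become functions u = α + β s. Comparing a third row with two
-- fixed ones gives many solutions of x + t y ∈ S t for n multipliers t (x, y in sets of size n, |S t| ≤ n).
-- Dependent random choice and Ruzsa's triangle inequality turn this into one set A with |A − t A| ≤ K |A| for many t.
-- By Petridis' lemma the bound persists, with powers of K, for ratios r of differences of multipliers and for
-- t + (r + 1) t′. As 1 generates 𝔽_p additively, either every element of 𝔽_p is such a ratio, or some r is one and
-- r + 1 is not, in which case the elements t + (r + 1) t′ are pairwise distinct. In both cases there are so many
-- admissible ξ that on average A and ξ A have few additive coincidences, hence |A − ξ A| is large: a contradiction
-- unless K is a power of n. This bounds n by a power of k ≈ N / n² and gives the exponent 3/2 − 1/746.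

-- Prime fields

-- The exponent comes from counting powers of k. Fixing two rows costs Λ ≈ k². Counting paths of
-- length four costs Λ⁵ in the differences of fibres, hence Λ³ · (Λ⁵)² = Λ¹³ in the doubling of A;
-- the pivot raises this to the seventh power, and A and the set of multipliers are shorter than n
-- by factors that cost another Λ². So n ≤ C k^186 with 186 = 2 · (7 · 13 + 2); with k n² ≈ N this
-- reads n^373 ≤ C′ N^186, while I ≤ 6 N n. The obstacle is that dependent random choice yields a
-- different set of y for each multiplier t, whereas the pivot needs a single set. The bridge is a
-- fibre that overlaps many other fibres in a fixed proportion. The condition N < p enters through
-- n² ≤ N: when every field element is a ratio, p multipliers have to outweigh the accidental
-- coincidences between pairs of elements of A. All estimates are inequalities in ℕ: "at least n /
-- c" is written n ≤ c · a, and losses are explicit functions kept opaque.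

record PrimeField : Set₁ where
  infixl 6 _+ᶠ_ _-ᶠ_
  infixl 7 _*ᶠ_
  infix 8 -ᶠ_
  field
    K : Set
    _+ᶠ_ _*ᶠ_ : K → K → K
    -ᶠ_ : K → K
    0ᶠ 1ᶠ : K
    isCommutativeRing : IsCommutativeRing _≡_ _+ᶠ_ _*ᶠ_ -ᶠ_ 0ᶠ 1ᶠ
    _≟_ : DecidableEquality K
    inv : K → K
    inverse : ∀ {x} → x ≢ 0ᶠ → x *ᶠ inv x ≡ 1ᶠ
    U : List K
    U-unique : Unique U
    U-complete : ∀ x → x ∈ U
    -- This separates prime fields from other finite fields: 1 generates the additive group.
    -- Otherwise a proper subfield A would satisfy A - t A = A for all its elements t, and no growth
    -- could be proved.
    +1-induction : (P : K → Set) → P 0ᶠ → (∀ x → P x → P (x +ᶠ 1ᶠ)) → ∀ x → P x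

  _-ᶠ_ : K → K → K
  x -ᶠ y = x +ᶠ -ᶠ y

module RingSolver {K : Set} {_+ᶠ_ _*ᶠ_ : K → K → K} { -ᶠ_ : K → K} {0ᶠ 1ᶠ : K}
  (isCommutativeRing : IsCommutativeRing _≡_ _+ᶠ_ _*ᶠ_ -ᶠ_ 0ᶠ 1ᶠ) where

  private
    ring : CommutativeRing 0ℓ 0ℓ
    ring = record { isCommutativeRing = isCommutativeRing }

  open import Algebra.Properties.Ring (CommutativeRing.ring ring)
    using (-‿+-comm; -0#≈0#; -‿involutive; -‿distribˡ-*; -‿distribʳ-*)
  open import Algebra.Properties.Semiring.Mult.TCOptimised (CommutativeRing.semiring ring)
    using (1+×; ×-homo-+; ×1-homo-*) renaming (_×_ to _×ᵐ_)
  open CommutativeRing ring using (-‿inverseʳ)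
    renaming (+-comm to +ᶠ-comm; +-assoc to +ᶠ-assoc; +-identityˡ to +ᶠ-identityˡ; +-identityʳ to +ᶠ-identityʳ)
  open import Algebra.Solver.Ring.AlmostCommutativeRing

  R : AlmostCommutativeRing 0ℓ 0ℓ
  R = fromCommutativeRing ring

  -- The canonical map from the integers. Integer coefficients compute, whereas those of an abstract
  -- field do not, so the solver can see that terms cancel.
  ι : ℤ → K
  ι (ℤ.+ n) = n ×ᵐ 1ᶠ
  ι -[1+ n ] = -ᶠ (suc n ×ᵐ 1ᶠ)

  private
    _−_ : K → K → K
    a − b = a +ᶠ (-ᶠ b)

    cancel : ∀ a b c → ((a +ᶠ b) − (a +ᶠ c)) ≡ (b − c)
    cancel a b c = begin
      (a +ᶠ b) +ᶠ (-ᶠ (a +ᶠ c))  ≡⟨ cong ((a +ᶠ b) +ᶠ_) (sym (-‿+-comm a c)) ⟩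
      (a +ᶠ b) +ᶠ ((-ᶠ a) +ᶠ (-ᶠ c))  ≡⟨ cong (_+ᶠ ((-ᶠ a) +ᶠ (-ᶠ c))) (+ᶠ-comm a b) ⟩
      (b +ᶠ a) +ᶠ ((-ᶠ a) +ᶠ (-ᶠ c))  ≡⟨ +ᶠ-assoc b a _ ⟩
      b +ᶠ (a +ᶠ ((-ᶠ a) +ᶠ (-ᶠ c)))  ≡⟨ cong (b +ᶠ_) (sym (+ᶠ-assoc a _ _)) ⟩
      b +ᶠ ((a +ᶠ (-ᶠ a)) +ᶠ (-ᶠ c))  ≡⟨ cong (λ z → b +ᶠ (z +ᶠ (-ᶠ c))) (-‿inverseʳ a) ⟩
      b +ᶠ (0ᶠ +ᶠ (-ᶠ c))  ≡⟨ cong (b +ᶠ_) (+ᶠ-identityˡ _) ⟩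
      b +ᶠ (-ᶠ c) ∎ where open ≡-Reasoning

  ι-sub : ∀ m n → ι (m ℤ.⊖ n) ≡ ((m ×ᵐ 1ᶠ) +ᶠ (-ᶠ (n ×ᵐ 1ᶠ)))
  ι-sub zero zero = sym (-‿inverseʳ 0ᶠ)
  ι-sub zero (suc n) = sym (+ᶠ-identityˡ _)
  ι-sub (suc m) zero = sym (trans (cong ((suc m ×ᵐ 1ᶠ) +ᶠ_) -0#≈0#) (+ᶠ-identityʳ _))
  ι-sub (suc m) (suc n) = trans (cong ι (ℤₚ.[1+m]⊖[1+n]≡m⊖n m n)) (trans (ι-sub m n)
    (sym (trans (cong₂ _−_ (1+× m 1ᶠ) (1+× n 1ᶠ)) (cancel 1ᶠ _ _))))

  ι-+ : ∀ x y → ι (x ℤ.+ y) ≡ (ι x +ᶠ ι y)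
  ι-+ (ℤ.+ m) (ℤ.+ n) = ×-homo-+ 1ᶠ m n
  ι-+ (ℤ.+ m) -[1+ n ] = ι-sub m (suc n)
  ι-+ -[1+ m ] (ℤ.+ n) = trans (ι-sub n (suc m)) (+ᶠ-comm _ _)
  ι-+ -[1+ m ] -[1+ n ] = trans (cong (λ z → -ᶠ (suc z ×ᵐ 1ᶠ)) (sym (ℕₚ.+-suc m n)))
    (trans (cong -ᶠ_ (×-homo-+ 1ᶠ (suc m) (suc n))) (sym (-‿+-comm _ _)))

  ι-neg : ∀ x → ι (ℤ.- x) ≡ (-ᶠ ι x)
  ι-neg (ℤ.+ zero) = sym -0#≈0#
  ι-neg (ℤ.+ suc n) = refl
  ι-neg -[1+ n ] = sym (-‿involutive _)

  ι-*⁺ : ∀ m y → ι (ℤ.+ m ℤ.* y) ≡ ((m ×ᵐ 1ᶠ) *ᶠ ι y)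
  ι-*⁺ m (ℤ.+ n) = trans (cong ι (sym (ℤₚ.pos-* m n))) (×1-homo-* m n)
  ι-*⁺ m -[1+ n ] = begin
    ι (ℤ.+ m ℤ.* -[1+ n ])  ≡⟨ cong ι (sym (ℤₚ.neg-distribʳ-* (ℤ.+ m) (ℤ.+ suc n))) ⟩
    ι (ℤ.- (ℤ.+ m ℤ.* ℤ.+ suc n))  ≡⟨ ι-neg (ℤ.+ m ℤ.* ℤ.+ suc n) ⟩
    (-ᶠ ι (ℤ.+ m ℤ.* ℤ.+ suc n))  ≡⟨ cong -ᶠ_ (ι-*⁺ m (ℤ.+ suc n)) ⟩
    (-ᶠ ((m ×ᵐ 1ᶠ) *ᶠ (suc n ×ᵐ 1ᶠ)))  ≡⟨ -‿distribʳ-* _ _ ⟩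
    ((m ×ᵐ 1ᶠ) *ᶠ (-ᶠ (suc n ×ᵐ 1ᶠ))) ∎ where open ≡-Reasoning

  ι-* : ∀ x y → ι (x ℤ.* y) ≡ (ι x *ᶠ ι y)
  ι-* (ℤ.+ m) y = ι-*⁺ m y
  ι-* -[1+ m ] y = begin
    ι (-[1+ m ] ℤ.* y)  ≡⟨ cong ι (sym (ℤₚ.neg-distribˡ-* (ℤ.+ suc m) y)) ⟩
    ι (ℤ.- (ℤ.+ suc m ℤ.* y))  ≡⟨ ι-neg (ℤ.+ suc m ℤ.* y) ⟩
    (-ᶠ ι (ℤ.+ suc m ℤ.* y))  ≡⟨ cong -ᶠ_ (ι-*⁺ (suc m) y) ⟩
    (-ᶠ ((suc m ×ᵐ 1ᶠ) *ᶠ ι y))  ≡⟨ -‿distribˡ-* _ _ ⟩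
    ((-ᶠ (suc m ×ᵐ 1ᶠ)) *ᶠ ι y) ∎ where open ≡-Reasoning

  morphism : ℤ.+-*-rawRing -Raw-AlmostCommutative⟶ R
  morphism = record
    { ⟦_⟧ = ι ; +-homo = ι-+ ; *-homo = ι-* ; -‿homo = ι-neg
    ; 0-homo = refl ; 1-homo = refl }

  open import Algebra.Solver.Ring ℤ.+-*-rawRing R morphism
    (λ x y → Maybe.map (cong ι) (dec⇒weaklyDec ℤₚ._≟_ x y)) public
    using (solve; _:=_; _:+_; _:*_; :-_; _:-_; con; Polynomial)

  :0 :1 : ∀ {n} → Polynomial n
  :0 = con (ℤ.+ 0)
  :1 = con (ℤ.+ 1)

-- The field of residues modulo a prime

module Residues (p : ℕ) .{{_ : NonZero p}} where

  ⟨_⟩ : ℕ → Fin p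
  ⟨ n ⟩ = n mod p

  toℕ-⟨⟩ : ∀ n → toℕ ⟨ n ⟩ ≡ n % p
  toℕ-⟨⟩ n = Finₚ.toℕ-fromℕ< (m%n<n n p)

  ⟨⟩-cong : ∀ {m n} → m % p ≡ n % p → ⟨ m ⟩ ≡ ⟨ n ⟩
  ⟨⟩-cong {m} {n} eq = Finₚ.toℕ-injective (trans (toℕ-⟨⟩ m) (trans eq (sym (toℕ-⟨⟩ n))))

  ⟨toℕ⟩ : ∀ x → ⟨ toℕ x ⟩ ≡ x
  ⟨toℕ⟩ x = Finₚ.toℕ-injective (trans (toℕ-⟨⟩ (toℕ x)) (m<n⇒m%n≡m (Finₚ.toℕ<n x)))

  infixl 6 _+ᵖ_
  infixl 7 _*ᵖ_
  infix 8 -ᵖ_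
  _+ᵖ_ _*ᵖ_ : Fin p → Fin p → Fin p
  x +ᵖ y = ⟨ toℕ x ℕ.+ toℕ y ⟩
  x *ᵖ y = ⟨ toℕ x ℕ.* toℕ y ⟩
  -ᵖ_ : Fin p → Fin p
  -ᵖ x = ⟨ p ℕ.∸ toℕ x ⟩
  0# 1# : Fin p
  0# = ⟨ 0 ⟩
  1# = ⟨ 1 ⟩

  ⟨⟩-+ : ∀ m n → ⟨ m ⟩ +ᵖ ⟨ n ⟩ ≡ ⟨ m ℕ.+ n ⟩
  ⟨⟩-+ m n = ⟨⟩-cong (trans (cong₂ (λ a b → (a ℕ.+ b) % p) (toℕ-⟨⟩ m) (toℕ-⟨⟩ n)) (sym (%-distribˡ-+ m n p)))

  ⟨⟩-* : ∀ m n → ⟨ m ⟩ *ᵖ ⟨ n ⟩ ≡ ⟨ m ℕ.* n ⟩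
  ⟨⟩-* m n = ⟨⟩-cong (trans (cong₂ (λ a b → (a ℕ.* b) % p) (toℕ-⟨⟩ m) (toℕ-⟨⟩ n)) (sym (%-distribˡ-* m n p)))

  private
    -- Every residue is the class of its representative, so an identity need only be checked on
    -- classes `⟨ n ⟩`, where it descends from ℕ.
    via : {A : Set} (P Q : Fin p → A) → (∀ n → P ⟨ n ⟩ ≡ Q ⟨ n ⟩) → ∀ x → P x ≡ Q x
    via P Q h x = subst (λ z → P z ≡ Q z) (⟨toℕ⟩ x) (h (toℕ x))

    assoc-via : (_∙_ : Fin p → Fin p → Fin p) (_∘_ : ℕ → ℕ → ℕ) → (∀ m n → ⟨ m ⟩ ∙ ⟨ n ⟩ ≡ ⟨ m ∘ n ⟩)
      → (∀ a b c → (a ∘ b) ∘ c ≡ a ∘ (b ∘ c)) → ∀ x y z → (x ∙ y) ∙ z ≡ x ∙ (y ∙ z)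
    assoc-via _∙_ _∘_ h as x y z = via (λ x → (x ∙ y) ∙ z) (λ x → x ∙ (y ∙ z)) (λ a →
      via (λ y → (⟨ a ⟩ ∙ y) ∙ z) (λ y → ⟨ a ⟩ ∙ (y ∙ z)) (λ b →
      via (λ z → (⟨ a ⟩ ∙ ⟨ b ⟩) ∙ z) (λ z → ⟨ a ⟩ ∙ (⟨ b ⟩ ∙ z)) (λ c →
        trans (cong (_∙ ⟨ c ⟩) (h a b)) (trans (h (a ∘ b) c) (trans (cong ⟨_⟩ (as a b c))
          (sym (trans (cong (⟨ a ⟩ ∙_) (h b c)) (h a (b ∘ c))))))) z) y) x

  +ᵖ-comm : ∀ x y → x +ᵖ y ≡ y +ᵖ x
  +ᵖ-comm x y = cong ⟨_⟩ (ℕₚ.+-comm (toℕ x) (toℕ y))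

  *ᵖ-comm : ∀ x y → x *ᵖ y ≡ y *ᵖ x
  *ᵖ-comm x y = cong ⟨_⟩ (ℕₚ.*-comm (toℕ x) (toℕ y))

  +ᵖ-identityˡ : ∀ x → 0# +ᵖ x ≡ x
  +ᵖ-identityˡ = via (0# +ᵖ_) (λ x → x) (⟨⟩-+ 0)

  *ᵖ-identityˡ : ∀ x → 1# *ᵖ x ≡ x
  *ᵖ-identityˡ = via (1# *ᵖ_) (λ x → x) (λ n → trans (⟨⟩-* 1 n) (cong ⟨_⟩ (ℕₚ.*-identityˡ n)))

  -ᵖ-inverseˡ : ∀ x → -ᵖ x +ᵖ x ≡ 0#
  -ᵖ-inverseˡ x = trans (cong (-ᵖ x +ᵖ_) (sym (⟨toℕ⟩ x))) (trans (⟨⟩-+ _ (toℕ x))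
    (trans (cong ⟨_⟩ (ℕₚ.m∸n+n≡m (ℕₚ.<⇒≤ (Finₚ.toℕ<n x)))) (⟨⟩-cong (trans (n%n≡0 p) (sym (m<n⇒m%n≡m (ℕ.>-nonZero⁻¹ p)))))))

  *ᵖ-distribˡ-+ᵖ : ∀ x y z → x *ᵖ (y +ᵖ z) ≡ x *ᵖ y +ᵖ x *ᵖ z
  *ᵖ-distribˡ-+ᵖ x y z = via (λ x → x *ᵖ (y +ᵖ z)) (λ x → x *ᵖ y +ᵖ x *ᵖ z) (λ a →
      via (λ y → ⟨ a ⟩ *ᵖ (y +ᵖ z)) (λ y → ⟨ a ⟩ *ᵖ y +ᵖ ⟨ a ⟩ *ᵖ z) (λ b →
      via (λ z → ⟨ a ⟩ *ᵖ (⟨ b ⟩ +ᵖ z)) (λ z → ⟨ a ⟩ *ᵖ ⟨ b ⟩ +ᵖ ⟨ a ⟩ *ᵖ z) (λ c →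
        trans (cong (⟨ a ⟩ *ᵖ_) (⟨⟩-+ b c)) (trans (⟨⟩-* a _) (trans (cong ⟨_⟩ (ℕₚ.*-distribˡ-+ a b c))
          (sym (trans (cong₂ _+ᵖ_ (⟨⟩-* a b) (⟨⟩-* a c)) (⟨⟩-+ _ _)))))) z) y) x

  isCommutativeRing : IsCommutativeRing _≡_ _+ᵖ_ _*ᵖ_ -ᵖ_ 0# 1#
  isCommutativeRing = record
    { isRing = record
      { +-isAbelianGroup = record
        { isGroup = record
          { isMonoid = record
            { isSemigroup = record
              { isMagma = record { isEquivalence = isEquivalence ; ∙-cong = cong₂ _+ᵖ_ }
              ; assoc = assoc-via _+ᵖ_ ℕ._+_ ⟨⟩-+ ℕₚ.+-assoc }
            ; identity = +ᵖ-identityˡ , λ x → trans (+ᵖ-comm x 0#) (+ᵖ-identityˡ x) }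
          ; inverse = -ᵖ-inverseˡ , λ x → trans (+ᵖ-comm x (-ᵖ x)) (-ᵖ-inverseˡ x)
          ; ⁻¹-cong = cong -ᵖ_ }
        ; comm = +ᵖ-comm }
      ; *-cong = cong₂ _*ᵖ_
      ; *-assoc = assoc-via _*ᵖ_ ℕ._*_ ⟨⟩-* ℕₚ.*-assoc
      ; *-identity = *ᵖ-identityˡ , λ x → trans (*ᵖ-comm x 1#) (*ᵖ-identityˡ x)
      ; distrib = *ᵖ-distribˡ-+ᵖ , λ x y z → trans (*ᵖ-comm (y +ᵖ z) x) (trans (*ᵖ-distribˡ-+ᵖ x y z) (cong₂ _+ᵖ_ (*ᵖ-comm x y) (*ᵖ-comm x z)))
      }
    ; *-comm = *ᵖ-comm }

  open RingSolver isCommutativeRing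

  private
    multiple≡0 : ∀ u → ⟨ u ℕ.* p ⟩ ≡ 0#
    multiple≡0 u = ⟨⟩-cong {u ℕ.* p} {0} (trans (m*n%n≡0 u p) (sym (m*n%n≡0 0 p)))

    x≡ : ∀ {x a} → toℕ x ≡ a → x ≡ ⟨ a ⟩
    x≡ {x} eq = trans (sym (⟨toℕ⟩ x)) (cong ⟨_⟩ eq)

  module _ (prime : Prime p) where

    -- Bézout's identity for p and x, read modulo p. Over ℕ it comes in two forms, according to the
    -- coefficient that would be negative.
    invertible : ∀ {x} → x ≢ 0# → Σ (Fin p) λ y → x *ᵖ y ≡ 1#
    invertible {x} x≢0 = go (toℕ x) refl
      where
      go : ∀ a → toℕ x ≡ a → Σ (Fin p) λ y → x *ᵖ y ≡ 1#
      go zero eq = ⊥-elim (x≢0 (x≡ eq))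
      go (suc a) eq with coprime-Bézout (prime⇒coprime prime (subst (ℕ._< p) eq (Finₚ.toℕ<n x)))
      ... | Bézout.-+ u v e = ⟨ v ⟩ , (begin
              x *ᵖ ⟨ v ⟩  ≡⟨ cong (λ z → z *ᵖ ⟨ v ⟩) (x≡ eq) ⟩
              ⟨ suc a ⟩ *ᵖ ⟨ v ⟩  ≡⟨ *ᵖ-comm ⟨ suc a ⟩ ⟨ v ⟩ ⟩
              ⟨ v ⟩ *ᵖ ⟨ suc a ⟩  ≡⟨ ⟨⟩-* v (suc a) ⟩
              ⟨ v ℕ.* suc a ⟩  ≡⟨ cong ⟨_⟩ (sym e) ⟩
              ⟨ 1 ℕ.+ u ℕ.* p ⟩  ≡⟨ sym (⟨⟩-+ 1 (u ℕ.* p)) ⟩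
              1# +ᵖ ⟨ u ℕ.* p ⟩  ≡⟨ cong (λ z → 1# +ᵖ z) (multiple≡0 u) ⟩
              1# +ᵖ 0#  ≡⟨ +ᵖ-comm 1# 0# ⟩
              0# +ᵖ 1#  ≡⟨ +ᵖ-identityˡ 1# ⟩
              1# ∎)
        where
        open ≡-Reasoning
      -- Here 1 + v x is a multiple of p, so v x is -1 and the inverse carries a sign.
      ... | Bézout.+- u v e = -ᵖ ⟨ v ⟩ , (begin
              x *ᵖ -ᵖ ⟨ v ⟩  ≡⟨ cong (λ z → z *ᵖ -ᵖ ⟨ v ⟩) (x≡ eq) ⟩
              ⟨ suc a ⟩ *ᵖ -ᵖ ⟨ v ⟩  ≡⟨ solve 2 (λ x v → x :* :- v := :1 :- (:1 :+ v :* x)) refl ⟨ suc a ⟩ ⟨ v ⟩ ⟩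
              1# +ᵖ -ᵖ (1# +ᵖ ⟨ v ⟩ *ᵖ ⟨ suc a ⟩)  ≡⟨ cong (λ z → 1# +ᵖ -ᵖ z) zero≡ ⟩
              1# +ᵖ -ᵖ 0#  ≡⟨ solve 0 (:1 :- :0 := :1) refl ⟩
              1# ∎)
        where
        open ≡-Reasoning
        zero≡ : 1# +ᵖ ⟨ v ⟩ *ᵖ ⟨ suc a ⟩ ≡ 0#
        zero≡ = begin
          1# +ᵖ ⟨ v ⟩ *ᵖ ⟨ suc a ⟩  ≡⟨ cong (λ z → 1# +ᵖ z) (⟨⟩-* v (suc a)) ⟩
          1# +ᵖ ⟨ v ℕ.* suc a ⟩  ≡⟨ ⟨⟩-+ 1 _ ⟩
          ⟨ 1 ℕ.+ v ℕ.* suc a ⟩  ≡⟨ cong ⟨_⟩ e ⟩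
          ⟨ u ℕ.* p ⟩  ≡⟨ multiple≡0 u ⟩
          0# ∎

    inv : Fin p → Fin p
    inv x with x Finₚ.≟ 0#
    ... | yes _ = 0#
    ... | no x≢0 = proj₁ (invertible x≢0)

    inverse : ∀ {x} → x ≢ 0# → x *ᵖ inv x ≡ 1#
    inverse {x} x≢0 with x Finₚ.≟ 0#
    ... | yes x≡0 = ⊥-elim (x≢0 x≡0)
    ... | no x≢0′ = proj₂ (invertible x≢0′)

    +1-induction : (P : Fin p → Set) → P 0# → (∀ x → P x → P (x +ᵖ 1#)) → ∀ x → P x
    +1-induction P P0 step x = subst P (⟨toℕ⟩ x) (go (toℕ x))
      where go : ∀ n → P ⟨ n ⟩
            go zero = P0
            go (suc n) = subst P (trans (⟨⟩-+ n 1) (cong ⟨_⟩ (ℕₚ.+-comm n 1))) (step ⟨ n ⟩ (go n))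

    𝔽 : PrimeField
    𝔽 = record
      { K = Fin p ; isCommutativeRing = isCommutativeRing ; _≟_ = Finₚ._≟_
      ; inv = inv ; inverse = inverse ; U = allFin p ; U-unique = allFin⁺ p
      ; U-complete = ∈-allFin ; +1-induction = +1-induction }

-- Sums over lists

module Counting where
  private
    variable
      A B : Set
      P Q : Set

  -- The Iverson bracket. Cardinalities are sums of it, which makes double counting an exchange of
  -- sums.
  ⟦_⟧ : Dec P → ℕ
  ⟦ yes _ ⟧ = 1
  ⟦ no _ ⟧ = 0

  ⟦⟧-mono : (p : Dec P) (q : Dec Q) → (P → Q) → ⟦ p ⟧ ≤ ⟦ q ⟧
  ⟦⟧-mono (no _) q f = z≤n
  ⟦⟧-mono (yes p) (yes q) f = ≤-refl
  ⟦⟧-mono (yes p) (no ¬q) f = ⊥-elim (¬q (f p))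

  ⟦⟧-cong : (p : Dec P) (q : Dec Q) → (P → Q) → (Q → P) → ⟦ p ⟧ ≡ ⟦ q ⟧
  ⟦⟧-cong p q f g = ≤-antisym (⟦⟧-mono p q f) (⟦⟧-mono q p g)

  ⟦⟧≤1 : (p : Dec P) → ⟦ p ⟧ ≤ 1
  ⟦⟧≤1 (yes _) = ≤-refl
  ⟦⟧≤1 (no _) = z≤n

  ⟦⟧-yes : (p : Dec P) → P → ⟦ p ⟧ ≡ 1
  ⟦⟧-yes (yes _) _ = refl
  ⟦⟧-yes (no ¬p) p = ⊥-elim (¬p p)

  ⟦⟧-no : (p : Dec P) → ¬ P → ⟦ p ⟧ ≡ 0
  ⟦⟧-no (yes p) ¬p = ⊥-elim (¬p p)
  ⟦⟧-no (no _) _ = refl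

  ⟦×⟧ : (p : Dec P) (q : Dec Q) → ⟦ p ×-dec q ⟧ ≡ ⟦ p ⟧ * ⟦ q ⟧
  ⟦×⟧ (yes p) (yes q) = refl
  ⟦×⟧ (yes p) (no q) = refl
  ⟦×⟧ (no p) q = refl

  ⟦⟧-split : (p : Dec P) (q : Dec Q) → ⟦ p ⟧ ≡ ⟦ p ×-dec q ⟧ + ⟦ p ×-dec ¬? q ⟧
  ⟦⟧-split (yes p) (yes q) = refl
  ⟦⟧-split (yes p) (no q) = refl
  ⟦⟧-split (no p) q = refl

  ⟦⟧*-mono : (p : Dec P) {m n : ℕ} → (P → m ≤ n) → ⟦ p ⟧ * m ≤ ⟦ p ⟧ * n
  ⟦⟧*-mono (yes p) f = +-monoˡ-≤ 0 (f p)
  ⟦⟧*-mono (no _) f = z≤n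

  ⟦⟧*≤ : (p : Dec P) {m : ℕ} → ⟦ p ⟧ * m ≤ m
  ⟦⟧*≤ (yes p) {m} = ≤-reflexive (+-identityʳ m)
  ⟦⟧*≤ (no _) = z≤n

  ∑ : List A → (A → ℕ) → ℕ
  ∑ [] f = 0
  ∑ (x ∷ xs) f = f x + ∑ xs f

  ∑-mono∈ : ∀ (xs : List A) {f g} → (∀ x → x ∈ xs → f x ≤ g x) → ∑ xs f ≤ ∑ xs g
  ∑-mono∈ [] h = z≤n
  ∑-mono∈ (x ∷ xs) h = +-mono-≤ (h x (here refl)) (∑-mono∈ xs λ y y∈ → h y (there y∈))

  ∑-mono : ∀ (xs : List A) {f g} → (∀ x → f x ≤ g x) → ∑ xs f ≤ ∑ xs g
  ∑-mono xs h = ∑-mono∈ xs λ x _ → h x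

  ∑-cong : ∀ (xs : List A) {f g} → (∀ x → f x ≡ g x) → ∑ xs f ≡ ∑ xs g
  ∑-cong [] h = refl
  ∑-cong (x ∷ xs) h = cong₂ _+_ (h x) (∑-cong xs h)

  ∑-zero : ∀ (xs : List A) → ∑ xs (λ _ → 0) ≡ 0
  ∑-zero [] = refl
  ∑-zero (x ∷ xs) = ∑-zero xs

  ∑-const : ∀ (xs : List A) c → ∑ xs (λ _ → c) ≡ length xs * c
  ∑-const [] c = refl
  ∑-const (x ∷ xs) c = cong (c +_) (∑-const xs c)

  private
    interchange : ∀ a b c d → (a + b) + (c + d) ≡ (a + c) + (b + d)
    interchange = solve-∀

  ∑-+ : ∀ (xs : List A) f g → ∑ xs (λ x → f x + g x) ≡ ∑ xs f + ∑ xs g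
  ∑-+ [] f g = refl
  ∑-+ (x ∷ xs) f g = trans (cong (f x + g x +_) (∑-+ xs f g)) (interchange (f x) (g x) _ _)

  ∑-*ˡ : ∀ (xs : List A) c f → ∑ xs (λ x → c * f x) ≡ c * ∑ xs f
  ∑-*ˡ [] c f = sym (*-zeroʳ c)
  ∑-*ˡ (x ∷ xs) c f = trans (cong (c * f x +_) (∑-*ˡ xs c f)) (sym (*-distribˡ-+ c (f x) _))

  ∑-*ʳ : ∀ (xs : List A) f c → ∑ xs (λ x → f x * c) ≡ ∑ xs f * c
  ∑-*ʳ xs f c = trans (∑-cong xs λ x → *-comm (f x) c) (trans (∑-*ˡ xs c f) (*-comm c _))

  ∑-swap : ∀ (xs : List A) (ys : List B) (f : A → B → ℕ) →
    ∑ xs (λ x → ∑ ys (f x)) ≡ ∑ ys (λ y → ∑ xs λ x → f x y)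
  ∑-swap [] ys f = sym (∑-zero ys)
  ∑-swap (x ∷ xs) ys f = trans (cong (∑ ys (f x) +_) (∑-swap xs ys f))
    (sym (∑-+ ys (f x) (λ y → ∑ xs λ x → f x y)))

  ∑-product : ∀ (xs : List A) (ys : List B) f g →
    ∑ xs f * ∑ ys g ≡ ∑ xs λ x → ∑ ys λ y → f x * g y
  ∑-product xs ys f g = trans (sym (∑-*ʳ xs f _)) (∑-cong xs λ x → sym (∑-*ˡ ys (f x) g))

  ∑-++ : ∀ (xs ys : List A) f → ∑ (xs ++ ys) f ≡ ∑ xs f + ∑ ys f
  ∑-++ [] ys f = refl
  ∑-++ (x ∷ xs) ys f = trans (cong (f x +_) (∑-++ xs ys f)) (sym (+-assoc (f x) _ _))

  ∑-map : ∀ (g : A → B) xs f → ∑ (map g xs) f ≡ ∑ xs λ x → f (g x)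
  ∑-map g [] f = refl
  ∑-map g (x ∷ xs) f = cong (f (g x) +_) (∑-map g xs f)

  ∑-cartesian : ∀ (xs : List A) (ys : List B) f →
    ∑ (cartesianProduct xs ys) f ≡ ∑ xs λ x → ∑ ys λ y → f (x , y)
  ∑-cartesian [] ys f = refl
  ∑-cartesian (x ∷ xs) ys f = trans (∑-++ (map (x ,_) ys) _ f)
    (cong₂ _+_ (∑-map (x ,_) ys f) (∑-cartesian xs ys f))

  ∑-filter : ∀ {P : A → Set} (P? : Decidable P) xs f → ∑ (filter P? xs) f ≡ ∑ xs λ x → ⟦ P? x ⟧ * f x
  ∑-filter P? [] f = refl
  ∑-filter P? (x ∷ xs) f with P? x
  ... | yes _ = cong₂ _+_ (sym (+-identityʳ (f x))) (∑-filter P? xs f)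
  ... | no _ = ∑-filter P? xs f

  length-filter : ∀ {P : A → Set} (P? : Decidable P) xs → length (filter P? xs) ≡ ∑ xs λ x → ⟦ P? x ⟧
  length-filter P? xs = trans (sym (trans (∑-const (filter P? xs) 1) (*-identityʳ _)))
    (trans (∑-filter P? xs (λ _ → 1)) (∑-cong xs λ x → *-identityʳ _))

  -- The form of pigeonhole behind every averaging argument here: comparing two sums, rather than a
  -- sum with its mean, avoids division.
  ∑-exists≤ : ∀ (xs : List A) {f g} → 0 < length xs → ∑ xs f ≤ ∑ xs g → ∃ λ x → x ∈ xs × f x ≤ g x
  ∑-exists≤ (x ∷ xs) {f} {g} _ = go x xs
    where
    go : ∀ x xs → ∑ (x ∷ xs) f ≤ ∑ (x ∷ xs) g → ∃ λ y → y ∈ x ∷ xs × f y ≤ g y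
    go x [] h = x , here refl , subst₂ _≤_ (+-identityʳ _) (+-identityʳ _) h
    go x (y ∷ xs) h with f x ≤? g x
    ... | yes le = x , here refl , le
    ... | no nle with go y xs (+-cancelˡ-≤ (g x) _ _ (≤-trans (+-monoˡ-≤ _ (<⇒≤ (≰⇒> nle))) h))
    ... | z , z∈ , le = z , there z∈ , le

  ∑-at-most-one : ∀ {P : A → Set} (P? : Decidable P) xs → Unique xs →
    (∀ {x y} → x ∈ xs → y ∈ xs → P x → P y → x ≡ y) → ∑ xs (λ x → ⟦ P? x ⟧) ≤ 1
  ∑-at-most-one P? [] u h = z≤n
  ∑-at-most-one P? (x ∷ xs) (x∉ ∷ u) h with P? x
  ... | no _ = ∑-at-most-one P? xs u λ x∈ y∈ → h (there x∈) (there y∈)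
  ... | yes px = s≤s (≤-trans (∑-mono∈ xs λ y y∈ → ≤-reflexive (⟦⟧-no (P? y)
          λ py → All.lookup x∉ y∈ (h (here refl) (there y∈) px py))) (≤-reflexive (∑-zero xs)))

  ∑-single : ∀ (xs : List A) f {x} → x ∈ xs → f x ≤ ∑ xs f
  ∑-single (x ∷ xs) f (here refl) = m≤m+n _ _
  ∑-single (y ∷ xs) f (there x∈) = ≤-trans (∑-single xs f x∈) (m≤n+m _ _)

  -- Double counting of the pairs (x , f x): every x with `P` occurs in one of them, every y with
  -- `Q` in at most one.
  ∑-injection : ∀ {P : A → Set} {Q : B → Set} (P? : Decidable P) (Q? : Decidable Q) →
    DecidableEquality B → ∀ xs ys → Unique xs → (f : A → B) →
    (∀ {x} → x ∈ xs → P x → f x ∈ ys × Q (f x)) →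
    (∀ {x y} → x ∈ xs → y ∈ xs → P x → P y → f x ≡ f y → x ≡ y) →
    ∑ xs (λ x → ⟦ P? x ⟧) ≤ ∑ ys (λ y → ⟦ Q? y ⟧)
  ∑-injection {P = P} {Q = Q} P? Q? _≟_ xs ys u f into inj = begin
    ∑ xs (λ x → ⟦ P? x ⟧)  ≤⟨ ∑-mono∈ xs left ⟩
    ∑ xs (λ x → ∑ ys λ y → ⟦ both? x y ⟧)  ≡⟨ ∑-swap xs ys _ ⟩
    ∑ ys (λ y → ∑ xs λ x → ⟦ both? x y ⟧)  ≤⟨ ∑-mono ys right ⟩
    ∑ ys (λ y → ⟦ Q? y ⟧) ∎
    where
    open ≤-Reasoning
    both? : ∀ x y → Dec (P x × Q y × f x ≡ y)
    both? x y = P? x ×-dec (Q? y ×-dec (f x ≟ y))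
    left : ∀ x → x ∈ xs → ⟦ P? x ⟧ ≤ ∑ ys λ y → ⟦ both? x y ⟧
    left x x∈ with P? x in eq
    ... | no _ = z≤n
    ... | yes px with into x∈ px
    ... | fx∈ , qfx = ≤-trans (≤-reflexive (sym (⟦⟧-yes (yes px ×-dec (Q? (f x) ×-dec (f x ≟ f x))) (px , qfx , refl))))
                        (∑-single ys (λ y → ⟦ yes px ×-dec (Q? y ×-dec (f x ≟ y)) ⟧) fx∈)
    right : ∀ y → ∑ xs (λ x → ⟦ both? x y ⟧) ≤ ⟦ Q? y ⟧
    right y with Q? y
    ... | yes qy = ∑-at-most-one (λ x → P? x ×-dec (yes qy ×-dec (f x ≟ y))) xs u
                    λ { x∈ x′∈ (p , _ , e) (p′ , _ , e′) → inj x∈ x′∈ p p′ (trans e (sym e′)) }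
    ... | no ¬qy = ≤-trans (∑-mono xs λ x → ≤-reflexive (⟦⟧-no (P? x ×-dec (no ¬qy ×-dec (f x ≟ y)))
                    λ { (_ , q , _) → ¬qy q })) (≤-reflexive (∑-zero xs))

  am-gm : ∀ a b → 2 * (a * b) ≤ a * a + b * b
  am-gm a b with ≤-total a b
  ... | inj₁ a≤b = subst (λ b → 2 * (a * b) ≤ a * a + b * b) (m+[n∸m]≡n a≤b) (lemma a (b ∸ a))
    where
    expand : ∀ a d → a * a + (a + d) * (a + d) ≡ 2 * (a * (a + d)) + d * d
    expand = solve-∀
    lemma : ∀ a d → 2 * (a * (a + d)) ≤ a * a + (a + d) * (a + d)
    lemma a d = subst (2 * (a * (a + d)) ≤_) (sym (expand a d)) (m≤m+n _ _)
  ... | inj₂ b≤a = subst (λ a → 2 * (a * b) ≤ a * a + b * b) (m+[n∸m]≡n b≤a) (lemma b (a ∸ b))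
    where
    expand : ∀ b d → (b + d) * (b + d) + b * b ≡ 2 * ((b + d) * b) + d * d
    expand = solve-∀
    lemma : ∀ b d → 2 * ((b + d) * b) ≤ (b + d) * (b + d) + b * b
    lemma b d = subst (2 * ((b + d) * b) ≤_) (sym (expand b d)) (m≤m+n _ _)

  -- Summing 2 f x f y ≤ (f x)² + (f y)² over all pairs needs no subtraction and so works over ℕ.
  cauchy-schwarz : ∀ (xs : List A) f → ∑ xs f * ∑ xs f ≤ length xs * ∑ xs (λ x → f x * f x)
  cauchy-schwarz xs f = *-cancelˡ-≤ 2 (begin
    2 * (∑ xs f * ∑ xs f)  ≡⟨ cong (2 *_) (∑-product xs xs f f) ⟩
    2 * ∑ xs (λ x → ∑ xs λ y → f x * f y)  ≡⟨ sym (∑-*ˡ xs 2 _) ⟩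
    ∑ xs (λ x → 2 * ∑ xs λ y → f x * f y)  ≡⟨ ∑-cong xs (λ x → sym (∑-*ˡ xs 2 _)) ⟩
    ∑ xs (λ x → ∑ xs λ y → 2 * (f x * f y))  ≤⟨ ∑-mono xs (λ x → ∑-mono xs λ y → am-gm (f x) (f y)) ⟩
    ∑ xs (λ x → ∑ xs λ y → f x * f x + f y * f y)  ≡⟨ ∑-cong xs (λ x → ∑-+ xs _ _) ⟩
    ∑ xs (λ x → ∑ xs (λ y → f x * f x) + S)  ≡⟨ ∑-+ xs _ _ ⟩
    ∑ xs (λ x → ∑ xs λ y → f x * f x) + ∑ xs (λ _ → S)  ≡⟨ cong₂ _+_ (trans (∑-cong xs λ x → ∑-const xs _) (∑-*ˡ xs (length xs) _)) (∑-const xs S) ⟩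
    length xs * S + length xs * S  ≡⟨ double (length xs * S) ⟩
    2 * (length xs * S) ∎)
    where
    open ≤-Reasoning
    S = ∑ xs (λ x → f x * f x)
    double : ∀ a → a + a ≡ 2 * a
    double = solve-∀

open Counting

-- Sumsets, the Ruzsa triangle inequality and Petridis' lemma

sublists : {A : Set} → List A → List (List A)
sublists [] = [] ∷ []
sublists (x ∷ xs) = map (x ∷_) (sublists xs) ++ sublists xs

filter∈sublists : ∀ {A : Set} {P : A → Set} (P? : Decidable P) xs → filter P? xs ∈ sublists xs
filter∈sublists P? [] = here refl
filter∈sublists P? (x ∷ xs) with P? x
... | yes _ = ∈-++⁺ˡ (∈-map⁺ (x ∷_) (filter∈sublists P? xs))
... | no _ = ∈-++⁺ʳ (map (x ∷_) (sublists xs)) (filter∈sublists P? xs)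

-- Fixes one witness per element, with `b` as the value where `P` fails. Fixed representations are
-- what makes the maps of the Ruzsa and Balog-Szemerédi-Gowers arguments injective.
choose : ∀ {A B : Set} {P : A → Set} {R : A → B → Set} → Decidable P → B → (∀ {a} → P a → ∃ (R a)) →
  Σ (A → B) λ f → ∀ {a} → P a → R a (f a)
choose {A} {B} {P} {R} P? b h = (λ a → proj₁ (pick a)) , λ {a} → proj₂ (pick a)
  where
  pick : ∀ a → Σ B λ b → P a → R a b
  pick a with P? a
  ... | yes p = proj₁ (h p) , λ _ → proj₂ (h p)
  ... | no ¬p = b , λ p → ⊥-elim (¬p p)

module Sets (F : PrimeField) where
  open PrimeField F
  open RingSolver isCommutativeRing using (solve; _:=_; _:+_; _:*_; :-_; _:-_; :0; :1)

  record Subset : Set₁ where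
    field
      _∋_ : K → Set
      _∋?_ : ∀ x → Dec (_∋_ x)
  open Subset public

  ∃? : {P : K → Set} → Decidable P → Dec (∃ P)
  ∃? P? = map′ (λ a → let x , _ , px = find a in x , px) (λ { (x , px) → lose (U-complete x) px }) (Any.any? P? U)

  #_ : Subset → ℕ
  # A = ∑ U λ x → ⟦ A ∋? x ⟧

  el : Subset → List K
  el A = filter (A ∋?_) U

  length-el : ∀ A → length (el A) ≡ # A
  length-el A = length-filter (A ∋?_) U

  ∈-el⁺ : ∀ {A x} → A ∋ x → x ∈ el A
  ∈-el⁺ {A} a = ∈-filter⁺ (A ∋?_) (U-complete _) a

  ∈-el⁻ : ∀ {A x} → x ∈ el A → A ∋ x
  ∈-el⁻ {A} x∈ = proj₂ (∈-filter⁻ (A ∋?_) {xs = U} x∈)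

  infix 4 _⊆_
  _⊆_ : Subset → Subset → Set
  A ⊆ B = ∀ {x} → A ∋ x → B ∋ x

  #-mono : ∀ {A B} → A ⊆ B → # A ≤ # B
  #-mono {A} {B} h = ∑-mono U λ x → ⟦⟧-mono (A ∋? x) (B ∋? x) h

  #-injection : ∀ {A B} (f : K → K) → (∀ {x} → A ∋ x → B ∋ f x) →
    (∀ {x y} → A ∋ x → A ∋ y → f x ≡ f y → x ≡ y) → # A ≤ # B
  #-injection {A} {B} f into inj = ∑-injection (A ∋?_) (B ∋?_) _≟_ U U U-unique f
    (λ _ a → U-complete _ , into a) (λ _ _ → inj)

  infixl 6 _∩_ _∖_ _⊕_
  infixr 7 _·_

  _∩_ _∖_ _⊕_ : Subset → Subset → Subset
  A ∩ B = record { _∋_ = λ x → A ∋ x × B ∋ x ; _∋?_ = λ x → (A ∋? x) ×-dec (B ∋? x) }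
  A ∖ B = record { _∋_ = λ x → A ∋ x × ¬ B ∋ x ; _∋?_ = λ x → (A ∋? x) ×-dec ¬? (B ∋? x) }
  A ⊕ B = record { _∋_ = λ z → ∃ λ a → ∃ λ b → A ∋ a × B ∋ b × z ≡ a +ᶠ b
                 ; _∋?_ = λ z → ∃? λ a → ∃? λ b → (A ∋? a) ×-dec (B ∋? b) ×-dec (z ≟ (a +ᶠ b)) }

  _·_ : K → Subset → Subset
  t · A = record { _∋_ = λ z → ∃ λ a → A ∋ a × z ≡ t *ᶠ a ; _∋?_ = λ z → ∃? λ a → (A ∋? a) ×-dec (z ≟ (t *ᶠ a)) }

  #-split : ∀ A B → # A ≡ # (A ∩ B) + # (A ∖ B)
  #-split A B = trans (∑-cong U λ x → ⟦⟧-split (A ∋? x) (B ∋? x)) (∑-+ U _ _)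

  ⊕-mono : ∀ {A A′ B B′} → A ⊆ A′ → B ⊆ B′ → A ⊕ B ⊆ A′ ⊕ B′
  ⊕-mono f g (a , b , a∈ , b∈ , eq) = a , b , f a∈ , g b∈ , eq

  U² : List (K × K)
  U² = cartesianProduct U U

  _≟²_ : (x y : K × K) → Dec (x ≡ y)
  _≟²_ = ≡-dec _≟_ _≟_

  #-product : ∀ A B → # A * # B ≡ ∑ U² λ { (a , b) → ⟦ (A ∋? a) ×-dec (B ∋? b) ⟧ }
  #-product A B = trans (∑-product U U _ _) (trans
    (∑-cong U λ a → ∑-cong U λ b → sym (⟦×⟧ (A ∋? a) (B ∋? b))) (sym (∑-cartesian U U _)))

  +-cancelˡᶠ : ∀ {a b c} → a +ᶠ b ≡ a +ᶠ c → b ≡ c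
  +-cancelˡᶠ {a} {b} {c} eq = trans (lem a b) (trans (cong (_-ᶠ a) eq) (sym (lem a c)))
    where
    lem : ∀ a b → b ≡ a +ᶠ b -ᶠ a
    lem = solve 2 (λ a b → b := a :+ b :- a) refl

  +-cancelʳᶠ : ∀ {a b c} → b +ᶠ a ≡ c +ᶠ a → b ≡ c
  +-cancelʳᶠ {a} {b} {c} eq = trans (lem a b) (trans (cong (_-ᶠ a) eq) (sym (lem a c)))
    where
    lem : ∀ a b → b ≡ b +ᶠ a -ᶠ a
    lem = solve 2 (λ a b → b := b :+ a :- a) refl

  *-cancelˡᶠ : ∀ {t a b} → t ≢ 0ᶠ → t *ᶠ a ≡ t *ᶠ b → a ≡ b
  *-cancelˡᶠ {t} {a} {b} t≢0 eq = trans (lem a) (trans (cong (λ z → inv t *ᶠ z) eq) (sym (lem b)))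
    where
    assoc : ∀ t i a → (t *ᶠ i) *ᶠ a ≡ i *ᶠ (t *ᶠ a)
    assoc = solve 3 (λ t i a → (t :* i) :* a := i :* (t :* a)) refl
    lem : ∀ a → a ≡ inv t *ᶠ (t *ᶠ a)
    lem a = trans (solve 1 (λ a → a := :1 :* a) refl a) (trans (cong (_*ᶠ a) (sym (inverse t≢0))) (assoc t (inv t) a))

  #-scale : ∀ {A B} t → t ≢ 0ᶠ → (∀ {x} → A ∋ x → B ∋ (t *ᶠ x)) → # A ≤ # B
  #-scale t t≢0 h = #-injection (t *ᶠ_) h λ _ _ → *-cancelˡᶠ t≢0

  #-dilate : ∀ {t} A → t ≢ 0ᶠ → # A ≤ # (t · A)
  #-dilate {t} A t≢0 = #-scale t t≢0 λ {x} a → x , a , refl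

  -- With a fixed representation w = β - γ, the map (w , x) ↦ (x + β , x + γ) is injective: the
  -- difference of the image is w, which determines β and then x. Only translates of `X` have to lie
  -- in `P` and `Q`, so these may be sumsets built on different sets.
  ruzsa-triangle : ∀ W X P Q →
    (∀ {w} → W ∋ w → ∃ λ { (β , γ) → w ≡ β -ᶠ γ × (∀ {x} → X ∋ x → P ∋ (x +ᶠ β) × Q ∋ (x +ᶠ γ)) }) →
    # W * # X ≤ # P * # Q
  ruzsa-triangle W X P Q h with choose (W ∋?_) (0ᶠ , 0ᶠ) h
  ... | rep , spec = subst₂ _≤_ (sym (#-product W X)) (sym (#-product P Q))
    (∑-injection _ _ _≟²_ U² U² (cartesianProduct⁺ U-unique U-unique)
      (λ { (w , x) → x +ᶠ proj₁ (rep w) , x +ᶠ proj₂ (rep w) })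
      (λ { _ (w∈ , x∈) → ∈-cartesianProduct⁺ (U-complete _) (U-complete _) , proj₂ (spec w∈) x∈ })
      λ { {w , x} {w′ , x′} _ _ (w∈ , x∈) (w∈′ , x∈′) eq → inj w∈ w∈′ (cong proj₁ eq) (cong proj₂ eq) })
    where
    lem : ∀ x β γ → β -ᶠ γ ≡ (x +ᶠ β) -ᶠ (x +ᶠ γ)
    lem = solve 3 (λ x β γ → β :- γ := (x :+ β) :- (x :+ γ)) refl
    inj : ∀ {w x w′ x′} → W ∋ w → W ∋ w′ → x +ᶠ proj₁ (rep w) ≡ x′ +ᶠ proj₁ (rep w′) →
      x +ᶠ proj₂ (rep w) ≡ x′ +ᶠ proj₂ (rep w′) → (w , x) ≡ (w′ , x′)
    inj {w} {x} {w′} {x′} w∈ w∈′ e₁ e₂ with trans (proj₁ (spec w∈)) (trans (lem x _ _) (trans (cong₂ _-ᶠ_ e₁ e₂) (sym (trans (proj₁ (spec w∈′)) (lem x′ _ _)))))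
    ... | refl = cong (w ,_) (+-cancelʳᶠ e₁)

  module _ (X B : Subset) (k : ℕ) where
    private
      ⌈_⌉ : List K → Subset
      ⌈ zs ⌉ = record { _∋_ = _∈ zs ; _∋?_ = λ x → Any.any? (x ≟_) zs }

      -- Minimising this sum instead of the ratio |Z ⊕ B| / |Z| of Petridis forces the minimiser to be large.
      cost : List K → ℕ
      cost zs = # ((⌈ zs ⌉ ∩ X) ⊕ B) + k * # (X ∖ ⌈ zs ⌉)

      best : List K
      best = argmin cost U (sublists U)

      optimal : ∀ Z → cost best ≤ cost (el Z)
      optimal Z = All.lookup (f[argmin]≤f[xs] {f = cost} U (sublists U)) (filter∈sublists (Z ∋?_) U)

    core : Subset
    core = ⌈ best ⌉ ∩ X

    -- Replacing the core by a subset raises the penalty by at most k per element given up, and the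
    -- cost cannot fall.
    core-minimal : ∀ Z → Z ⊆ core → # (core ⊕ B) ≤ # (Z ⊕ B) + k * # (core ∖ Z)
    core-minimal Z Z⊆ = +-cancelʳ-≤ (k * # (X ∖ ⌈ best ⌉)) _ _ (begin
      # (core ⊕ B) + k * # (X ∖ ⌈ best ⌉)  ≤⟨ optimal Z ⟩
      # ((⌈ el Z ⌉ ∩ X) ⊕ B) + k * # (X ∖ ⌈ el Z ⌉)  ≤⟨ +-mono-≤
        (#-mono {(⌈ el Z ⌉ ∩ X) ⊕ B} {Z ⊕ B} λ { (a , b , (a∈ , _) , b∈ , eq) → a , b , ∈-el⁻ {Z} a∈ , b∈ , eq })
        (*-monoʳ-≤ k rest) ⟩
      # (Z ⊕ B) + k * (# (core ∖ Z) + # (X ∖ ⌈ best ⌉))  ≡⟨ rearrange (# (Z ⊕ B)) k _ _ ⟩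
      # (Z ⊕ B) + k * # (core ∖ Z) + k * # (X ∖ ⌈ best ⌉) ∎)
      where
      open ≤-Reasoning
      rearrange : ∀ a k b c → a + k * (b + c) ≡ a + k * b + k * c
      rearrange = solve-∀
      rest : # (X ∖ ⌈ el Z ⌉) ≤ # (core ∖ Z) + # (X ∖ ⌈ best ⌉)
      rest = begin
        # (X ∖ ⌈ el Z ⌉)  ≡⟨ #-split (X ∖ ⌈ el Z ⌉) ⌈ best ⌉ ⟩
        # (X ∖ ⌈ el Z ⌉ ∩ ⌈ best ⌉) + # (X ∖ ⌈ el Z ⌉ ∖ ⌈ best ⌉) ≤⟨ +-mono-≤
          (#-mono {X ∖ ⌈ el Z ⌉ ∩ ⌈ best ⌉} {core ∖ Z} λ { ((x , z) , b) → (b , x) , λ z∈ → z (∈-el⁺ {Z} z∈) })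
          (#-mono {X ∖ ⌈ el Z ⌉ ∖ ⌈ best ⌉} {X ∖ ⌈ best ⌉} λ { ((x , z) , b) → x , b }) ⟩
        # (core ∖ Z) + # (X ∖ ⌈ best ⌉) ∎

    -- The competitor is all of `X`, whose penalty is zero.
    core-deficit : k * # (X ∖ core) ≤ # (X ⊕ B)
    core-deficit = begin
      k * # (X ∖ core)  ≤⟨ *-monoʳ-≤ k (#-mono {X ∖ core} {X ∖ ⌈ best ⌉} λ { (x , c) → x , λ b → c (b , x) }) ⟩
      k * # (X ∖ ⌈ best ⌉)  ≤⟨ m≤n+m _ _ ⟩
      cost best  ≤⟨ optimal X ⟩
      # ((⌈ el X ⌉ ∩ X) ⊕ B) + k * # (X ∖ ⌈ el X ⌉) ≤⟨ +-mono-≤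
        (#-mono {(⌈ el X ⌉ ∩ X) ⊕ B} {X ⊕ B} λ { (a , b , (_ , a∈) , b∈ , eq) → a , b , a∈ , b∈ , eq })
        (≤-reflexive (trans (cong (k *_) none) (*-zeroʳ k))) ⟩
      # (X ⊕ B) + 0  ≡⟨ +-identityʳ _ ⟩
      # (X ⊕ B) ∎
      where
      open ≤-Reasoning
      none : # (X ∖ ⌈ el X ⌉) ≡ 0
      none = trans (∑-cong U λ x → ⟦⟧-no ((X ∖ ⌈ el X ⌉) ∋? x) λ { (x , z) → z (∈-el⁺ {X} x) }) (∑-zero U)

    private
      shifts : Subset → List K → Subset
      shifts A cs = record { _∋_ = λ z → Any (λ c → A ∋ (z -ᶠ c)) cs ; _∋?_ = λ z → Any.any? (λ c → A ∋? (z -ᶠ c)) cs }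

      add-sub : ∀ x c → x ≡ x +ᶠ c -ᶠ c
      add-sub = solve 2 (λ x c → x := x :+ c :- c) refl

      -- Petridis' induction: adjoin c to the second summand and let `Z` be the x of the core for
      -- which x + c is already covered. Then Z + B + c is covered too, so by minimality the left
      -- side gains at most k times the number of elements of the core outside `Z`; the translates
      -- of these by c are new on the right.
      shifts-bound : ∀ cs → # (shifts (core ⊕ B) cs) ≤ k * # (shifts core cs)
      shifts-bound [] = ≤-trans (≤-reflexive (∑-zero U)) z≤n
      shifts-bound (c ∷ cs) = begin
        # E′  ≡⟨ #-split E′ E ⟩
        # (E′ ∩ E) + # (E′ ∖ E)  ≤⟨ +-mono-≤ (#-mono {E′ ∩ E} {E} proj₂) new ⟩
        # E + # (core ⊕ B ∖ (Z ⊕ B))  ≤⟨ +-mono-≤ (shifts-bound cs) new′ ⟩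
        k * # G + k * # (core ∖ Z)  ≡⟨ sym (*-distribˡ-+ k (# G) _) ⟩
        k * (# G + # (core ∖ Z))  ≤⟨ *-monoʳ-≤ k grow ⟩
        k * # G′ ∎
        where
        open ≤-Reasoning
        E′ = shifts (core ⊕ B) (c ∷ cs)
        E = shifts (core ⊕ B) cs
        G′ = shifts core (c ∷ cs)
        G = shifts core cs
        Z : Subset
        Z = record { _∋_ = λ x → core ∋ x × G ∋ (x +ᶠ c) ; _∋?_ = λ x → (core ∋? x) ×-dec (G ∋? (x +ᶠ c)) }
        lem : ∀ x b c d → (x +ᶠ c -ᶠ d) +ᶠ b ≡ (x +ᶠ b) +ᶠ c -ᶠ d
        lem = solve 4 (λ x b c d → (x :+ c :- d) :+ b := (x :+ b) :+ c :- d) refl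
        sub-add : ∀ z c → z ≡ z -ᶠ c +ᶠ c
        sub-add = solve 2 (λ z c → z := z :- c :+ c) refl
        into : ∀ {z} → (E′ ∖ E) ∋ z → (core ⊕ B ∖ (Z ⊕ B)) ∋ (z -ᶠ c)
        into (there e , ¬e) = ⊥-elim (¬e e)
        into {z} (here e , ¬e) = e , λ { (x , b , (x∈ , xc) , b∈ , eq) → ¬e (Any.map (λ {d} h → x +ᶠ c -ᶠ d , b , h , b∈ ,
          trans (cong (_-ᶠ d) (trans (sub-add z c) (cong (_+ᶠ c) eq))) (sym (lem x b c d))) xc) }
        new : # (E′ ∖ E) ≤ # (core ⊕ B ∖ (Z ⊕ B))
        new = #-injection {E′ ∖ E} {core ⊕ B ∖ (Z ⊕ B)} (_-ᶠ c) into λ _ _ → +-cancelʳᶠ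
        new′ : # (core ⊕ B ∖ (Z ⊕ B)) ≤ k * # (core ∖ Z)
        new′ = +-cancelˡ-≤ (# (Z ⊕ B)) _ _ (begin
          # (Z ⊕ B) + # (core ⊕ B ∖ (Z ⊕ B))  ≤⟨ +-monoˡ-≤ _
            (#-mono {Z ⊕ B} {(core ⊕ B) ∩ (Z ⊕ B)} λ zb → ⊕-mono {Z} {core} {B} {B} proj₁ (λ b → b) zb , zb) ⟩
          # ((core ⊕ B) ∩ (Z ⊕ B)) + # (core ⊕ B ∖ (Z ⊕ B))  ≡⟨ sym (#-split (core ⊕ B) (Z ⊕ B)) ⟩
          # (core ⊕ B)  ≤⟨ core-minimal Z proj₁ ⟩
          # (Z ⊕ B) + k * # (core ∖ Z) ∎)
        grow : # G + # (core ∖ Z) ≤ # G′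
        grow = begin
          # G + # (core ∖ Z)  ≤⟨ +-mono-≤ (#-mono {G} {G′ ∩ G} λ f → there f , f)
            (#-injection {core ∖ Z} {G′ ∖ G} (_+ᶠ c)
              (λ { {x} (x∈ , ¬z) → here (subst (core ∋_) (add-sub x c) x∈) , λ f → ¬z (x∈ , f) })
              λ _ _ → +-cancelʳᶠ) ⟩
          # (G′ ∩ G) + # (G′ ∖ G)  ≡⟨ sym (#-split G′ G) ⟩
          # G′ ∎

    core-growth : ∀ C → # (core ⊕ B ⊕ C) ≤ k * # (core ⊕ C)
    core-growth C = begin
      # (core ⊕ B ⊕ C)  ≤⟨ #-mono {core ⊕ B ⊕ C} {shifts (core ⊕ B) (el C)} (λ { {z} (a , c , a∈ , c∈ , eq) →
              lose (∈-el⁺ {C} c∈) (subst ((core ⊕ B) ∋_) (trans (add-sub a c) (cong (_-ᶠ c) (sym eq))) a∈) }) ⟩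
      # (shifts (core ⊕ B) (el C))  ≤⟨ shifts-bound (el C) ⟩
      k * # (shifts core (el C))  ≤⟨ *-monoʳ-≤ k (#-mono {shifts core (el C)} {core ⊕ C} λ {z} s →
              let c , c∈ , h = find s in z -ᶠ c , c , h , ∈-el⁻ {C} c∈ , sub-add z c) ⟩
      k * # (core ⊕ C) ∎
      where
      open ≤-Reasoning
      sub-add : ∀ z c → z ≡ z -ᶠ c +ᶠ c
      sub-add = solve 2 (λ z c → z := z :- c :+ c) refl

  -- The penalty 2k in place of k ensures that at most half of `X` is lost. A core of known
  -- proportion can itself be the starting set for another multiplier.
  petridis : ∀ X B k → 1 ≤ k → # (X ⊕ B) ≤ k * # X →
    ∃ λ X′ → X′ ⊆ X × # X ≤ 2 * # X′ × (∀ C → # (X′ ⊕ B ⊕ C) ≤ 2 * k * # (X′ ⊕ C))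
  petridis X B k@(suc _) _ h = X′ , proj₂ , large , core-growth X B (2 * k)
    where
    open ≤-Reasoning
    X′ = core X B (2 * k)
    half : 2 * # (X ∖ X′) ≤ # X
    half = *-cancelˡ-≤ k (begin
      k * (2 * # (X ∖ X′))  ≡⟨ lem k (# (X ∖ X′)) ⟩
      2 * k * # (X ∖ X′)  ≤⟨ core-deficit X B (2 * k) ⟩
      # (X ⊕ B)  ≤⟨ h ⟩
      k * # X ∎)
      where
      lem : ∀ k x → k * (2 * x) ≡ 2 * k * x
      lem = solve-∀
    large : # X ≤ 2 * # X′
    large = +-cancelʳ-≤ (# X) _ _ (begin
      # X + # X  ≡⟨ cong (λ x → x + x) (#-split X X′) ⟩
      (# (X ∩ X′) + # (X ∖ X′)) + (# (X ∩ X′) + # (X ∖ X′)) ≡⟨ lem (# (X ∩ X′)) _ ⟩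
      2 * # (X ∩ X′) + 2 * # (X ∖ X′)  ≤⟨ +-mono-≤ (*-monoʳ-≤ 2 (#-mono {X ∩ X′} {X′} proj₂)) half ⟩
      2 * # X′ + # X ∎)
      where
      lem : ∀ a b → (a + b) + (a + b) ≡ 2 * a + 2 * b
      lem = solve-∀

-- Growth of a set under many multipliers

module Pivot (F : PrimeField) where
  open PrimeField F
  open RingSolver isCommutativeRing using (solve; _:=_; _:+_; _:*_; :-_; _:-_; :0; :1)
  open Sets F

  sub≡0 : ∀ {x y} → x -ᶠ y ≡ 0ᶠ → x ≡ y
  sub≡0 {x} {y} e = trans (solve 2 (λ x y → x := x :- y :+ y) refl x y)
    (trans (cong (_+ᶠ y) e) (solve 1 (λ y → :0 :+ y := y) refl y))

  neg≢0 : ∀ {x} → x ≢ 0ᶠ → -ᶠ x ≢ 0ᶠ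
  neg≢0 {x} x≢0 e = x≢0 (trans (solve 1 (λ x → x := :- (:- x)) refl x) (trans (cong -ᶠ_ e) (solve 0 (:- :0 := :0) refl)))

  #-dilate≤ : ∀ {t} A → t ≢ 0ᶠ → # (t · A) ≤ # A
  #-dilate≤ {t} A t≢0 = #-scale {t · A} {A} (inv t) inv≢0 λ { (a , a∈ , refl) → subst (A ∋_) (cancel a) a∈ }
    where
    cancel : ∀ a → a ≡ inv t *ᶠ (t *ᶠ a)
    cancel a = trans (solve 1 (λ a → a := :1 :* a) refl a) (trans (cong (_*ᶠ a) (sym (inverse t≢0)))
      (solve 3 (λ t i a → (t :* i) :* a := i :* (t :* a)) refl t (inv t) a))
    inv≢0 : inv t ≢ 0ᶠ
    inv≢0 e = t≢0 (trans (solve 1 (λ a → a := :1 :* a) refl t) (trans (cong (_*ᶠ t) (sym (inverse t≢0)))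
      (trans (cong (λ i → t *ᶠ i *ᶠ t) e) (solve 1 (λ t → t :* :0 :* t := :0) refl t))))

  two-elements : ∀ {A} → 2 ≤ # A → ∃ λ x → ∃ λ y → A ∋ x × A ∋ y × x ≢ y
  two-elements {A} h with ∃? (λ x → ∃? λ y → (A ∋? x) ×-dec ((A ∋? y) ×-dec ¬? (x ≟ y)))
  ... | yes r = r
  ... | no none = ⊥-elim (<-irrefl refl (≤-trans h (∑-at-most-one (A ∋?_) U U-unique λ {x} {y} _ _ → same x y)))
    where
    same : ∀ x y → A ∋ x → A ∋ y → x ≡ y
    same x y x∈ y∈ with x ≟ y
    ... | yes e = e
    ... | no ne = ⊥-elim (none (x , y , x∈ , y∈ , ne))

  module Energy (A : Subset) where
    private
      y = # A
      pairs : List (K × K)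
      pairs = cartesianProduct (el A) (el A)

      pairs-unique : Unique pairs
      pairs-unique = cartesianProduct⁺ (filter⁺ (A ∋?_) U-unique) (filter⁺ (A ∋?_) U-unique)

      ∑-pairs-const : ∀ c → ∑ pairs (λ _ → c) ≡ y * (y * c)
      ∑-pairs-const c = trans (∑-cartesian (el A) (el A) _) (trans (∑-cong (el A) λ _ → ∑-const (el A) c)
        (trans (∑-const (el A) _) (cong (λ l → l * (l * c)) (length-el A))))

      φ : K → K × K → K
      φ ξ (a , c) = a +ᶠ -ᶠ ξ *ᶠ c

      rep : K → K → ℕ
      rep ξ z = ∑ pairs λ u → ⟦ z ≟ φ ξ u ⟧

    -- The number of quadruples (a , c , a′ , c′) in `A` with a - ξ c = a′ - ξ c′.
    energy : K → ℕ
    energy ξ = ∑ U λ z → rep ξ z * rep ξ z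

    -- Cauchy-Schwarz for the pairs of X × A, distributed over X - ξ A. The energy is that of all of
    -- `A` because `X` will vary with ξ, while the average over ξ needs a single family of
    -- quadruples.
    energy-lower : ∀ ξ X → X ⊆ A → (# X * y) * (# X * y) ≤ # (X ⊕ (-ᶠ ξ) · A) * energy ξ
    energy-lower ξ X X⊆A = begin
      (# X * y) * (# X * y)  ≤⟨ *-mono-≤ mass mass ⟩
      ∑ (el S) (rep ξ) * ∑ (el S) (rep ξ)  ≤⟨ cauchy-schwarz (el S) (rep ξ) ⟩
      length (el S) * ∑ (el S) (λ z → rep ξ z * rep ξ z)  ≤⟨ *-mono-≤ (≤-reflexive (length-el S)) restrict ⟩
      # S * energy ξ ∎
      where
      open ≤-Reasoning
      S = X ⊕ (-ᶠ ξ) · A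
      restrict : ∑ (el S) (λ z → rep ξ z * rep ξ z) ≤ energy ξ
      restrict = ≤-trans (≤-reflexive (∑-filter (S ∋?_) U _)) (∑-mono U λ z → ⟦⟧*≤ (S ∋? z))
      hit : ∀ a c → a ∈ el A → c ∈ el A → ⟦ X ∋? a ⟧ ≤ ∑ (el S) λ z → ⟦ z ≟ φ ξ (a , c) ⟧
      hit a c a∈ c∈ with X ∋? a
      ... | no _ = z≤n
      ... | yes x = ≤-trans (≤-reflexive (sym (⟦⟧-yes (φ ξ (a , c) ≟ φ ξ (a , c)) refl)))
              (∑-single (el S) (λ z → ⟦ z ≟ φ ξ (a , c) ⟧) (∈-el⁺ {S} (a , _ , x , (c , ∈-el⁻ {A} c∈ , refl) , refl)))
      mass : # X * y ≤ ∑ (el S) (rep ξ)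
      mass = begin
        # X * y  ≤⟨ *-monoˡ-≤ y (∑-mono U λ x → pick x) ⟩
        ∑ U (λ x → ⟦ A ∋? x ⟧ * ⟦ X ∋? x ⟧) * y  ≡⟨ cong₂ _*_ (sym (∑-filter (A ∋?_) U _)) (sym (length-el A)) ⟩
        ∑ (el A) (λ a → ⟦ X ∋? a ⟧) * length (el A)  ≡⟨ sym (∑-*ʳ (el A) _ (length (el A))) ⟩
        ∑ (el A) (λ a → ⟦ X ∋? a ⟧ * length (el A))  ≡⟨ ∑-cong (el A) (λ a → trans (*-comm _ (length (el A))) (sym (∑-const (el A) _))) ⟩
        ∑ (el A) (λ a → ∑ (el A) λ c → ⟦ X ∋? a ⟧)  ≤⟨ ∑-mono∈ (el A) (λ a a∈ → ∑-mono∈ (el A) λ c c∈ → hit a c a∈ c∈) ⟩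
        ∑ (el A) (λ a → ∑ (el A) λ c → ∑ (el S) λ z → ⟦ z ≟ φ ξ (a , c) ⟧) ≡⟨ sym (∑-cartesian (el A) (el A) _) ⟩
        ∑ pairs (λ u → ∑ (el S) λ z → ⟦ z ≟ φ ξ u ⟧)  ≡⟨ ∑-swap pairs (el S) _ ⟩
        ∑ (el S) (rep ξ) ∎
        where
        pick : ∀ x → ⟦ X ∋? x ⟧ ≤ ⟦ A ∋? x ⟧ * ⟦ X ∋? x ⟧
        pick x = ≤-trans (⟦⟧-mono (X ∋? x) ((A ∋? x) ×-dec (X ∋? x)) λ h → X⊆A h , h) (≤-reflexive (⟦×⟧ (A ∋? x) (X ∋? x)))

    -- Two distinct pairs collide for at most one multiplier.
    energy-upper : ∀ Ξ → ∑ (el Ξ) energy ≤ # Ξ * (y * y) + y * y * (y * y)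
    energy-upper Ξ = begin
      ∑ (el Ξ) energy  ≡⟨ ∑-cong (el Ξ) (λ ξ → ∑-cong U λ z → ∑-product pairs pairs _ _) ⟩
      ∑ (el Ξ) (λ ξ → ∑ U λ z → ∑ pairs λ u → ∑ pairs λ v → hit ξ z u * hit ξ z v)  ≡⟨ ∑-cong (el Ξ) (λ ξ → trans (∑-swap U pairs _) (∑-cong pairs λ u → ∑-swap U pairs _)) ⟩
      ∑ (el Ξ) (λ ξ → ∑ pairs λ u → ∑ pairs λ v → ∑ U λ z → hit ξ z u * hit ξ z v)  ≤⟨ ∑-mono (el Ξ) (λ ξ → ∑-mono pairs λ u → ∑-mono pairs λ v → collide ξ u v) ⟩
      ∑ (el Ξ) (λ ξ → ∑ pairs λ u → ∑ pairs λ v → ⟦ φ ξ u ≟ φ ξ v ⟧)  ≡⟨ trans (∑-swap (el Ξ) pairs _) (∑-cong pairs λ u → ∑-swap (el Ξ) pairs _) ⟩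
      ∑ pairs (λ u → ∑ pairs λ v → ∑ (el Ξ) λ ξ → ⟦ φ ξ u ≟ φ ξ v ⟧)  ≤⟨ ∑-mono pairs (λ u → ∑-mono pairs λ v → few u v) ⟩
      ∑ pairs (λ u → ∑ pairs λ v → # Ξ * ⟦ v ≟² u ⟧ + 1)  ≤⟨ ∑-mono pairs (λ u → ≤-trans (≤-reflexive (trans (∑-+ pairs _ _) (cong₂ _+_ (∑-*ˡ pairs (# Ξ) _) (∑-pairs-const 1))))
              (+-monoˡ-≤ _ (*-monoʳ-≤ (# Ξ) (∑-at-most-one (_≟² u) pairs pairs-unique λ _ _ e e′ → trans e (sym e′))))) ⟩
      ∑ pairs (λ u → # Ξ * 1 + y * (y * 1))  ≡⟨ ∑-pairs-const _ ⟩
      y * (y * (# Ξ * 1 + y * (y * 1)))  ≡⟨ arith y (# Ξ) ⟩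
      # Ξ * (y * y) + y * y * (y * y) ∎
      where
      open ≤-Reasoning
      arith : ∀ y x → y * (y * (x * 1 + y * (y * 1))) ≡ x * (y * y) + y * y * (y * y)
      arith = solve-∀
      hit : K → K → K × K → ℕ
      hit ξ z u = ⟦ z ≟ φ ξ u ⟧
      collide : ∀ ξ u v → ∑ U (λ z → hit ξ z u * hit ξ z v) ≤ ⟦ φ ξ u ≟ φ ξ v ⟧
      collide ξ u v with φ ξ u ≟ φ ξ v
      ... | yes _ = ≤-trans (∑-mono U λ z → ≤-reflexive (sym (⟦×⟧ (z ≟ φ ξ u) (z ≟ φ ξ v))))
              (∑-at-most-one (λ z → (z ≟ φ ξ u) ×-dec (z ≟ φ ξ v)) U U-unique λ _ _ e e′ → trans (proj₁ e) (sym (proj₁ e′)))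
      ... | no ne = ≤-trans (∑-mono U λ z → ≤-reflexive (trans (sym (⟦×⟧ (z ≟ φ ξ u) (z ≟ φ ξ v)))
              (⟦⟧-no ((z ≟ φ ξ u) ×-dec (z ≟ φ ξ v)) λ { (e , e′) → ne (trans (sym e) e′) }))) (≤-reflexive (∑-zero U))
      unique-ξ : ∀ {ξ ξ′ a c a′ c′} → (a , c) ≢ (a′ , c′) → φ ξ (a , c) ≡ φ ξ (a′ , c′) → φ ξ′ (a , c) ≡ φ ξ′ (a′ , c′) → ξ ≡ ξ′
      unique-ξ {ξ} {ξ′} {a} {c} {a′} {c′} ne e e′ with c ≟ c′
      ... | yes refl = ⊥-elim (ne (cong (_, c) (+-cancelʳᶠ e)))
      ... | no c≢c′ = *-cancelˡᶠ {c -ᶠ c′} (λ z → c≢c′ (sub≡0 z)) (trans (sol ξ e) (sym (sol ξ′ e′)))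
        where
        sol : ∀ ξ → φ ξ (a , c) ≡ φ ξ (a′ , c′) → (c -ᶠ c′) *ᶠ ξ ≡ a -ᶠ a′
        sol ξ e = trans (solve 5 (λ a c a′ c′ ξ → (c :- c′) :* ξ := (a :- a′) :- ((a :+ (:- ξ) :* c) :- (a′ :+ (:- ξ) :* c′))) refl a c a′ c′ ξ)
          (trans (cong (λ w → (a -ᶠ a′) -ᶠ (w -ᶠ φ ξ (a′ , c′))) e) (solve 2 (λ s w → s :- (w :- w) := s) refl (a -ᶠ a′) (φ ξ (a′ , c′))))
      few : ∀ u v → ∑ (el Ξ) (λ ξ → ⟦ φ ξ u ≟ φ ξ v ⟧) ≤ # Ξ * ⟦ v ≟² u ⟧ + 1
      few u v with v ≟² u
      ... | yes _ = ≤-trans (∑-mono (el Ξ) λ ξ → ⟦⟧≤1 (φ ξ u ≟ φ ξ v)) (≤-trans (≤-reflexive (trans (∑-const (el Ξ) 1) (cong (_* 1) (length-el Ξ)))) (m≤m+n _ 1))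
      ... | no ne = ≤-trans (∑-at-most-one (λ ξ → φ ξ u ≟ φ ξ v) (el Ξ) (filter⁺ (Ξ ∋?_) U-unique) λ _ _ e e′ → unique-ξ (λ eq → ne (sym eq)) e e′) (m≤n+m 1 _)

    -- Trivial coincidences contribute |Ξ| |A|² to the total energy, the others at most |A|⁴. The
    -- factor 16 is the square of the 4 lost from |A| to |X|.
    energy-average : ∀ Ξ G → 1 ≤ y → (∀ {ξ} → Ξ ∋ ξ → ∃ λ X → X ⊆ A × y ≤ 4 * # X × # (X ⊕ (-ᶠ ξ) · A) ≤ G) →
      # Ξ * (y * y) ≤ 16 * G * (# Ξ + y * y)
    energy-average Ξ G 1≤y h = *-cancelʳ-≤ _ _ (y * y) {{>-nonZero (*-mono-≤ 1≤y 1≤y)}} (begin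
      # Ξ * (y * y) * (y * y)  ≡⟨ trans (*-assoc (# Ξ) (y * y) (y * y)) (cong (_* (y * y * (y * y))) (sym (length-el Ξ))) ⟩
      length (el Ξ) * (y * y * (y * y))  ≡⟨ sym (∑-const (el Ξ) _) ⟩
      ∑ (el Ξ) (λ _ → y * y * (y * y))  ≤⟨ ∑-mono∈ (el Ξ) (λ ξ ξ∈ → each (∈-el⁻ {Ξ} ξ∈)) ⟩
      ∑ (el Ξ) (λ ξ → 16 * G * energy ξ)  ≡⟨ ∑-*ˡ (el Ξ) (16 * G) energy ⟩
      16 * G * ∑ (el Ξ) energy  ≤⟨ *-monoʳ-≤ (16 * G) (energy-upper Ξ) ⟩
      16 * G * (# Ξ * (y * y) + y * y * (y * y))  ≡⟨ arith G (# Ξ) (y * y) ⟩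
      16 * G * (# Ξ + y * y) * (y * y) ∎)
      where
      open ≤-Reasoning
      arith : ∀ g x q → 16 * g * (x * q + q * q) ≡ 16 * g * (x + q) * q
      arith = solve-∀
      each : ∀ {ξ} → Ξ ∋ ξ → y * y * (y * y) ≤ 16 * G * energy ξ
      each {ξ} ξ∈ with h ξ∈
      ... | X , X⊆A , large , small = begin
        y * y * (y * y)  ≤⟨ *-mono-≤ (*-monoˡ-≤ y large) (*-monoˡ-≤ y large) ⟩
        4 * # X * y * (4 * # X * y)  ≡⟨ sq (# X) y ⟩
        16 * (# X * y * (# X * y))  ≤⟨ *-monoʳ-≤ 16 (energy-lower ξ X X⊆A) ⟩
        16 * (# (X ⊕ (-ᶠ ξ) · A) * energy ξ)  ≤⟨ *-monoʳ-≤ 16 (*-monoˡ-≤ (energy ξ) small) ⟩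
        16 * (G * energy ξ)  ≡⟨ sym (*-assoc 16 G _) ⟩
        16 * G * energy ξ ∎
        where
        sq : ∀ x y → 4 * x * y * (4 * x * y) ≡ 16 * (x * y * (x * y))
        sq = solve-∀

  module Multipliers (A T : Subset) (k : ℕ) (1≤k : 1 ≤ k) (1≤y : 1 ≤ # A)
    (T≢0 : ∀ {τ} → T ∋ τ → τ ≢ 0ᶠ)
    (small : ∀ {τ} → T ∋ τ → # (A ⊕ (-ᶠ τ) · A) ≤ k * # A) where
    private
      y = # A
      infix 8 _⁻
      _⁻ : K → Subset
      τ ⁻ = (-ᶠ τ) · A

    -- The core for τ loses a factor 2 in size, so for a second multiplier the constant doubles.
    small-on-core : ∀ {X τ} → X ⊆ A → y ≤ 2 * # X → T ∋ τ → # (X ⊕ τ ⁻) ≤ 2 * k * # X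
    small-on-core {X} {τ} X⊆A large τ∈ = begin
      # (X ⊕ τ ⁻)  ≤⟨ #-mono {X ⊕ τ ⁻} {A ⊕ τ ⁻} (⊕-mono {X} {A} {τ ⁻} {τ ⁻} X⊆A (λ b → b)) ⟩
      # (A ⊕ τ ⁻)  ≤⟨ small τ∈ ⟩
      k * y  ≤⟨ *-monoʳ-≤ k large ⟩
      k * (2 * # X)  ≡⟨ arith k (# X) ⟩
      2 * k * # X ∎
      where
      open ≤-Reasoning
      arith : ∀ k x → k * (2 * x) ≡ 2 * k * x
      arith = solve-∀

    -- Nested cores for two multipliers. A sumset over `X₂` can shed -σ A and then, after enlarging
    -- `X₂` to `X₁`, also -τ A.
    record Cores (τ σ : K) : Set₁ where
      field
        X₁ X₂ : Subset
        X₁⊆A : X₁ ⊆ A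
        X₂⊆X₁ : X₂ ⊆ X₁
        large : y ≤ 4 * # X₂
        growth₁ : ∀ C → # (X₁ ⊕ τ ⁻ ⊕ C) ≤ 2 * k * # (X₁ ⊕ C)
        growth₂ : ∀ C → # (X₂ ⊕ σ ⁻ ⊕ C) ≤ 4 * k * # (X₂ ⊕ C)

    abstract
     cores : ∀ {τ σ} → T ∋ τ → T ∋ σ → Cores τ σ
     cores {τ} {σ} τ∈ σ∈ =
      let X₁ , X₁⊆A , large₁ , growth₁ = petridis A (τ ⁻) k 1≤k (small τ∈)
          X₂ , X₂⊆X₁ , large₂ , growth₂ = petridis X₁ (σ ⁻) (2 * k) (≤-trans 1≤k (m≤n*m k 2)) (small-on-core {X₁} X₁⊆A large₁ σ∈)
      in record
        { X₁ = X₁ ; X₂ = X₂ ; X₁⊆A = X₁⊆A ; X₂⊆X₁ = X₂⊆X₁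
        ; large = ≤-trans large₁ (≤-trans (*-monoʳ-≤ 2 large₂) (≤-reflexive (sym (*-assoc 2 2 (# X₂)))))
        ; growth₁ = growth₁
        ; growth₂ = λ C → ≤-trans (growth₂ C) (≤-reflexive (cong (_* # (X₂ ⊕ C)) (sym (*-assoc 2 2 k)))) }

    -- Ruzsa's inequality over `X₂`, which lies in both cores: one core absorbs -τ₁ A, the other -σ₁
    -- A, and what is left is small by hypothesis. The constant is 32 = 4 · 2 · 4, from |A| ≤ 4 |X₂|
    -- and the two growth factors.
    four-fold : ∀ W {τ₁ τ₂ σ₁ σ₂} → T ∋ τ₁ → T ∋ τ₂ → T ∋ σ₁ → T ∋ σ₂ →
      (∀ {w} → W ∋ w → Σ (K × K × K × K) λ { (a₁ , a₂ , a₃ , a₄) → (A ∋ a₁ × A ∋ a₂ × A ∋ a₃ × A ∋ a₄) ×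
        w ≡ (-ᶠ τ₁ *ᶠ a₁ +ᶠ -ᶠ τ₂ *ᶠ a₂) -ᶠ (-ᶠ σ₁ *ᶠ a₃ +ᶠ -ᶠ σ₂ *ᶠ a₄) }) →
      # W ≤ 32 * k ^ 4 * y
    four-fold W {τ₁} {τ₂} {σ₁} {σ₂} τ₁∈ τ₂∈ σ₁∈ σ₂∈ h =
      arith (# W) (# X₂) (# P) (# Q) large (ruzsa-triangle W X₂ P Q rep)
        (≤-trans (growth₁ (τ₂ ⁻)) (*-monoʳ-≤ (2 * k) (diff X₁ X₁⊆A τ₂∈)))
        (≤-trans (growth₂ (σ₂ ⁻)) (*-monoʳ-≤ (4 * k) (diff X₂ (λ x → X₁⊆A (X₂⊆X₁ x)) σ₂∈)))
      where
      open Cores (cores τ₁∈ σ₁∈)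
      P = X₁ ⊕ τ₁ ⁻ ⊕ τ₂ ⁻
      Q = X₂ ⊕ σ₁ ⁻ ⊕ σ₂ ⁻
      diff : ∀ X {τ} → X ⊆ A → T ∋ τ → # (X ⊕ τ ⁻) ≤ k * y
      diff X {τ} X⊆A τ∈ = ≤-trans (#-mono {X ⊕ τ ⁻} {A ⊕ τ ⁻} (⊕-mono {X} {A} {τ ⁻} {τ ⁻} X⊆A (λ b → b))) (small τ∈)
      arith : ∀ w x p q → y ≤ 4 * x → w * x ≤ p * q → p ≤ 2 * k * (k * y) → q ≤ 4 * k * (k * y) → w ≤ 32 * k ^ 4 * y
      arith w x p q y≤ wx≤ p≤ q≤ = *-cancelʳ-≤ w (32 * k ^ 4 * y) y {{>-nonZero 1≤y}} (begin
        w * y  ≤⟨ *-monoʳ-≤ w y≤ ⟩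
        w * (4 * x)  ≡⟨ arith₁ w x ⟩
        4 * (w * x)  ≤⟨ *-monoʳ-≤ 4 (≤-trans wx≤ (*-mono-≤ p≤ q≤)) ⟩
        4 * (2 * k * (k * y) * (4 * k * (k * y)))  ≡⟨ arith₂ k y ⟩
        32 * k ^ 4 * y * y ∎)
        where
        open ≤-Reasoning
        arith₁ : ∀ w x → w * (4 * x) ≡ 4 * (w * x)
        arith₁ = solve-∀
        arith₂ : ∀ k y → 4 * (2 * k * (k * y) * (4 * k * (k * y))) ≡ 32 * (k * (k * (k * (k * 1)))) * y * y
        arith₂ = solve-∀
      assoc : ∀ x b c → x +ᶠ (b +ᶠ c) ≡ x +ᶠ b +ᶠ c
      assoc = solve 3 (λ x b c → x :+ (b :+ c) := x :+ b :+ c) refl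
      rep : ∀ {w} → W ∋ w → ∃ λ { (β , γ) → w ≡ β -ᶠ γ × (∀ {x} → X₂ ∋ x → P ∋ (x +ᶠ β) × Q ∋ (x +ᶠ γ)) }
      rep w∈ = let (a₁ , a₂ , a₃ , a₄) , (a₁∈ , a₂∈ , a₃∈ , a₄∈) , eq = h w∈ in (-ᶠ τ₁ *ᶠ a₁ +ᶠ -ᶠ τ₂ *ᶠ a₂ , -ᶠ σ₁ *ᶠ a₃ +ᶠ -ᶠ σ₂ *ᶠ a₄) , eq , λ {x} x∈ →
        (x +ᶠ -ᶠ τ₁ *ᶠ a₁ , -ᶠ τ₂ *ᶠ a₂ , (x , -ᶠ τ₁ *ᶠ a₁ , X₂⊆X₁ x∈ , (a₁ , a₁∈ , refl) , refl) , (a₂ , a₂∈ , refl) , assoc x _ _) ,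
        (x +ᶠ -ᶠ σ₁ *ᶠ a₃ , -ᶠ σ₂ *ᶠ a₄ , (x , -ᶠ σ₁ *ᶠ a₃ , x∈ , (a₃ , a₃∈ , refl) , refl) , (a₄ , a₄∈ , refl) , assoc x _ _)

    -- The quotient set (T - T) / (T - T), written without division.
    Ratios : Subset
    Ratios = record
      { _∋_ = λ r → ∃ λ a → ∃ λ b → ∃ λ c → ∃ λ d → T ∋ a × T ∋ b × T ∋ c × T ∋ d × c ≢ d × a -ᶠ b ≡ r *ᶠ (c -ᶠ d)
      ; _∋?_ = λ r → ∃? λ a → ∃? λ b → ∃? λ c → ∃? λ d → (T ∋? a) ×-dec (T ∋? b) ×-dec (T ∋? c) ×-dec (T ∋? d)
          ×-dec ¬? (c ≟ d) ×-dec ((a -ᶠ b) ≟ (r *ᶠ (c -ᶠ d))) }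

    -- Dilating A - r A by c - d clears the denominator and leaves (c - d) α - (a - b) β, a
    -- difference of two sums of the kind bounded by `four-fold`.
    ratio-small : ∀ {r} → Ratios ∋ r → # (A ⊕ r ⁻) ≤ 32 * k ^ 4 * y
    ratio-small {r} (a , b , c , d , a∈ , b∈ , c∈ , d∈ , c≢d , eq) = ≤-trans
      (#-dilate (A ⊕ r ⁻) λ e → c≢d (sub≡0 e))
      (four-fold ((c -ᶠ d) · (A ⊕ r ⁻)) a∈ d∈ b∈ c∈ λ
        { (z , (α , _ , α∈ , (β , β∈ , refl) , refl) , refl) → (β , α , β , α) , (β∈ , α∈ , β∈ , α∈) , expand α β })
      where
      expand : ∀ α β → (c -ᶠ d) *ᶠ (α +ᶠ -ᶠ r *ᶠ β) ≡ (-ᶠ a *ᶠ β +ᶠ -ᶠ d *ᶠ α) -ᶠ (-ᶠ b *ᶠ β +ᶠ -ᶠ c *ᶠ α)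
      expand α β = trans
        (solve 5 (λ c d r α β → (c :- d) :* (α :+ (:- r) :* β) := (c :- d) :* α :- (r :* (c :- d)) :* β) refl c d r α β)
        (trans (cong (λ s → (c -ᶠ d) *ᶠ α -ᶠ s *ᶠ β) (sym eq))
        (solve 6 (λ a b c d α β → (c :- d) :* α :- (a :- b) :* β := ((:- a) :* β :+ (:- d) :* α) :- ((:- b) :* β :+ (:- c) :* α)) refl a b c d α β))

    -- Ruzsa's inequality through -t A: here A - t A is small because t is a multiplier, and -t (A -
    -- r A) because r is a ratio. The exponent is 5 = 1 + 4.
    ratio-multiple-small : ∀ {r t} → Ratios ∋ r → T ∋ t → # (A ⊕ (r *ᶠ t) ⁻) ≤ 32 * k ^ 5 * y
    ratio-multiple-small {r} {t} r∈ t∈ = *-cancelʳ-≤ (# W) (32 * k ^ 5 * y) y {{>-nonZero 1≤y}} (begin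
      # W * y  ≤⟨ *-monoʳ-≤ (# W) (#-dilate A -t≢0) ⟩
      # W * # (t ⁻)  ≤⟨ ruzsa-triangle W (t ⁻) (A ⊕ t ⁻) ((-ᶠ t) · (A ⊕ r ⁻)) rep ⟩
      # (A ⊕ t ⁻) * # ((-ᶠ t) · (A ⊕ r ⁻)) ≤⟨ *-mono-≤ (small t∈) (≤-trans (#-dilate≤ (A ⊕ r ⁻) -t≢0) (ratio-small r∈)) ⟩
      k * y * (32 * k ^ 4 * y)  ≡⟨ arith k y ⟩
      32 * k ^ 5 * y * y ∎)
      where
      open ≤-Reasoning
      W = A ⊕ (r *ᶠ t) ⁻
      -t≢0 = neg≢0 (T≢0 t∈)
      arith : ∀ k y → k * y * (32 * (k * (k * (k * (k * 1)))) * y) ≡ 32 * (k * (k * (k * (k * (k * 1))))) * y * y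
      arith = solve-∀
      rep : ∀ {w} → W ∋ w → ∃ λ { (β , γ) → w ≡ β -ᶠ γ × (∀ {x} → (t ⁻) ∋ x → (A ⊕ t ⁻) ∋ (x +ᶠ β) × ((-ᶠ t) · (A ⊕ r ⁻)) ∋ (x +ᶠ γ)) }
      rep (α , _ , α∈ , (β , β∈ , refl) , refl) = (α , r *ᶠ t *ᶠ β) ,
        solve 4 (λ α r t β → α :+ (:- (r :* t)) :* β := α :- r :* t :* β) refl α r t β ,
        λ { (γ , γ∈ , refl) → (α , _ , α∈ , (γ , γ∈ , refl) , solve 3 (λ α t γ → (:- t) :* γ :+ α := α :+ (:- t) :* γ) refl α t γ) ,
          (γ +ᶠ -ᶠ r *ᶠ β , (γ , _ , γ∈ , (β , β∈ , refl) , refl) ,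
            solve 4 (λ r t β γ → (:- t) :* γ :+ r :* t :* β := (:- t) :* (γ :+ (:- r) :* β)) refl r t β γ) }

    -- ξ α splits into t α, t′ α and r t′ α. The cores absorb the first two at a cost of k each and
    -- the third is the previous estimate, so the exponent is 7 = 1 + 1 + 5.
    pivot-small : ∀ {r t t′} → Ratios ∋ r → T ∋ t → T ∋ t′ →
      ∃ λ X → X ⊆ A × y ≤ 4 * # X × # (X ⊕ (t +ᶠ (r +ᶠ 1ᶠ) *ᶠ t′) ⁻) ≤ 256 * k ^ 7 * y
    pivot-small {r} {t} {t′} r∈ t∈ t′∈ = X₂ , (λ x → X₁⊆A (X₂⊆X₁ x)) , large , (begin
      # (X₂ ⊕ (t +ᶠ (r +ᶠ 1ᶠ) *ᶠ t′) ⁻)  ≤⟨ #-mono {X₂ ⊕ (t +ᶠ (r +ᶠ 1ᶠ) *ᶠ t′) ⁻} {X₂ ⊕ t ⁻ ⊕ C} (λ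
          { (x , _ , x∈ , (α , α∈ , refl) , refl) → _ , _ , (x , _ , x∈ , (α , α∈ , refl) , refl) , (_ , _ , (α , α∈ , refl) , (α , α∈ , refl) , refl) ,
            solve 5 (λ x t r t′ α → x :+ (:- (t :+ (r :+ :1) :* t′)) :* α := (x :+ (:- t) :* α) :+ ((:- t′) :* α :+ (:- (r :* t′)) :* α)) refl x t r t′ α }) ⟩
      # (X₂ ⊕ t ⁻ ⊕ C)  ≤⟨ growth₂ C ⟩
      4 * k * # (X₂ ⊕ C)  ≤⟨ *-monoʳ-≤ (4 * k) (#-mono {X₂ ⊕ C} {X₁ ⊕ t′ ⁻ ⊕ (r *ᶠ t′) ⁻} λ
          { (x , _ , x∈ , (b , c , b∈ , c∈ , refl) , refl) → x +ᶠ b , c , (x , b , X₂⊆X₁ x∈ , b∈ , refl) , c∈ ,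
            solve 3 (λ x b c → x :+ (b :+ c) := x :+ b :+ c) refl x b c }) ⟩
      4 * k * # (X₁ ⊕ t′ ⁻ ⊕ (r *ᶠ t′) ⁻)  ≤⟨ *-monoʳ-≤ (4 * k) (growth₁ ((r *ᶠ t′) ⁻)) ⟩
      4 * k * (2 * k * # (X₁ ⊕ (r *ᶠ t′) ⁻))  ≤⟨ *-monoʳ-≤ (4 * k) (*-monoʳ-≤ (2 * k) (≤-trans
          (#-mono {X₁ ⊕ (r *ᶠ t′) ⁻} {A ⊕ (r *ᶠ t′) ⁻} (⊕-mono {X₁} {A} {(r *ᶠ t′) ⁻} {(r *ᶠ t′) ⁻} X₁⊆A (λ b → b))) (ratio-multiple-small r∈ t′∈))) ⟩
      4 * k * (2 * k * (32 * k ^ 5 * y))  ≡⟨ arith k y ⟩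
      256 * k ^ 7 * y ∎)
      where
      open ≤-Reasoning
      open Cores (cores t′∈ t∈)
      C = t′ ⁻ ⊕ (r *ᶠ t′) ⁻
      arith : ∀ k y → 4 * k * (2 * k * (32 * (k * (k * (k * (k * (k * 1))))) * y)) ≡ 256 * (k * (k * (k * (k * (k * (k * (k * 1))))))) * y
      arith = solve-∀

    private
      m = # T

      cancel-y : ∀ x c → x * (y * y) ≤ 16 * (c * y) * (x + y * y) → x * y ≤ 16 * c * (x + y * y)
      cancel-y x c h = *-cancelʳ-≤ (x * y) (16 * c * (x + y * y)) y {{>-nonZero 1≤y}} (subst₂ _≤_ (sym (*-assoc x y y)) (arith c y (x + y * y)) h)
        where
        arith : ∀ c y s → 16 * (c * y) * s ≡ 16 * c * s * y
        arith = solve-∀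

      -- The inequality amounts to x (y - c) ≤ c y², which passes to smaller x; the case y ≤ c is
      -- separate because subtraction is truncated.
      shrink : ∀ c {x x′} → x ≤ x′ → x′ * y ≤ c * (x′ + y * y) → x * y ≤ c * (x + y * y)
      shrink c {x} {x′} x≤x′ h with ≤-total y c
      ... | inj₁ y≤c = begin
          x * y  ≤⟨ *-monoʳ-≤ x y≤c ⟩
          x * c  ≡⟨ *-comm x c ⟩
          c * x  ≤⟨ *-monoʳ-≤ c (m≤m+n x _) ⟩
          c * (x + y * y) ∎
          where open ≤-Reasoning
      ... | inj₂ c≤y = begin
          x * y  ≡⟨ cong (x *_) (sym (m+[n∸m]≡n c≤y)) ⟩
          x * (c + e)  ≡⟨ *-distribˡ-+ x c e ⟩
          x * c + x * e  ≤⟨ +-monoʳ-≤ (x * c) (≤-trans (*-monoˡ-≤ e x≤x′) excess) ⟩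
          x * c + c * (y * y)  ≡⟨ cong (_+ c * (y * y)) (*-comm x c) ⟩
          c * x + c * (y * y)  ≡⟨ sym (*-distribˡ-+ c x _) ⟩
          c * (x + y * y) ∎
          where
          open ≤-Reasoning
          e = y ∸ c
          excess : x′ * e ≤ c * (y * y)
          excess = +-cancelˡ-≤ (c * x′) _ _ (begin
            c * x′ + x′ * e  ≡⟨ cong (_+ x′ * e) (*-comm c x′) ⟩
            x′ * c + x′ * e  ≡⟨ sym (*-distribˡ-+ x′ c e) ⟩
            x′ * (c + e)  ≡⟨ cong (x′ *_) (m+[n∸m]≡n c≤y) ⟩
            x′ * y  ≤⟨ h ⟩
            c * (x′ + y * y)  ≡⟨ *-distribˡ-+ c x′ _ ⟩
            c * x′ + c * (y * y) ∎)

    open Energy A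

    growth : 2 ≤ m → y * y ≤ length U → m * m * y ≤ 4096 * k ^ 7 * (m * m + y * y)
    growth 2≤m y²≤p with ∃? (λ r → (Ratios ∋? r) ×-dec ¬? (Ratios ∋? (r +ᶠ 1ᶠ)))
    ... | yes (r , r∈ , r+1∉) = shrink (4096 * k ^ 7) injective (≤-trans (cancel-y (# Ξ) (256 * k ^ 7)
        (energy-average Ξ (256 * k ^ 7 * y) 1≤y λ { (t , t′ , t∈ , t′∈ , refl) → pivot-small r∈ t∈ t′∈ }))
        (≤-reflexive (arith (k ^ 7) (# Ξ + y * y))))
      where
      arith : ∀ c s → 16 * (256 * c) * s ≡ 4096 * c * s
      arith = solve-∀
      Ξ : Subset
      Ξ = record { _∋_ = λ ξ → ∃ λ t → ∃ λ t′ → T ∋ t × T ∋ t′ × ξ ≡ t +ᶠ (r +ᶠ 1ᶠ) *ᶠ t′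
                 ; _∋?_ = λ ξ → ∃? λ t → ∃? λ t′ → (T ∋? t) ×-dec (T ∋? t′) ×-dec (ξ ≟ (t +ᶠ (r +ᶠ 1ᶠ) *ᶠ t′)) }
      inj : ∀ {t t′ s s′} → T ∋ t → T ∋ t′ → T ∋ s → T ∋ s′ → t +ᶠ (r +ᶠ 1ᶠ) *ᶠ t′ ≡ s +ᶠ (r +ᶠ 1ᶠ) *ᶠ s′ → (t , t′) ≡ (s , s′)
      inj {t} {t′} {s} {s′} t∈ t′∈ s∈ s′∈ eq with s′ ≟ t′
      ... | yes refl = cong (_, t′) (+-cancelʳᶠ eq)
      -- Equal values would exhibit r + 1 as the ratio (t - s) / (s′ - t′).
      ... | no s′≢t′ = ⊥-elim (r+1∉ (t , s , s′ , t′ , t∈ , s∈ , s′∈ , t′∈ , s′≢t′ ,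
          trans (solve 4 (λ t x t′ s → t :- s := (t :+ x :* t′) :- (x :* t′ :+ s)) refl t (r +ᶠ 1ᶠ) t′ s)
          (trans (cong (_-ᶠ ((r +ᶠ 1ᶠ) *ᶠ t′ +ᶠ s)) eq)
          (solve 4 (λ s x t′ s′ → (s :+ x :* s′) :- (x :* t′ :+ s) := x :* (s′ :- t′)) refl s (r +ᶠ 1ᶠ) t′ s′))))
      injective : m * m ≤ # Ξ
      injective = subst (_≤ # Ξ) (sym (#-product T T)) (∑-injection _ (Ξ ∋?_) _≟_ U² U (cartesianProduct⁺ U-unique U-unique)
        (λ { (t , t′) → t +ᶠ (r +ᶠ 1ᶠ) *ᶠ t′ })
        (λ { {t , t′} _ (t∈ , t′∈) → U-complete _ , (t , t′ , t∈ , t′∈ , refl) })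
        (λ { _ _ (t∈ , t′∈) (s∈ , s′∈) → inj t∈ t′∈ s∈ s′∈ }))
    ... | no closed = begin
        m * m * y  ≤⟨ *-monoʳ-≤ (m * m) y-small ⟩
        m * m * (4096 * k ^ 7)  ≡⟨ *-comm (m * m) _ ⟩
        4096 * k ^ 7 * (m * m)  ≤⟨ *-monoʳ-≤ (4096 * k ^ 7) (m≤m+n (m * m) (y * y)) ⟩
        4096 * k ^ 7 * (m * m + y * y) ∎
      where
      open ≤-Reasoning
      everything : ∀ ξ → Ratios ∋ ξ
      everything = +1-induction (Ratios ∋_) base step
        where
        base : Ratios ∋ 0ᶠ
        base with two-elements {T} 2≤m
        ... | c , d , c∈ , d∈ , c≢d = c , c , c , d , c∈ , c∈ , c∈ , d∈ , c≢d , solve 2 (λ c d → c :- c := :0 :* (c :- d)) refl c d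
        step : ∀ ξ → Ratios ∋ ξ → Ratios ∋ (ξ +ᶠ 1ᶠ)
        step ξ ξ∈ with Ratios ∋? (ξ +ᶠ 1ᶠ)
        ... | yes h = h
        ... | no h = ⊥-elim (closed (ξ , ξ∈ , h))
      p = # Ratios
      p≡ : length U ≤ p
      p≡ = ≤-reflexive (sym (trans (∑-cong U λ x → ⟦⟧-yes (Ratios ∋? x) (everything x)) (trans (∑-const U 1) (*-identityʳ _))))
      0<p : 1 ≤ p
      0<p = ≤-trans (*-mono-≤ 1≤y 1≤y) (≤-trans y²≤p p≡)
      bound : p * y ≤ 16 * (32 * k ^ 4) * (p + y * y)
      bound = cancel-y p (32 * k ^ 4) (energy-average Ratios (32 * k ^ 4 * y) 1≤y λ {ξ} ξ∈ → A , (λ a → a) , m≤n*m y 4 , ratio-small ξ∈)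
      y-small : y ≤ 4096 * k ^ 7
      y-small = ≤-trans (*-cancelˡ-≤ p {{>-nonZero 0<p}} (begin
        p * y  ≤⟨ bound ⟩
        -- By y² ≤ p the accidental coincidences weigh no more than the trivial ones, after which p
        -- cancels.
        16 * (32 * k ^ 4) * (p + y * y)  ≤⟨ *-monoʳ-≤ (16 * (32 * k ^ 4)) (+-monoʳ-≤ p (≤-trans y²≤p p≡)) ⟩
        16 * (32 * k ^ 4) * (p + p)  ≡⟨ arith p (k ^ 4) ⟩
        p * (1024 * k ^ 4) ∎))
        -- A coarser bound, to match the constant and the exponent of the pivot case.
        (*-mono-≤ {1024} {4096} (m≤m+n 1024 3072) (^-monoʳ-≤ k {{>-nonZero 1≤k}} (m≤m+n 4 3)))
        where
        arith : ∀ p c → 16 * (32 * c) * (p + p) ≡ p * (1024 * c)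
        arith = solve-∀

-- Partial sumsets with many multipliers

square-cancel-≤ : ∀ a b → a * a ≤ b * b → a ≤ b
square-cancel-≤ a b h with ≤-total a b
... | inj₁ a≤b = a≤b
... | inj₂ b≤a with a ≤? b
... | yes a≤b = a≤b
... | no a≰b = ⊥-elim (<⇒≱ (*-mono-< (≰⇒> a≰b) (≰⇒> a≰b)) h)

nonempty : ∀ {A : Set} (xs : List A) f → 1 ≤ ∑ xs f → 0 < length xs
nonempty (x ∷ xs) f _ = s≤s z≤n

positive : ∀ {a c s} → 1 ≤ a → a ≤ c * s → 1 ≤ s
positive {c = c} {s = zero} 1≤a h = ⊥-elim (<⇒≱ 1≤a (≤-trans h (≤-reflexive (*-zeroʳ c))))
positive {s = suc _} _ _ = s≤s z≤n

module _ {A V : Set} (xs : List A) (vs : List V) {E : A → V → Set} (E? : ∀ x v → Dec (E x v))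
  (n Λ θ : ℕ) (θ≡ : θ ≡ 32 * (Λ * Λ)) (1≤n : 1 ≤ n) (1≤Λ : 1 ≤ Λ) (xs≤n : length xs ≤ n) (vs≤n² : length vs ≤ n * n)
  (dense : n * n * n ≤ Λ * ∑ xs λ x → ∑ vs λ v → ⟦ E? x v ⟧) where

  private
    open ≤-Reasoning

    instance
      n≢0 : NonZero n
      n≢0 = >-nonZero 1≤n
      Λ≢0 : NonZero Λ
      Λ≢0 = >-nonZero 1≤Λ

    degree : A → ℕ
    degree x = ∑ vs λ v → ⟦ E? x v ⟧

  codegree : V → V → ℕ
  codegree v w = ∑ xs λ x → ⟦ E? x v ⟧ * ⟦ E? x w ⟧

  Linked : V → V → Set
  Linked v w = n ≤ θ * codegree v w

  linked? : ∀ v w → Dec (Linked v w)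
  linked? v w = n ≤? θ * codegree v w

  private
    unlinked : A → ℕ
    unlinked x = ∑ vs λ v → ∑ vs λ w → ⟦ E? x v ⟧ * ⟦ E? x w ⟧ * ⟦ ¬? (linked? v w) ⟧

    -- An unlinked pair has fewer than n / θ common neighbours, and there are at most n⁴ pairs.
    unlinked-total : θ * ∑ xs unlinked ≤ n * n * (n * n * n)
    unlinked-total = begin
      θ * ∑ xs unlinked
        ≡⟨ cong (θ *_) (trans (∑-swap xs vs _) (∑-cong vs λ v → ∑-swap xs vs _)) ⟩
      θ * ∑ vs (λ v → ∑ vs λ w → ∑ xs λ x → ⟦ E? x v ⟧ * ⟦ E? x w ⟧ * ⟦ ¬? (linked? v w) ⟧)
        ≡⟨ trans (sym (∑-*ˡ vs (θ) _)) (∑-cong vs λ v → sym (∑-*ˡ vs (θ) _)) ⟩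
      ∑ vs (λ v → ∑ vs λ w → θ * ∑ xs λ x → ⟦ E? x v ⟧ * ⟦ E? x w ⟧ * ⟦ ¬? (linked? v w) ⟧)
        ≤⟨ ∑-mono vs (λ v → ∑-mono vs λ w → each v w) ⟩
      ∑ vs (λ v → ∑ vs λ w → n)
        ≡⟨ trans (∑-cong vs λ v → ∑-const vs n) (∑-const vs _) ⟩
      length vs * (length vs * n)
        ≤⟨ *-mono-≤ vs≤n² (*-monoˡ-≤ n vs≤n²) ⟩
      n * n * (n * n * n) ∎
      where
      each : ∀ v w → θ * ∑ xs (λ x → ⟦ E? x v ⟧ * ⟦ E? x w ⟧ * ⟦ ¬? (linked? v w) ⟧) ≤ n
      each v w = ≤-trans (≤-reflexive (trans (cong (θ *_) (∑-*ʳ xs _ _)) (sym (*-assoc (θ) (codegree v w) _)))) (last (linked? v w))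
        where
        last : (d : Dec (Linked v w)) → θ * codegree v w * ⟦ ¬? d ⟧ ≤ n
        last (yes _) = ≤-trans (≤-reflexive (*-zeroʳ (θ * codegree v w))) z≤n
        last (no h) = ≤-trans (≤-reflexive (*-identityʳ _)) (<⇒≤ (≰⇒> h))

    -- Cauchy-Schwarz in tangent form, 2 Λ n² d ≤ Λ² d² + n⁴: the added terms total at most n⁵, half
    -- of what the density supplies.
    degree-total : n * n * (n * n * n) ≤ Λ * Λ * ∑ xs (λ x → degree x * degree x)
    degree-total = +-cancelʳ-≤ (n * n * (n * n * n)) _ _ (begin
      n * n * (n * n * n) + n * n * (n * n * n)  ≡⟨ double (n * n * (n * n * n)) ⟩
      2 * (n * n * (n * n * n))  ≤⟨ *-monoʳ-≤ 2 (*-monoʳ-≤ (n * n) dense) ⟩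
      2 * (n * n * (Λ * ∑ xs degree))  ≡⟨ rearrange (n * n) Λ (∑ xs degree) ⟩
      2 * Λ * (n * n) * ∑ xs degree  ≡⟨ sym (∑-*ˡ xs (2 * Λ * (n * n)) degree) ⟩
      ∑ xs (λ x → 2 * Λ * (n * n) * degree x)  ≤⟨ ∑-mono xs (λ x → convex (degree x)) ⟩
      ∑ xs (λ x → Λ * Λ * (degree x * degree x) + n * n * (n * n)) ≡⟨ trans (∑-+ xs _ _) (cong₂ _+_ (∑-*ˡ xs (Λ * Λ) _) (∑-const xs _)) ⟩
      Λ * Λ * ∑ xs (λ x → degree x * degree x) + length xs * (n * n * (n * n)) ≤⟨ +-monoʳ-≤ _ (*-monoˡ-≤ _ xs≤n) ⟩
      Λ * Λ * ∑ xs (λ x → degree x * degree x) + n * (n * n * (n * n)) ≡⟨ cong (Λ * Λ * ∑ xs (λ x → degree x * degree x) +_) (fifth n) ⟩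
      Λ * Λ * ∑ xs (λ x → degree x * degree x) + n * n * (n * n * n) ∎)
      where
      double : ∀ a → a + a ≡ 2 * a
      double = solve-∀
      fifth : ∀ n → n * (n * n * (n * n)) ≡ n * n * (n * n * n)
      fifth = solve-∀
      rearrange : ∀ a l s → 2 * (a * (l * s)) ≡ 2 * l * a * s
      rearrange = solve-∀
      e₁ : ∀ l q d → 2 * l * q * d ≡ 2 * (l * d * q)
      e₁ = solve-∀
      e₂ : ∀ l d → l * d * (l * d) ≡ l * l * (d * d)
      e₂ = solve-∀
      convex : ∀ d → 2 * Λ * (n * n) * d ≤ Λ * Λ * (d * d) + n * n * (n * n)
      convex d = begin
        2 * Λ * (n * n) * d  ≡⟨ e₁ Λ (n * n) d ⟩
        2 * (Λ * d * (n * n))  ≤⟨ am-gm (Λ * d) (n * n) ⟩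
        Λ * d * (Λ * d) + n * n * (n * n)  ≡⟨ cong (_+ n * n * (n * n)) (e₂ Λ d) ⟩
        Λ * Λ * (d * d) + n * n * (n * n) ∎

    -- Two demands in one inequality, so that a single average meets both: the degree is at least n²
    -- / 2Λ, and few pairs of neighbours are unlinked compared with the square of the degree.
    Pivotal : A → Set
    Pivotal x = n * n * (n * n) + θ * unlinked x ≤ 2 * (Λ * Λ) * (degree x * degree x)

    pivotal : ∃ λ x → x ∈ xs × Pivotal x
    pivotal = ∑-exists≤ xs xs-nonempty (begin
      ∑ xs (λ x → n * n * (n * n) + θ * unlinked x)  ≡⟨ trans (∑-+ xs _ _) (cong₂ _+_ (∑-const xs _) (∑-*ˡ xs θ unlinked)) ⟩
      length xs * (n * n * (n * n)) + θ * ∑ xs unlinked ≤⟨ +-mono-≤ (*-monoˡ-≤ _ xs≤n) unlinked-total ⟩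
      n * (n * n * (n * n)) + n * n * (n * n * n)  ≡⟨ double n ⟩
      2 * (n * n * (n * n * n))  ≤⟨ *-monoʳ-≤ 2 degree-total ⟩
      2 * (Λ * Λ * ∑ xs (λ x → degree x * degree x))  ≡⟨ trans (sym (*-assoc 2 (Λ * Λ) _)) (sym (∑-*ˡ xs (2 * (Λ * Λ)) _)) ⟩
      ∑ xs (λ x → 2 * (Λ * Λ) * (degree x * degree x)) ∎)
      where
      double : ∀ n → n * (n * n * (n * n)) + n * n * (n * n * n) ≡ 2 * (n * n * (n * n * n))
      double = solve-∀
      xs-nonempty : 0 < length xs
      xs-nonempty = nonempty xs degree (positive {c = Λ} (*-mono-≤ (*-mono-≤ 1≤n 1≤n) 1≤n) dense)

  -- Two good vertices are joined by many paths v, x, w, x′, v′ of length four: `many-links` counts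
  -- the middle vertices w, and linkage supplies x and x′.
  record WellLinked : Set₁ where
    field
      Good : V → Set
      good? : Decidable Good
      many-good : n * n ≤ 4 * Λ * ∑ vs λ v → ⟦ good? v ⟧
      many-links : ∀ {v v′} → Good v → Good v′ → n * n ≤ 4 * Λ * ∑ vs λ w → ⟦ linked? v w ×-dec linked? v′ w ⟧

  private
    module At (x : A) (h : Pivotal x) where
      D = degree x

      bad : V → ℕ
      bad v = ∑ vs λ w → ⟦ E? x w ⟧ * ⟦ ¬? (linked? v w) ⟧

      n²≤ : n * n ≤ 2 * Λ * D
      n²≤ = square-cancel-≤ _ _ (begin
        n * n * (n * n)  ≤⟨ m≤m+n _ _ ⟩
        _  ≤⟨ h ⟩
        2 * (Λ * Λ) * (D * D)  ≤⟨ *-monoˡ-≤ (D * D) (*-monoˡ-≤ (Λ * Λ) (m≤m+n 2 2)) ⟩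
        4 * (Λ * Λ) * (D * D)  ≡⟨ e Λ D ⟩
        2 * Λ * D * (2 * Λ * D) ∎)
        where
        e : ∀ l d → 4 * (l * l) * (d * d) ≡ 2 * l * d * (2 * l * d)
        e = solve-∀

      1≤D : 1 ≤ D
      1≤D = positive {c = 2 * Λ} (*-mono-≤ 1≤n 1≤n) n²≤

      -- The value θ = 32 Λ² is chosen for the 16: it implies that at most a quarter of the
      -- neighbours of x are unlinked to more than a quarter of them.
      bad-total : 16 * ∑ vs (λ v → ⟦ E? x v ⟧ * bad v) ≤ D * D
      bad-total = *-cancelˡ-≤ (2 * (Λ * Λ)) {{m*n≢0 2 (Λ * Λ) {{_}} {{m*n≢0 Λ Λ}}}} (begin
        2 * (Λ * Λ) * (16 * ∑ vs (λ v → ⟦ E? x v ⟧ * bad v))  ≡⟨ trans (e (Λ * Λ) _) (cong (_* ∑ vs (λ v → ⟦ E? x v ⟧ * bad v)) (sym θ≡)) ⟩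
        θ * ∑ vs (λ v → ⟦ E? x v ⟧ * bad v)  ≡⟨ cong (θ *_) (∑-cong vs λ v → trans (sym (∑-*ˡ vs ⟦ E? x v ⟧ _)) (∑-cong vs λ w → sym (*-assoc ⟦ E? x v ⟧ _ _))) ⟩
        θ * unlinked x  ≤⟨ m≤n+m _ _ ⟩
        _  ≤⟨ h ⟩
        2 * (Λ * Λ) * (D * D) ∎)
        where
        e : ∀ l s → 2 * l * (16 * s) ≡ 32 * l * s
        e = solve-∀

      good? : ∀ v → Dec (E x v × 4 * bad v ≤ D)
      good? v = E? x v ×-dec (4 * bad v ≤? D)

      spoiled = ∑ vs λ v → ⟦ E? x v ×-dec ¬? (4 * bad v ≤? D) ⟧
      goods = ∑ vs λ v → ⟦ good? v ⟧

      4spoiled≤D : 4 * spoiled ≤ D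
      4spoiled≤D = *-cancelʳ-≤ (4 * spoiled) D D {{>-nonZero 1≤D}} (begin
        4 * spoiled * D  ≡⟨ *-assoc 4 spoiled D ⟩
        4 * (spoiled * D)  ≡⟨ cong (4 *_) (sym (∑-*ʳ vs _ D)) ⟩
        4 * ∑ vs (λ v → ⟦ E? x v ×-dec ¬? (4 * bad v ≤? D) ⟧ * D)  ≤⟨ *-monoʳ-≤ 4 (∑-mono vs each) ⟩
        4 * ∑ vs (λ v → 4 * (⟦ E? x v ⟧ * bad v))  ≡⟨ cong (4 *_) (∑-*ˡ vs 4 _) ⟩
        4 * (4 * ∑ vs (λ v → ⟦ E? x v ⟧ * bad v))  ≡⟨ sym (*-assoc 4 4 (∑ vs (λ v → ⟦ E? x v ⟧ * bad v))) ⟩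
        16 * ∑ vs (λ v → ⟦ E? x v ⟧ * bad v)  ≤⟨ bad-total ⟩
        D * D ∎)
        where
        each : ∀ v → ⟦ E? x v ×-dec ¬? (4 * bad v ≤? D) ⟧ * D ≤ 4 * (⟦ E? x v ⟧ * bad v)
        each v = begin
          ⟦ E? x v ×-dec ¬? (4 * bad v ≤? D) ⟧ * D  ≤⟨ ⟦⟧*-mono (E? x v ×-dec ¬? (4 * bad v ≤? D)) (λ { (_ , nb) → <⇒≤ (≰⇒> nb) }) ⟩
          ⟦ E? x v ×-dec ¬? (4 * bad v ≤? D) ⟧ * (4 * bad v) ≤⟨ *-monoˡ-≤ (4 * bad v) (⟦⟧-mono (E? x v ×-dec ¬? (4 * bad v ≤? D)) (E? x v) proj₁) ⟩
          ⟦ E? x v ⟧ * (4 * bad v)  ≡⟨ e ⟦ E? x v ⟧ (bad v) ⟩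
          4 * (⟦ E? x v ⟧ * bad v) ∎
          where
          e : ∀ a b → a * (4 * b) ≡ 4 * (a * b)
          e = solve-∀

      D≤2goods : D ≤ 2 * goods
      D≤2goods = *-cancelˡ-≤ 2 (+-cancelʳ-≤ (D + D) _ _ (begin
        2 * D + (D + D)  ≡⟨ e₁ D ⟩
        4 * D  ≡⟨ cong (4 *_) (trans (∑-cong vs λ v → ⟦⟧-split (E? x v) (4 * bad v ≤? D)) (∑-+ vs _ _)) ⟩
        4 * (goods + spoiled)  ≡⟨ *-distribˡ-+ 4 goods spoiled ⟩
        4 * goods + 4 * spoiled  ≤⟨ +-mono-≤ (≤-reflexive (*-assoc 2 2 goods)) (≤-trans 4spoiled≤D (m≤m+n D D)) ⟩
        2 * (2 * goods) + (D + D) ∎))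
        where
        e₁ : ∀ d → 2 * d + (d + d) ≡ 4 * d
        e₁ = solve-∀

      -- Each of v and v′ loses at most a quarter of the neighbourhood of x, so at least half of it
      -- is linked to both.
      D≤2links : ∀ {v v′} → 4 * bad v ≤ D → 4 * bad v′ ≤ D → D ≤ 2 * ∑ vs λ w → ⟦ linked? v w ×-dec linked? v′ w ⟧
      D≤2links {v} {v′} b b′ = *-cancelˡ-≤ 2 (+-cancelʳ-≤ (D + D) _ _ (begin
        2 * D + (D + D)  ≡⟨ e₁ D ⟩
        4 * D  ≤⟨ *-monoʳ-≤ 4 (∑-mono vs λ w → cover (E? x w) (linked? v w) (linked? v′ w)) ⟩
        4 * ∑ vs (λ w → ⟦ linked? v w ×-dec linked? v′ w ⟧ + (⟦ E? x w ⟧ * ⟦ ¬? (linked? v w) ⟧ + ⟦ E? x w ⟧ * ⟦ ¬? (linked? v′ w) ⟧))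
          ≡⟨ cong (4 *_) (trans (∑-+ vs _ _) (cong (links +_) (∑-+ vs _ _))) ⟩
        4 * (links + (bad v + bad v′))  ≡⟨ e₂ links (bad v) (bad v′) ⟩
        2 * (2 * links) + (4 * bad v + 4 * bad v′) ≤⟨ +-monoʳ-≤ (2 * (2 * links)) (+-mono-≤ b b′) ⟩
        2 * (2 * links) + (D + D) ∎))
        where
        links = ∑ vs λ w → ⟦ linked? v w ×-dec linked? v′ w ⟧
        e₁ : ∀ d → 2 * d + (d + d) ≡ 4 * d
        e₁ = solve-∀
        e₂ : ∀ a b c → 4 * (a + (b + c)) ≡ 2 * (2 * a) + (4 * b + 4 * c)
        e₂ = solve-∀
        cover : ∀ {P Q R : Set} (p : Dec P) (q : Dec Q) (r : Dec R) → ⟦ p ⟧ ≤ ⟦ q ×-dec r ⟧ + (⟦ p ⟧ * ⟦ ¬? q ⟧ + ⟦ p ⟧ * ⟦ ¬? r ⟧)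
        cover (no _) q r = z≤n
        cover (yes _) (yes _) (yes _) = s≤s z≤n
        cover (yes _) (yes _) (no _) = s≤s z≤n
        cover (yes _) (no _) r = s≤s z≤n

      weaken : ∀ s → D ≤ 2 * s → n * n ≤ 4 * Λ * s
      weaken s h = begin
        n * n  ≤⟨ n²≤ ⟩
        2 * Λ * D  ≤⟨ *-monoʳ-≤ (2 * Λ) h ⟩
        2 * Λ * (2 * s)  ≡⟨ e Λ s ⟩
        4 * Λ * s ∎
        where
        e : ∀ l s → 2 * l * (2 * s) ≡ 4 * l * s
        e = solve-∀

      wellLinked : WellLinked
      wellLinked = record
        { Good = λ v → E x v × 4 * bad v ≤ D
        ; good? = good?
        ; many-good = weaken goods D≤2goods
        ; many-links = λ { (_ , b) (_ , b′) → weaken _ (D≤2links b b′) } }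

  abstract
    -- Dependent random choice: the neighbourhood of a suitable x consists mostly of linked pairs.
    well-linked : WellLinked
    well-linked = At.wellLinked (proj₁ pivotal) (proj₂ (proj₂ pivotal))

-- A fibre that overlaps many others

module Fibres (F : PrimeField) where
  open PrimeField F
  open Sets F

  module _ (Y T : Subset) (fibre : K → Subset) (n Λ : ℕ) (1≤n : 1 ≤ n) (Y≤n : # Y ≤ n) (T≤n : # T ≤ n)
    (fibre⊆Y : ∀ {t} → fibre t ⊆ Y) (mass : n * n ≤ 4 * Λ * ∑ (el T) λ t → # (fibre t)) where
    private
      open ≤-Reasoning

      heavy? : ∀ t → Dec (n ≤ 8 * Λ * # (fibre t))
      heavy? t = n ≤? 8 * Λ * # (fibre t)

      heavies : List K
      heavies = filter heavy? (el T)

      m₁ : ℕ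
      m₁ = ∑ heavies λ t → # (fibre t)

      -- As |T| ≤ n, the fibres smaller than n / 8Λ carry at most half of the total.
      heavy-mass : n * n ≤ 8 * Λ * m₁
      heavy-mass = +-cancelʳ-≤ (n * n) _ _ (begin
        n * n + n * n  ≤⟨ +-mono-≤ mass mass ⟩
        4 * Λ * S + 4 * Λ * S  ≡⟨ e Λ S ⟩
        8 * Λ * S  ≡⟨ sym (∑-*ˡ (el T) (8 * Λ) _) ⟩
        ∑ (el T) (λ t → 8 * Λ * # (fibre t))  ≤⟨ ∑-mono (el T) (λ t → each t) ⟩
        ∑ (el T) (λ t → 8 * Λ * (⟦ heavy? t ⟧ * # (fibre t)) + n)  ≡⟨ trans (∑-+ (el T) _ _) (cong₂ _+_ (trans (∑-*ˡ (el T) (8 * Λ) _) (cong (8 * Λ *_) (sym (∑-filter heavy? (el T) _)))) (∑-const (el T) n)) ⟩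
        8 * Λ * m₁ + length (el T) * n  ≤⟨ +-monoʳ-≤ (8 * Λ * m₁) (*-monoˡ-≤ n (≤-trans (≤-reflexive (length-el T)) T≤n)) ⟩
        8 * Λ * m₁ + n * n ∎)
        where
        S = ∑ (el T) λ t → # (fibre t)
        e : ∀ l s → 4 * l * s + 4 * l * s ≡ 8 * l * s
        e = solve-∀
        each : ∀ t → 8 * Λ * # (fibre t) ≤ 8 * Λ * (⟦ heavy? t ⟧ * # (fibre t)) + n
        each t = go (heavy? t)
          where
          go : (d : Dec (n ≤ 8 * Λ * # (fibre t))) → 8 * Λ * # (fibre t) ≤ 8 * Λ * (⟦ d ⟧ * # (fibre t)) + n
          go (yes _) = ≤-trans (≤-reflexive (cong (8 * Λ *_) (sym (+-identityʳ (# (fibre t)))))) (m≤m+n _ n)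
          go (no h) = ≤-trans (<⇒≤ (≰⇒> h)) (m≤n+m n _)

      degree : K → ℕ
      degree y = ∑ heavies λ t → ⟦ fibre t ∋? y ⟧

      degree-total : ∑ (el Y) degree ≡ m₁
      degree-total = trans (∑-swap (el Y) heavies _) (∑-cong heavies λ t → trans (∑-filter (Y ∋?_) U _)
        (∑-cong U λ y → trans (sym (⟦×⟧ (Y ∋? y) (fibre t ∋? y))) (⟦⟧-cong ((Y ∋? y) ×-dec (fibre t ∋? y)) (fibre t ∋? y) proj₂ (λ h → fibre⊆Y h , h))))

      common : K → K → ℕ
      common t₀ t = # (fibre t₀ ∩ fibre t)

      common-total : ∑ heavies (λ t₀ → ∑ heavies λ t → common t₀ t) ≡ ∑ U λ y → degree y * degree y
      common-total = trans (∑-cong heavies λ t₀ → trans (∑-cong heavies λ t → ∑-cong U λ y → ⟦×⟧ (fibre t₀ ∋? y) (fibre t ∋? y)) (∑-swap heavies U _))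
        (trans (∑-swap heavies U _) (∑-cong U λ y → sym (∑-product heavies heavies _ _)))

      -- The second moment of the number of heavy fibres through a point of `Y`, again in tangent
      -- form; `heavy-mass` bounds the added n³ by half of the left side.
      common-large : n * m₁ ≤ 8 * Λ * ∑ heavies (λ t₀ → ∑ heavies λ t → common t₀ t)
      common-large = *-cancelˡ-≤ (8 * Λ) {{>-nonZero (positive {c = m₁} (*-mono-≤ 1≤n 1≤n) (≤-trans heavy-mass (≤-reflexive (*-comm (8 * Λ) m₁))))}}
        (+-cancelʳ-≤ (8 * Λ * (n * m₁)) _ _ (begin
        8 * Λ * (n * m₁) + 8 * Λ * (n * m₁)  ≡⟨ e₁ Λ n m₁ ⟩
        16 * Λ * n * m₁  ≡⟨ trans (cong (16 * Λ * n *_) (sym degree-total)) (sym (∑-*ˡ (el Y) (16 * Λ * n) degree)) ⟩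
        ∑ (el Y) (λ y → 16 * Λ * n * degree y)  ≤⟨ ∑-mono (el Y) (λ y → convex (degree y)) ⟩
        ∑ (el Y) (λ y → 8 * Λ * (8 * Λ) * (degree y * degree y) + n * n)  ≡⟨ trans (∑-+ (el Y) _ _) (cong₂ _+_ (∑-*ˡ (el Y) (8 * Λ * (8 * Λ)) _) (∑-const (el Y) (n * n))) ⟩
        8 * Λ * (8 * Λ) * ∑ (el Y) (λ y → degree y * degree y) + length (el Y) * (n * n)
          ≤⟨ +-mono-≤ (*-monoʳ-≤ (8 * Λ * (8 * Λ)) (≤-trans (≤-reflexive (∑-filter (Y ∋?_) U _)) (∑-mono U λ y → ⟦⟧*≤ (Y ∋? y))))
               (≤-trans (*-monoˡ-≤ (n * n) (≤-trans (≤-reflexive (length-el Y)) Y≤n)) (*-monoʳ-≤ n heavy-mass)) ⟩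
        8 * Λ * (8 * Λ) * ∑ U (λ y → degree y * degree y) + n * (8 * Λ * m₁)
          ≡⟨ trans (e₂ (8 * Λ) _ n m₁) (cong (λ s → 8 * Λ * (8 * Λ * s) + 8 * Λ * (n * m₁)) (sym common-total)) ⟩
        8 * Λ * (8 * Λ * ∑ heavies (λ t₀ → ∑ heavies λ t → common t₀ t)) + 8 * Λ * (n * m₁) ∎))
        where
        e₁ : ∀ l n m → 8 * l * (n * m) + 8 * l * (n * m) ≡ 16 * l * n * m
        e₁ = solve-∀
        e₂ : ∀ l s n m → l * l * s + n * (l * m) ≡ l * (l * s) + l * (n * m)
        e₂ = solve-∀
        e₃ : ∀ l n d → 16 * l * n * d ≡ 2 * (8 * l * d * n)
        e₃ = solve-∀
        e₄ : ∀ l d → l * d * (l * d) ≡ l * l * (d * d)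
        e₄ = solve-∀
        convex : ∀ d → 16 * Λ * n * d ≤ 8 * Λ * (8 * Λ) * (d * d) + n * n
        convex d = begin
          16 * Λ * n * d  ≡⟨ e₃ Λ n d ⟩
          2 * (8 * Λ * d * n)  ≤⟨ am-gm (8 * Λ * d) n ⟩
          8 * Λ * d * (8 * Λ * d) + n * n  ≡⟨ cong (_+ n * n) (e₄ (8 * Λ) d) ⟩
          8 * Λ * (8 * Λ) * (d * d) + n * n ∎

      -- The average is weighted by |fibre t₀|, so that the overlaps of the chosen fibre are large
      -- in proportion to its own size; heaviness makes that size comparable to n.
      central : ∃ λ t₀ → t₀ ∈ heavies × n * # (fibre t₀) ≤ 8 * Λ * ∑ heavies (common t₀)
      central = ∑-exists≤ heavies (nonempty heavies (λ t → # (fibre t)) (positive {c = 8 * Λ} (*-mono-≤ 1≤n 1≤n) heavy-mass)) (begin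
        ∑ heavies (λ t₀ → n * # (fibre t₀))  ≡⟨ ∑-*ˡ heavies n _ ⟩
        n * m₁  ≤⟨ common-large ⟩
        8 * Λ * ∑ heavies (λ t₀ → ∑ heavies (common t₀))  ≡⟨ sym (∑-*ˡ heavies (8 * Λ) _) ⟩
        ∑ heavies (λ t₀ → 8 * Λ * ∑ heavies (common t₀)) ∎)

    close? : ∀ t₀ t → Dec (# (fibre t₀) ≤ 16 * Λ * # (fibre t₀ ∩ fibre t))
    close? t₀ t = # (fibre t₀) ≤? 16 * Λ * # (fibre t₀ ∩ fibre t)

    private
      centre : ∃ λ t₀ → T ∋ t₀ × n ≤ 8 * Λ * # (fibre t₀) × n ≤ 16 * Λ * ∑ (el T) λ t → ⟦ close? t₀ t ⟧
      centre = t₀ , ∈-el⁻ {T} (proj₁ (∈-filter⁻ heavy? {xs = el T} t₀∈)) , heavy , *-cancelʳ-≤ n (16 * Λ * C) y {{>-nonZero 1≤y}}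
        (+-cancelʳ-≤ (n * y) _ _ (begin
          n * y + n * y  ≤⟨ +-mono-≤ popular popular ⟩
          8 * Λ * V + 8 * Λ * V  ≡⟨ e₁ Λ V ⟩
          16 * Λ * V  ≡⟨ cong (16 * Λ *_) (∑-filter heavy? (el T) _) ⟩
          16 * Λ * ∑ (el T) (λ t → ⟦ heavy? t ⟧ * common t₀ t)  ≤⟨ *-monoʳ-≤ (16 * Λ) (∑-mono (el T) λ t → ⟦⟧*≤ (heavy? t)) ⟩
          16 * Λ * ∑ (el T) (common t₀)  ≡⟨ sym (∑-*ˡ (el T) (16 * Λ) _) ⟩
          ∑ (el T) (λ t → 16 * Λ * common t₀ t)  ≤⟨ ∑-mono (el T) each ⟩
          ∑ (el T) (λ t → 16 * Λ * y * ⟦ close? t₀ t ⟧ + y)  ≡⟨ trans (∑-+ (el T) _ _) (cong₂ _+_ (∑-*ˡ (el T) (16 * Λ * y) _) (∑-const (el T) y)) ⟩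
          16 * Λ * y * C + length (el T) * y  ≤⟨ +-mono-≤ (≤-reflexive (e₂ Λ y C)) (*-monoˡ-≤ y (≤-trans (≤-reflexive (length-el T)) T≤n)) ⟩
          16 * Λ * C * y + n * y ∎))
        where
        t₀ = proj₁ central
        t₀∈ = proj₁ (proj₂ central)
        y = # (fibre t₀)
        heavy : n ≤ 8 * Λ * y
        heavy = proj₂ (∈-filter⁻ heavy? {xs = el T} t₀∈)
        1≤y : 1 ≤ y
        1≤y = positive {c = 8 * Λ} 1≤n heavy
        V = ∑ heavies (common t₀)
        C = ∑ (el T) λ t → ⟦ close? t₀ t ⟧
        popular : n * y ≤ 8 * Λ * V
        popular = proj₂ (proj₂ central)
        e₁ : ∀ l v → 8 * l * v + 8 * l * v ≡ 16 * l * v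
        e₁ = solve-∀
        e₂ : ∀ l y c → 16 * l * y * c ≡ 16 * l * c * y
        e₂ = solve-∀
        each : ∀ t → 16 * Λ * common t₀ t ≤ 16 * Λ * y * ⟦ close? t₀ t ⟧ + y
        each t = go (close? t₀ t)
          where
          go : (d : Dec (y ≤ 16 * Λ * common t₀ t)) → 16 * Λ * common t₀ t ≤ 16 * Λ * y * ⟦ d ⟧ + y
          go (yes _) = ≤-trans (*-monoʳ-≤ (16 * Λ) (#-mono {fibre t₀ ∩ fibre t} {fibre t₀} proj₁))
            (≤-trans (≤-reflexive (sym (*-identityʳ (16 * Λ * y)))) (m≤m+n _ y))
          go (no h) = ≤-trans (<⇒≤ (≰⇒> h)) (m≤n+m y _)

    abstract
      central-fibre : ∃ λ t₀ → T ∋ t₀ × n ≤ 8 * Λ * # (fibre t₀) × n ≤ 16 * Λ * ∑ (el T) λ t → ⟦ close? t₀ t ⟧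
      central-fibre = centre

-- If a ≥ 2c, then c m² is at most half of m² a, leaving m² ≤ 2 c a with m and a both of order n. If
-- a ≤ 2c, then n ≤ 8 Λ a is already enough.
growth-consequence : ∀ n m a Λ c → 1 ≤ n → 1 ≤ Λ → 1 ≤ c → m * m * a ≤ c * (m * m + a * a) →
  n ≤ 16 * Λ * m → n ≤ 8 * Λ * a → a ≤ n → n ≤ 512 * (Λ * Λ) * c
growth-consequence n m a Λ c 1≤n 1≤Λ 1≤c growth n≤m n≤a a≤n with ≤-total a (2 * c)
... | inj₁ a≤2c = begin
  n  ≤⟨ n≤a ⟩
  8 * Λ * a  ≤⟨ *-monoʳ-≤ (8 * Λ) a≤2c ⟩
  8 * Λ * (2 * c)  ≡⟨ e₁ Λ c ⟩
  16 * (1 * Λ) * c  ≤⟨ *-monoˡ-≤ c (*-mono-≤ {16} {512} (m≤m+n 16 496) (*-monoˡ-≤ Λ 1≤Λ)) ⟩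
  512 * (Λ * Λ) * c ∎
  where
  open ≤-Reasoning
  e₁ : ∀ l c → 8 * l * (2 * c) ≡ 16 * (1 * l) * c
  e₁ = solve-∀
... | inj₂ 2c≤a = *-cancelʳ-≤ n (512 * (Λ * Λ) * c) n {{>-nonZero 1≤n}} (begin
  n * n  ≤⟨ *-mono-≤ n≤m n≤m ⟩
  16 * Λ * m * (16 * Λ * m)  ≡⟨ e₁ Λ m ⟩
  256 * (Λ * Λ) * (m * m)  ≤⟨ *-monoʳ-≤ (256 * (Λ * Λ)) m²≤ ⟩
  256 * (Λ * Λ) * (2 * c * a)  ≤⟨ *-monoʳ-≤ (256 * (Λ * Λ)) (*-monoʳ-≤ (2 * c) a≤n) ⟩
  256 * (Λ * Λ) * (2 * c * n)  ≡⟨ e₂ (Λ * Λ) c n ⟩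
  512 * (Λ * Λ) * c * n ∎)
  where
  open ≤-Reasoning
  e₁ : ∀ l m → 16 * l * m * (16 * l * m) ≡ 256 * (l * l) * (m * m)
  e₁ = solve-∀
  e₂ : ∀ l c n → 256 * l * (2 * c * n) ≡ 512 * l * c * n
  e₂ = solve-∀
  e₃ : ∀ c q a → 2 * (c * (q + a * a)) ≡ q * (2 * c) + 2 * c * a * a
  e₃ = solve-∀
  e₄ : ∀ q a → q * a + q * a ≡ 2 * (q * a)
  e₄ = solve-∀
  m²≤ : m * m ≤ 2 * c * a
  m²≤ = *-cancelʳ-≤ (m * m) (2 * c * a) a {{>-nonZero (positive {c = 8 * Λ} 1≤n n≤a)}} (+-cancelˡ-≤ (m * m * a) _ _ (begin
    m * m * a + m * m * a  ≡⟨ e₄ (m * m) a ⟩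
    2 * (m * m * a)  ≤⟨ *-monoʳ-≤ 2 growth ⟩
    2 * (c * (m * m + a * a))  ≡⟨ e₃ c (m * m) a ⟩
    m * m * (2 * c) + 2 * c * a * a ≤⟨ +-monoˡ-≤ _ (*-monoʳ-≤ (m * m) 2c≤a) ⟩
    m * m * a + 2 * c * a * a ∎))

-- Opaque, so that conversion checking never unfolds multiplications by the large literals.
abstract
  doubling : ℕ → ℕ → ℕ
  doubling Λ M₀ = 1024 * (Λ * Λ * Λ) * (M₀ * M₀)

  doubling-def : ∀ Λ M₀ → doubling Λ M₀ ≡ 1024 * (Λ * Λ * Λ) * (M₀ * M₀)
  doubling-def Λ M₀ = refl

  pivot-loss : ℕ → ℕ
  pivot-loss k = 4096 * k ^ 7

  pivot-loss-def : ∀ k → pivot-loss k ≡ 4096 * k ^ 7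
  pivot-loss-def k = refl

-- One set with many multipliers

module Rescaling (F : PrimeField) where
  open PrimeField F
  open RingSolver isCommutativeRing using (solve; _:=_; _:+_; _:*_; :-_; _:-_; :0; :1)
  open Sets F
  open Pivot F
  open Fibres F

  module _ (T : Subset) (fibre : K → Subset) (n Λ M₀ : ℕ) (1≤n : 1 ≤ n) (1≤Λ : 1 ≤ Λ) (1≤M₀ : 1 ≤ M₀)
    (T≢0 : ∀ {t} → T ∋ t → t ≢ 0ᶠ)
    (differences : ∀ t t′ → # (t · fibre t ⊕ (-ᶠ t′) · fibre t′) ≤ M₀ * n)
    (n²≤p : n * n ≤ length U) (t₀ : K) (t₀∈ : T ∋ t₀) (fibre≤n : # (fibre t₀) ≤ n)
    (closeness : ∀ t → Dec (# (fibre t₀) ≤ 16 * Λ * # (fibre t₀ ∩ fibre t)))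
    (heavy : n ≤ 8 * Λ * # (fibre t₀)) (many : n ≤ 16 * Λ * ∑ (el T) λ t → ⟦ closeness t ⟧) where
    private
      open ≤-Reasoning
      y = # (fibre t₀)

      A : Subset
      A = t₀ · fibre t₀

      t₀≢0 : t₀ ≢ 0ᶠ
      t₀≢0 = T≢0 t₀∈

      t₀-inv : ∀ t → t *ᶠ inv t₀ *ᶠ t₀ ≡ t
      t₀-inv t = trans (solve 3 (λ t i s → t :* i :* s := (s :* i) :* t) refl t (inv t₀) t₀)
        (trans (cong (_*ᶠ t) (inverse t₀≢0)) (solve 1 (λ t → :1 :* t := t) refl t))

      y≤a : y ≤ # A
      y≤a = #-dilate (fibre t₀) t₀≢0

      a≤n : # A ≤ n
      a≤n = ≤-trans (#-dilate≤ (fibre t₀) t₀≢0) fibre≤n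

      -- Dividing by t₀ makes τ A equal to t · fibre t₀, which overlaps t · fibre t in a fixed
      -- proportion.
      multipliers : Subset
      multipliers = record
        { _∋_ = λ τ → ∃ λ t → T ∋ t × y ≤ 16 * Λ * # (fibre t₀ ∩ fibre t) × τ ≡ t *ᶠ inv t₀
        ; _∋?_ = λ τ → ∃? λ t → (T ∋? t) ×-dec closeness t ×-dec (τ ≟ (t *ᶠ inv t₀)) }

      multipliers≢0 : ∀ {τ} → multipliers ∋ τ → τ ≢ 0ᶠ
      multipliers≢0 (t , t∈ , _ , refl) e = T≢0 t∈ (trans (sym (t₀-inv t)) (trans (cong (_*ᶠ t₀) e) (solve 1 (λ t → :0 :* t := :0) refl t₀)))

      multipliers-many : n ≤ 16 * Λ * # multipliers
      multipliers-many = ≤-trans many (*-monoʳ-≤ (16 * Λ) (∑-injection closeness (multipliers ∋?_) _≟_ (el T) U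
        (filter⁺ (T ∋?_) U-unique) (_*ᶠ inv t₀)
        (λ {t} t∈ c → U-complete _ , (t , ∈-el⁻ {T} t∈ , c , refl))
        (λ {t} {s} _ _ _ _ e → trans (sym (t₀-inv t)) (trans (cong (_*ᶠ t₀) e) (t₀-inv s)))))

      k : ℕ
      k = doubling Λ M₀

      1≤k : 1 ≤ k
      1≤k = subst (1 ≤_) (sym (doubling-def Λ M₀)) (*-mono-≤ (*-mono-≤ {1} {1024} (m≤m+n 1 1023) (*-mono-≤ (*-mono-≤ 1≤Λ 1≤Λ) 1≤Λ)) (*-mono-≤ 1≤M₀ 1≤M₀))

      -- Ruzsa's inequality through -t `Z`, where `Z` is the overlap of the two fibres: viewed
      -- inside `fibre t` it leads to the difference set of t₀ and t, viewed inside `fibre t₀` to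
      -- the dilate by τ of the difference set of t₀ with itself.
      rescaled : ∀ {t} → T ∋ t → y ≤ 16 * Λ * # (fibre t₀ ∩ fibre t) →
        # (A ⊕ (-ᶠ (t *ᶠ inv t₀)) · A) * y ≤ 16 * Λ * (M₀ * n * (M₀ * n))
      rescaled {t} t∈ c = begin
        # W * y  ≤⟨ *-monoʳ-≤ (# W) c ⟩
        # W * (16 * Λ * # Z)  ≡⟨ e (# W) (16 * Λ) (# Z) ⟩
        16 * Λ * (# W * # Z)  ≤⟨ *-monoʳ-≤ (16 * Λ) (≤-trans (*-monoʳ-≤ (# W) (#-dilate Z (neg≢0 (T≢0 t∈)))) (ruzsa-triangle W ((-ᶠ t) · Z) P Q rep)) ⟩
        16 * Λ * (# P * # Q)  ≤⟨ *-monoʳ-≤ (16 * Λ) (*-mono-≤ (differences t₀ t)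
              (≤-trans (#-dilate≤ (A ⊕ (-ᶠ t₀) · fibre t₀) τ≢0) (differences t₀ t₀))) ⟩
        16 * Λ * (M₀ * n * (M₀ * n)) ∎
        where
        τ = t *ᶠ inv t₀
        τ≢0 = multipliers≢0 (t , t∈ , c , refl)
        W = A ⊕ (-ᶠ τ) · A
        Z = fibre t₀ ∩ fibre t
        P = A ⊕ (-ᶠ t) · fibre t
        Q = τ · (A ⊕ (-ᶠ t₀) · fibre t₀)
        e : ∀ w l z → w * (l * z) ≡ l * (w * z)
        e = solve-∀
        rep : ∀ {w} → W ∋ w → ∃ λ { (β , γ) → w ≡ β -ᶠ γ × (∀ {x} → ((-ᶠ t) · Z) ∋ x → P ∋ (x +ᶠ β) × Q ∋ (x +ᶠ γ)) }
        rep (_ , _ , (u , u∈ , refl) , (_ , (v , v∈ , refl) , refl) , refl) = (t₀ *ᶠ u , τ *ᶠ (t₀ *ᶠ v)) ,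
          solve 3 (λ a τ b → a :+ (:- τ) :* b := a :- τ :* b) refl (t₀ *ᶠ u) τ (t₀ *ᶠ v) ,
          λ { (z , (z∈₀ , z∈) , refl) →
            (t₀ *ᶠ u , -ᶠ t *ᶠ z , (u , u∈ , refl) , (z , z∈ , refl) , solve 2 (λ a b → a :+ b := b :+ a) refl (-ᶠ t *ᶠ z) (t₀ *ᶠ u)) ,
            (t₀ *ᶠ v +ᶠ -ᶠ t₀ *ᶠ z , (t₀ *ᶠ v , -ᶠ t₀ *ᶠ z , (v , v∈ , refl) , (z , z∈₀ , refl) , refl) ,
              trans (cong (λ s → -ᶠ s *ᶠ z +ᶠ τ *ᶠ (t₀ *ᶠ v)) (sym (t₀-inv t)))
                (solve 4 (λ τ s z b → (:- (τ :* s)) :* z :+ τ :* (s :* b) := τ :* (s :* b :+ (:- s) :* z)) refl τ t₀ z v)) }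

      small : ∀ {τ} → multipliers ∋ τ → # (A ⊕ (-ᶠ τ) · A) ≤ k * # A
      small (t , t∈ , c , refl) = scale (# (A ⊕ (-ᶠ (t *ᶠ inv t₀)) · A)) (rescaled t∈ c)
        where
        scale : ∀ w → w * y ≤ 16 * Λ * (M₀ * n * (M₀ * n)) → w ≤ k * # A
        scale w h = ≤-trans (*-cancelʳ-≤ w (k * y) (n * n) {{>-nonZero (*-mono-≤ 1≤n 1≤n)}} (begin
          w * (n * n)  ≤⟨ *-monoʳ-≤ w (*-mono-≤ heavy heavy) ⟩
          w * (8 * Λ * y * (8 * Λ * y))  ≡⟨ e₁ w Λ y ⟩
          64 * (Λ * Λ) * y * (w * y)  ≤⟨ *-monoʳ-≤ (64 * (Λ * Λ) * y) h ⟩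
          64 * (Λ * Λ) * y * (16 * Λ * (M₀ * n * (M₀ * n)))  ≡⟨ trans (e₂ Λ y M₀ n) (cong (λ k → k * y * (n * n)) (sym (doubling-def Λ M₀))) ⟩
          k * y * (n * n) ∎)) (*-monoʳ-≤ k y≤a)
          where
          e₁ : ∀ w l y → w * (8 * l * y * (8 * l * y)) ≡ 64 * (l * l) * y * (w * y)
          e₁ = solve-∀
          e₂ : ∀ l y m n → 64 * (l * l) * y * (16 * l * (m * n * (m * n))) ≡ 1024 * (l * l * l) * (m * m) * y * (n * n)
          e₂ = solve-∀

      c : ℕ
      c = pivot-loss k

      1≤c : 1 ≤ c
      1≤c = subst (1 ≤_) (sym (pivot-loss-def k)) (*-mono-≤ {1} {4096} (m≤m+n 1 4095) (m^n>0 k {{>-nonZero 1≤k}} 7))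

      n≤8Λa : n ≤ 8 * Λ * # A
      n≤8Λa = ≤-trans heavy (*-monoʳ-≤ (8 * Λ) y≤a)

      bound : Dec (2 ≤ # multipliers) → n ≤ 512 * (Λ * Λ) * c
      bound (yes 2≤m) = growth-consequence n (# multipliers) (# A) Λ c 1≤n 1≤Λ 1≤c
              (subst (λ c → # multipliers * # multipliers * # A ≤ c * (# multipliers * # multipliers + # A * # A)) (sym (pivot-loss-def k))
              (Multipliers.growth A multipliers k 1≤k (positive {c = 8 * Λ} 1≤n n≤8Λa) multipliers≢0 small 2≤m
                (≤-trans (*-mono-≤ a≤n a≤n) n²≤p)))
              multipliers-many n≤8Λa a≤n
      -- With at most one multiplier there is no ratio to work with, but `multipliers-many` then
      -- bounds n by 16 Λ.
      bound (no m<2) = begin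
        n  ≤⟨ multipliers-many ⟩
        16 * Λ * # multipliers  ≤⟨ *-mono-≤ (*-mono-≤ {16} {512} (m≤m+n 16 496) (≤-trans (≤-reflexive (sym (*-identityˡ Λ))) (*-monoˡ-≤ Λ 1≤Λ)))
              (≤-trans (≤-pred (≰⇒> m<2)) 1≤c) ⟩
        512 * (Λ * Λ) * c ∎

    size-bound : n ≤ 512 * (Λ * Λ) * pivot-loss (doubling Λ M₀)
    size-bound = bound (2 ≤? # multipliers)

abstract
  link-loss : ℕ → ℕ
  link-loss Λ = 32 * (Λ * Λ)

  link-loss-def : ∀ Λ → link-loss Λ ≡ 32 * (Λ * Λ)
  link-loss-def Λ = refl

-- A factor 4 Λ for the middle vertices of the paths of length four, and one `link-loss` for each of
-- the two links.
difference-loss : ℕ → ℕ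
difference-loss Λ = 4 * Λ * (link-loss Λ * link-loss Λ)

-- Balog-Szemerédi-Gowers for the sums x + t y

module Multipliers-of-sums (F : PrimeField) where
  open PrimeField F
  open RingSolver isCommutativeRing using (solve; _:=_; _:+_; _:*_; :-_; _:-_; :0; :1)
  open Sets F
  open Pivot F

  ∑-el : ∀ A f → ∑ (el A) f ≡ ∑ U λ x → ⟦ A ∋? x ⟧ * f x
  ∑-el A f = ∑-filter (A ∋?_) U f

  el-unique : ∀ A → Unique (el A)
  el-unique A = filter⁺ (A ∋?_) U-unique

  module Sums (X Y T : Subset) (S : K → Subset) (n Λ : ℕ) (1≤n : 1 ≤ n) (1≤Λ : 1 ≤ Λ)
    (T≢0 : ∀ {t} → T ∋ t → t ≢ 0ᶠ)
    (X≤n : # X ≤ n) (Y≤n : # Y ≤ n) (T≤n : # T ≤ n) (S≤n : ∀ t → # (S t) ≤ n)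
    (n²≤p : n * n ≤ length U)
    (dense : n * n * n ≤ Λ * ∑ (el X) λ x → ∑ (cartesianProduct (el Y) (el T)) λ v → ⟦ S (proj₂ v) ∋? (x +ᶠ proj₂ v *ᶠ proj₁ v) ⟧) where
    private
      open ≤-Reasoning

      vs : List (K × K)
      vs = cartesianProduct (el Y) (el T)

      Edge : K → K × K → Set
      Edge x v = S (proj₂ v) ∋ (x +ᶠ proj₂ v *ᶠ proj₁ v)

      edge? : ∀ x v → Dec (Edge x v)
      edge? x v = S (proj₂ v) ∋? (x +ᶠ proj₂ v *ᶠ proj₁ v)

      elX≤n : length (el X) ≤ n
      elX≤n = ≤-trans (≤-reflexive (length-el X)) X≤n

      elY≤n : length (el Y) ≤ n
      elY≤n = ≤-trans (≤-reflexive (length-el Y)) Y≤n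

      elT≤n : length (el T) ≤ n
      elT≤n = ≤-trans (≤-reflexive (length-el T)) T≤n

      vs≤n² : length vs ≤ n * n
      vs≤n² = begin
        length vs  ≡⟨ sym (trans (∑-const vs 1) (*-identityʳ _)) ⟩
        ∑ vs (λ _ → 1)  ≡⟨ ∑-cartesian (el Y) (el T) _ ⟩
        ∑ (el Y) (λ _ → ∑ (el T) λ _ → 1)  ≡⟨ trans (∑-cong (el Y) λ _ → trans (∑-const (el T) 1) (*-identityʳ _)) (∑-const (el Y) _) ⟩
        length (el Y) * length (el T)  ≤⟨ *-mono-≤ elY≤n elT≤n ⟩
        n * n ∎

      θ : ℕ
      θ = link-loss Λ

      θ≡ : θ ≡ 32 * (Λ * Λ)
      θ≡ = link-loss-def Λ

      codeg : K × K → K × K → ℕ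
      codeg = codegree (el X) vs edge? n Λ θ θ≡ 1≤n 1≤Λ elX≤n vs≤n² dense

      linked : ∀ v w → Dec (n ≤ θ * codeg v w)
      linked = linked? (el X) vs edge? n Λ θ θ≡ 1≤n 1≤Λ elX≤n vs≤n² dense

      open WellLinked (well-linked (el X) vs edge? n Λ θ θ≡ 1≤n 1≤Λ elX≤n vs≤n² dense)

      -- A vertex of the graph is a pair (y , t), so goodness yields a separate set of y for each t.
      fibre : K → Subset
      fibre t = record { _∋_ = λ y → Y ∋ y × Good (y , t) ; _∋?_ = λ y → (Y ∋? y) ×-dec good? (y , t) }

      M₀ : ℕ
      M₀ = difference-loss Λ

      module Differences (t t′ : K) where
        W : Subset
        W = t · fibre t ⊕ (-ᶠ t′) · fibre t′

        Rep : K → K × K → Set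
        Rep w (y , y′) = Good (y , t) × Good (y′ , t′) × w ≡ t *ᶠ y +ᶠ -ᶠ t′ *ᶠ y′

        abstract
         chosen : Σ (K → K × K) λ rep → ∀ {w} → W ∋ w → Rep w (rep w)
         chosen = choose {R = Rep} (W ∋?_) (0ᶠ , 0ᶠ) λ { (_ , _ , (y , (_ , g) , refl) , (y′ , (_ , g′) , refl) , refl) → (y , y′) , g , g′ , refl }

        l r : K → K × K
        l w = proj₁ (proj₁ chosen w) , t
        r w = proj₂ (proj₁ chosen w) , t′

        -- The sum counts the paths of length four between the two vertices that represent w.
        lower : ∀ {w} → W ∋ w → n * n * (n * n) ≤ M₀ * ∑ vs λ v → codeg (l w) v * codeg (r w) v
        lower {w} w∈ = begin
          n * n * (n * n)  ≤⟨ *-monoˡ-≤ (n * n) (many-links (proj₁ spec) (proj₁ (proj₂ spec))) ⟩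
          4 * Λ * ∑ vs (λ v → ⟦ both v ⟧) * (n * n)  ≡⟨ trans (*-assoc (4 * Λ) _ (n * n)) (cong (4 * Λ *_) (sym (∑-*ʳ vs _ (n * n)))) ⟩
          4 * Λ * ∑ vs (λ v → ⟦ both v ⟧ * (n * n))  ≤⟨ *-monoʳ-≤ (4 * Λ) (∑-mono vs λ v → ≤-trans (⟦⟧*-mono (both v) λ { (a , b) → *-mono-≤ a b }) (⟦⟧*≤ (both v))) ⟩
          4 * Λ * ∑ vs (λ v → θ * codeg (l w) v * (θ * codeg (r w) v))  ≡⟨ cong (4 * Λ *_) (trans (∑-cong vs λ v → e θ (codeg (l w) v) (codeg (r w) v)) (∑-*ˡ vs (θ * θ) _)) ⟩
          4 * Λ * (θ * θ * ∑ vs (λ v → codeg (l w) v * codeg (r w) v))  ≡⟨ sym (*-assoc (4 * Λ) (θ * θ) _) ⟩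
          M₀ * ∑ vs (λ v → codeg (l w) v * codeg (r w) v) ∎
          where
          spec = proj₂ chosen w∈
          both : ∀ v → Dec (n ≤ θ * codeg (l w) v × n ≤ θ * codeg (r w) v)
          both v = linked (l w) v ×-dec linked (r w) v
          e : ∀ c a b → c * a * (c * b) ≡ c * c * (a * b)
          e = solve-∀

        source : List (K × (K × K) × K × K)
        source = cartesianProduct (el W) (cartesianProduct vs (cartesianProduct (el X) (el X)))

        target : List (K × (K × K) × K × K)
        target = cartesianProduct (el T) (cartesianProduct U² U²)

        P? : (τ : K × (K × K) × K × K) → let (w , v , x , x′) = τ in Dec ((Edge x (l w) × Edge x v) × (Edge x′ (r w) × Edge x′ v))
        P? (w , v , x , x′) = (edge? x (l w) ×-dec edge? x v) ×-dec (edge? x′ (r w) ×-dec edge? x′ v)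

        Q? : (τ : K × (K × K) × K × K) → let (s , (a , b) , c , d) = τ in Dec ((S t ∋ a × S s ∋ b) × (S t′ ∋ c × S s ∋ d))
        Q? (s , (a , b) , c , d) = ((S t ∋? a) ×-dec (S s ∋? b)) ×-dec ((S t′ ∋? c) ×-dec (S s ∋? d))

        f : K × (K × K) × K × K → K × (K × K) × K × K
        f (w , (z , s) , x , x′) = s , (x +ᶠ t *ᶠ proj₁ (l w) , x +ᶠ s *ᶠ z) , x′ +ᶠ t′ *ᶠ proj₁ (r w) , x′ +ᶠ s *ᶠ z

        recover : ∀ {w} s x x′ z → W ∋ w → w ≡ ((x +ᶠ t *ᶠ proj₁ (l w)) -ᶠ (x +ᶠ s *ᶠ z)) -ᶠ ((x′ +ᶠ t′ *ᶠ proj₁ (r w)) -ᶠ (x′ +ᶠ s *ᶠ z))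
        recover {w} s x x′ z w∈ = trans (proj₂ (proj₂ (proj₂ chosen w∈)))
          (solve 7 (λ t y t′ y′ x x′ q → t :* y :+ (:- t′) :* y′ := ((x :+ t :* y) :- (x :+ q)) :- ((x′ :+ t′ :* y′) :- (x′ :+ q))) refl
            t (proj₁ (l w)) t′ (proj₁ (r w)) x x′ (s *ᶠ z))

        remaining : ∀ {w z s x x′ w₁ z₁ x₁ x₁′} → T ∋ s → w ≡ w₁ →
          x +ᶠ t *ᶠ proj₁ (l w) ≡ x₁ +ᶠ t *ᶠ proj₁ (l w₁) → x +ᶠ s *ᶠ z ≡ x₁ +ᶠ s *ᶠ z₁ →
          x′ +ᶠ t′ *ᶠ proj₁ (r w) ≡ x₁′ +ᶠ t′ *ᶠ proj₁ (r w₁) → (w , (z , s) , x , x′) ≡ (w₁ , (z₁ , s) , x₁ , x₁′)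
        remaining {w} {z} {s} {x} {x′} {.w} {z₁} {x₁} {x₁′} s∈ refl e₁ e₂ e₃ =
          trans (cong (λ x → (w , (z , s) , x , x′)) x≡) (trans (cong (λ x′ → (w , (z , s) , x₁ , x′)) (+-cancelʳᶠ e₃))
            (cong (λ z → (w , (z , s) , x₁ , x₁′)) (*-cancelˡᶠ (T≢0 s∈) (+-cancelˡᶠ (trans (cong (_+ᶠ s *ᶠ z) (sym x≡)) e₂)))))
          where
          x≡ : x ≡ x₁
          x≡ = +-cancelʳᶠ e₁

        -- The four sums determine w as (a − b) − (c − d), hence its chosen representation and everything else.
        f-injective : ∀ {w z s x x′ w₁ z₁ s₁ x₁ x₁′} → W ∋ w → W ∋ w₁ → T ∋ s → s ≡ s₁ →
          x +ᶠ t *ᶠ proj₁ (l w) ≡ x₁ +ᶠ t *ᶠ proj₁ (l w₁) → x +ᶠ s *ᶠ z ≡ x₁ +ᶠ s₁ *ᶠ z₁ →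
          x′ +ᶠ t′ *ᶠ proj₁ (r w) ≡ x₁′ +ᶠ t′ *ᶠ proj₁ (r w₁) → x′ +ᶠ s *ᶠ z ≡ x₁′ +ᶠ s₁ *ᶠ z₁ →
          (w , (z , s) , x , x′) ≡ (w₁ , (z₁ , s₁) , x₁ , x₁′)
        f-injective {w} {z} {s} {x} {x′} {w₁} {z₁} {.s} {x₁} {x₁′} w∈ w₁∈ s∈ refl e₁ e₂ e₃ e₄ = remaining s∈
          (trans (recover s x x′ z w∈) (trans (cong₂ _-ᶠ_ (cong₂ _-ᶠ_ e₁ e₂) (cong₂ _-ᶠ_ e₃ e₄)) (sym (recover s x₁ x₁′ z₁ w₁∈)))) e₁ e₂ e₃

        source-count : ∑ source (λ τ → ⟦ P? τ ⟧) ≡ ∑ (el W) λ w → ∑ vs λ v → codeg (l w) v * codeg (r w) v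
        source-count = trans (∑-cartesian (el W) _ _) (∑-cong (el W) λ w → trans (∑-cartesian vs _ _) (∑-cong vs λ v →
          trans (∑-cartesian (el X) (el X) _) (trans (∑-cong (el X) λ x → ∑-cong (el X) λ x′ →
            trans (⟦×⟧ (edge? x (l w) ×-dec edge? x v) (edge? x′ (r w) ×-dec edge? x′ v))
              (cong₂ _*_ (⟦×⟧ (edge? x (l w)) (edge? x v)) (⟦×⟧ (edge? x′ (r w)) (edge? x′ v))))
            (sym (∑-product (el X) (el X) _ _)))))

        target-count : ∑ target (λ τ → ⟦ Q? τ ⟧) ≤ n * (n * n * (n * n))
        target-count = begin
          ∑ target (λ τ → ⟦ Q? τ ⟧)  ≡⟨ ∑-cartesian (el T) _ _ ⟩
          ∑ (el T) (λ s → ∑ (cartesianProduct U² U²) λ τ → ⟦ Q? (s , τ) ⟧) ≡⟨ ∑-cong (el T) (λ s → trans (∑-cartesian U² U² _) (trans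
              (∑-cong U² λ u → ∑-cong U² λ v → ⟦×⟧ ((S t ∋? proj₁ u) ×-dec (S s ∋? proj₂ u)) ((S t′ ∋? proj₁ v) ×-dec (S s ∋? proj₂ v)))
              (trans (sym (∑-product U² U² _ _)) (sym (cong₂ _*_ (#-product (S t) (S s)) (#-product (S t′) (S s))))))) ⟩
          ∑ (el T) (λ s → # (S t) * # (S s) * (# (S t′) * # (S s))) ≤⟨ ∑-mono (el T) (λ s → *-mono-≤ (*-mono-≤ (S≤n t) (S≤n s)) (*-mono-≤ (S≤n t′) (S≤n s))) ⟩
          ∑ (el T) (λ s → n * n * (n * n))  ≡⟨ ∑-const (el T) _ ⟩
          length (el T) * (n * n * (n * n))  ≤⟨ *-monoˡ-≤ (n * n * (n * n)) elT≤n ⟩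
          n * (n * n * (n * n)) ∎

        count : ∑ source (λ τ → ⟦ P? τ ⟧) ≤ ∑ target (λ τ → ⟦ Q? τ ⟧)
        count = ∑-injection P? Q? (≡-dec _≟_ (≡-dec _≟²_ _≟²_)) source target
          (cartesianProduct⁺ (el-unique W) (cartesianProduct⁺ (cartesianProduct⁺ (el-unique Y) (el-unique T)) (cartesianProduct⁺ (el-unique X) (el-unique X))))
          f
          (λ { {w , (z , s) , x , x′} τ∈ ((p , q) , (p′ , q′)) → ∈-cartesianProduct⁺ (s∈ τ∈)
                 (∈-cartesianProduct⁺ (∈-cartesianProduct⁺ (U-complete _) (U-complete _)) (∈-cartesianProduct⁺ (U-complete _) (U-complete _))) ,
               ((p , q) , (p′ , q′)) })
          (λ { {w , (z , s) , x , x′} {w₁ , (z₁ , s₁) , x₁ , x₁′} τ∈ τ₁∈ _ _ eq →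
               f-injective (w∈ τ∈) (w∈ τ₁∈) (∈-el⁻ {T} (s∈ τ∈))
                 (cong proj₁ eq) (cong (λ τ → proj₁ (proj₁ (proj₂ τ))) eq) (cong (λ τ → proj₂ (proj₁ (proj₂ τ))) eq)
                 (cong (λ τ → proj₁ (proj₂ (proj₂ τ))) eq) (cong (λ τ → proj₂ (proj₂ (proj₂ τ))) eq) })
          where
          w∈ : ∀ {w σ} → (w , σ) ∈ source → W ∋ w
          w∈ τ∈ = ∈-el⁻ {W} (proj₁ (∈-cartesianProduct⁻ (el W) _ τ∈))
          s∈ : ∀ {w z s σ} → (w , (z , s) , σ) ∈ source → s ∈ el T
          s∈ τ∈ = proj₂ (∈-cartesianProduct⁻ (el Y) (el T) (proj₁ (∈-cartesianProduct⁻ vs _ (proj₂ (∈-cartesianProduct⁻ (el W) _ τ∈)))))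

        abstract
          -- A path through (z , s) carries four sums, one in `S t`, one in `S t′` and two in `S s`.
          -- Together with s they take at most n⁵ values and determine both w and the path, while
          -- each w has at least n⁴ / M₀ paths.
          difference-small : # W ≤ M₀ * n
          difference-small = *-cancelʳ-≤ (# W) (M₀ * n) (n * n * (n * n)) {{>-nonZero (*-mono-≤ (*-mono-≤ 1≤n 1≤n) (*-mono-≤ 1≤n 1≤n))}} (begin
            # W * (n * n * (n * n))  ≡⟨ trans (cong (_* (n * n * (n * n))) (sym (length-el W))) (sym (∑-const (el W) _)) ⟩
            ∑ (el W) (λ w → n * n * (n * n))  ≤⟨ ∑-mono∈ (el W) (λ w w∈ → lower (∈-el⁻ {W} w∈)) ⟩
            ∑ (el W) (λ w → M₀ * ∑ vs λ v → codeg (l w) v * codeg (r w) v) ≡⟨ ∑-*ˡ (el W) M₀ _ ⟩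
            M₀ * ∑ (el W) (λ w → ∑ vs λ v → codeg (l w) v * codeg (r w) v) ≡⟨ cong (M₀ *_) (sym source-count) ⟩
            M₀ * ∑ source (λ τ → ⟦ P? τ ⟧)  ≤⟨ *-monoʳ-≤ M₀ (≤-trans count target-count) ⟩
            M₀ * (n * (n * n * (n * n)))  ≡⟨ sym (*-assoc M₀ n _) ⟩
            M₀ * n * (n * n * (n * n)) ∎)

      1≤M₀ : 1 ≤ M₀
      1≤M₀ = *-mono-≤ {1} {4 * Λ} (*-mono-≤ {1} {4} (m≤m+n 1 3) 1≤Λ) (*-mono-≤ 1≤θ 1≤θ)
        where
        1≤θ : 1 ≤ θ
        1≤θ = subst (1 ≤_) (sym θ≡) (*-mono-≤ {1} {32} (m≤m+n 1 31) (*-mono-≤ 1≤Λ 1≤Λ))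

      fibre-mass : n * n ≤ 4 * Λ * ∑ (el T) λ t → # (fibre t)
      fibre-mass = ≤-trans many-good (≤-reflexive (cong (4 * Λ *_) (trans (∑-cartesian (el Y) (el T) _) (trans (∑-swap (el Y) (el T) _)
        (∑-cong (el T) λ t → trans (∑-el Y _) (∑-cong U λ y → sym (⟦×⟧ (Y ∋? y) (good? (y , t)))))))))

      open Fibres F

      centre : ∃ λ t₀ → T ∋ t₀ × n ≤ 8 * Λ * # (fibre t₀) ×
        n ≤ 16 * Λ * ∑ (el T) λ t → ⟦ close? Y T fibre n Λ 1≤n Y≤n T≤n proj₁ fibre-mass t₀ t ⟧
      centre = central-fibre Y T fibre n Λ 1≤n Y≤n T≤n proj₁ fibre-mass

    sums-bound : n ≤ 512 * (Λ * Λ) * pivot-loss (doubling Λ (difference-loss Λ))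
    sums-bound = let t₀ , t₀∈ , heavy , many = centre in
      Rescaling.size-bound F T fibre n Λ M₀ 1≤n 1≤Λ 1≤M₀ T≢0 (λ t t′ → Differences.difference-small t t′) n²≤p t₀ t₀∈
        (≤-trans (#-mono {fibre t₀} {Y} proj₁) Y≤n) (close? Y T fibre n Λ 1≤n Y≤n T≤n proj₁ fibre-mass t₀) heavy many

-- Lines meeting many rows

module _ {A : Set} (_≟_ : DecidableEquality A) (xs : List A) (u : Unique xs) {P : A → Set} (P? : Decidable P) where
  private
    open ≤-Reasoning
    c = ∑ xs λ x → ⟦ P? x ⟧

    equal≤1 : ∀ y → ∑ xs (λ x → ⟦ x ≟ y ⟧) ≤ 1
    equal≤1 y = ∑-at-most-one (_≟ y) xs u λ _ _ e e′ → trans e (sym e′)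

  ∑-avoid₁ : ∀ y → c ≤ ∑ xs (λ x → ⟦ P? x ×-dec ¬? (x ≟ y) ⟧) + 1
  ∑-avoid₁ y = begin
    c  ≤⟨ ∑-mono xs (λ x → cover (P? x) (x ≟ y)) ⟩
    ∑ xs (λ x → ⟦ P? x ×-dec ¬? (x ≟ y) ⟧ + ⟦ x ≟ y ⟧)  ≡⟨ ∑-+ xs _ _ ⟩
    ∑ xs (λ x → ⟦ P? x ×-dec ¬? (x ≟ y) ⟧) + ∑ xs (λ x → ⟦ x ≟ y ⟧) ≤⟨ +-monoʳ-≤ _ (equal≤1 y) ⟩
    ∑ xs (λ x → ⟦ P? x ×-dec ¬? (x ≟ y) ⟧) + 1 ∎
    where
    cover : ∀ {P Q : Set} (p : Dec P) (q : Dec Q) → ⟦ p ⟧ ≤ ⟦ p ×-dec ¬? q ⟧ + ⟦ q ⟧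
    cover (no _) q = z≤n
    cover (yes _) (yes _) = s≤s z≤n
    cover (yes _) (no _) = s≤s z≤n

module _ {A : Set} (_≟_ : DecidableEquality A) (xs : List A) (u : Unique xs) {P : A → Set} (P? : Decidable P) where
  private
    open ≤-Reasoning
    c = ∑ xs λ x → ⟦ P? x ⟧

  Distinct : A → A → A → Set
  Distinct x y z = (P x × P y × ¬ y ≡ x) × (P z × ¬ z ≡ x) × ¬ z ≡ y

  distinct? : ∀ x y z → Dec (Distinct x y z)
  distinct? x y z = (P? x ×-dec P? y ×-dec ¬? (y ≟ x)) ×-dec (P? z ×-dec ¬? (z ≟ x)) ×-dec ¬? (z ≟ y)

  -- Once c ≥ 4, excluding one or two elements leaves at least half, so each of the two later
  -- choices costs a factor 2.
  distinct-triples : 4 ≤ c → c * c * c ≤ 4 * ∑ xs λ x → ∑ xs λ y → ∑ xs λ z → ⟦ distinct? x y z ⟧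
  distinct-triples 4≤c = begin
    c * c * c  ≡⟨ trans (*-assoc c c c) (sym (∑-*ʳ xs _ (c * c))) ⟩
    ∑ xs (λ x → ⟦ P? x ⟧ * (c * c))  ≤⟨ ∑-mono xs (λ x → *-monoʳ-≤ ⟦ P? x ⟧ (*-monoˡ-≤ c (second x))) ⟩
    ∑ xs (λ x → ⟦ P? x ⟧ * (2 * c₁ x * c))  ≡⟨ ∑-cong xs (λ x → trans (e₁ ⟦ P? x ⟧ (c₁ x) c) (cong (2 *_) (sym (∑-*ʳ xs _ _)))) ⟩
    ∑ xs (λ x → 2 * ∑ xs λ y → ⟦ P? y ×-dec ¬? (y ≟ x) ⟧ * (⟦ P? x ⟧ * c)) ≡⟨ ∑-*ˡ xs 2 _ ⟩
    2 * ∑ xs (λ x → ∑ xs λ y → ⟦ P? y ×-dec ¬? (y ≟ x) ⟧ * (⟦ P? x ⟧ * c)) ≤⟨ *-monoʳ-≤ 2 (∑-mono xs λ x → ∑-mono xs λ y → each x y) ⟩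
    2 * ∑ xs (λ x → ∑ xs λ y → 2 * ∑ xs λ z → ⟦ distinct? x y z ⟧)  ≡⟨ cong (2 *_) (trans (∑-cong xs λ x → ∑-*ˡ xs 2 _) (∑-*ˡ xs 2 _)) ⟩
    2 * (2 * S)  ≡⟨ sym (*-assoc 2 2 S) ⟩
    4 * S ∎
    where
    S = ∑ xs λ x → ∑ xs λ y → ∑ xs λ z → ⟦ distinct? x y z ⟧
    c₁ : A → ℕ
    c₁ x = ∑ xs λ y → ⟦ P? y ×-dec ¬? (y ≟ x) ⟧
    c₂ : A → A → ℕ
    c₂ x y = ∑ xs λ z → ⟦ (P? z ×-dec ¬? (z ≟ x)) ×-dec ¬? (z ≟ y) ⟧
    e₁ : ∀ p q c → p * (2 * q * c) ≡ 2 * (q * (p * c))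
    e₁ = solve-∀
    halve : ∀ {d} → c ≤ d + 2 → c ≤ 2 * d
    halve {d} h = +-cancelʳ-≤ 4 c (2 * d) (begin
      c + 4  ≤⟨ +-monoʳ-≤ c 4≤c ⟩
      c + c  ≤⟨ +-mono-≤ h h ⟩
      (d + 2) + (d + 2)  ≡⟨ e d ⟩
      2 * d + 4 ∎)
      where
      e : ∀ d → (d + 2) + (d + 2) ≡ 2 * d + 4
      e = solve-∀
    second : ∀ x → c ≤ 2 * c₁ x
    second x = halve (≤-trans (∑-avoid₁ _≟_ xs u P? x) (+-monoʳ-≤ (c₁ x) (m≤m+n 1 1)))
    third : ∀ x y → c ≤ 2 * c₂ x y
    third x y = halve (≤-trans (∑-avoid₁ _≟_ xs u P? x) (≤-trans (+-monoˡ-≤ 1 (∑-avoid₁ _≟_ xs u (λ z → P? z ×-dec ¬? (z ≟ x)) y)) (≤-reflexive (+-assoc (c₂ x y) 1 1))))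
    each : ∀ x y → ⟦ P? y ×-dec ¬? (y ≟ x) ⟧ * (⟦ P? x ⟧ * c) ≤ 2 * ∑ xs λ z → ⟦ distinct? x y z ⟧
    each x y = begin
      ⟦ P? y ×-dec ¬? (y ≟ x) ⟧ * (⟦ P? x ⟧ * c)  ≤⟨ *-monoʳ-≤ ⟦ P? y ×-dec ¬? (y ≟ x) ⟧ (*-monoʳ-≤ ⟦ P? x ⟧ (third x y)) ⟩
      ⟦ P? y ×-dec ¬? (y ≟ x) ⟧ * (⟦ P? x ⟧ * (2 * c₂ x y))  ≡⟨ e ⟦ P? y ×-dec ¬? (y ≟ x) ⟧ ⟦ P? x ⟧ (c₂ x y) ⟩
      2 * (⟦ P? x ⟧ * ⟦ P? y ×-dec ¬? (y ≟ x) ⟧ * c₂ x y)  ≡⟨ cong (λ p → 2 * (p * c₂ x y)) (sym (⟦×⟧ (P? x) (P? y ×-dec ¬? (y ≟ x)))) ⟩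
      2 * (⟦ P? x ×-dec P? y ×-dec ¬? (y ≟ x) ⟧ * c₂ x y)  ≡⟨ cong (2 *_) (trans (sym (∑-*ˡ xs ⟦ P? x ×-dec P? y ×-dec ¬? (y ≟ x) ⟧ _)) (∑-cong xs λ z →
              sym (⟦×⟧ (P? x ×-dec P? y ×-dec ¬? (y ≟ x)) ((P? z ×-dec ¬? (z ≟ x)) ×-dec ¬? (z ≟ y))))) ⟩
      2 * ∑ xs (λ z → ⟦ distinct? x y z ⟧) ∎
      where
      e : ∀ p q r → p * (q * (2 * r)) ≡ 2 * (q * p * r)
      e = solve-∀

-- From rows of points to sums x + t y

module Grid (F : PrimeField) where
  open PrimeField F
  open RingSolver isCommutativeRing using (solve; _:=_; _:+_; _:*_; :-_; _:-_; :0; :1)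
  open Sets F
  open Pivot F
  open Multipliers-of-sums F

  /-cancel : ∀ {u} x → u ≢ 0ᶠ → x *ᶠ u *ᶠ inv u ≡ x
  /-cancel {u} x u≢0 = trans (solve 3 (λ x u i → x :* u :* i := x :* (u :* i)) refl x u (inv u))
    (trans (cong (x *ᶠ_) (inverse u≢0)) (solve 1 (λ x → x :* :1 := x) refl x))

  inv≢0 : ∀ {u} → u ≢ 0ᶠ → inv u ≢ 0ᶠ
  inv≢0 {u} u≢0 e = u≢0 (trans (sym (/-cancel u u≢0)) (trans (cong (u *ᶠ u *ᶠ_) e) (solve 1 (λ x → x :* :0 := :0) refl (u *ᶠ u))))

  *-cancelʳᶠ : ∀ {t a b} → t ≢ 0ᶠ → a *ᶠ t ≡ b *ᶠ t → a ≡ b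
  *-cancelʳᶠ {t} {a} {b} t≢0 e = trans (sym (/-cancel a t≢0)) (trans (cong (_*ᶠ inv t) e) (/-cancel b t≢0))

  ev : K × K → K → K
  ev (α , β) s = α +ᶠ β *ᶠ s

  module _ (B : Subset) (A : K → Subset) (n : ℕ) (A≤n : ∀ s → # (A s) ≤ n) (B≤n : # B ≤ n) (s₀ s₁ : K) (s₁≢s₀ : s₁ ≢ s₀) where

    -- The point of abscissa σ t on the line through (s₀ , x) and (s₁ , y) has ordinate (x + t y) / (1 + t).
    σ : K → K
    σ t = (s₀ +ᶠ t *ᶠ s₁) *ᶠ inv (1ᶠ +ᶠ t)

    parameters : Subset
    parameters = record { _∋_ = λ t → t ≢ 0ᶠ × 1ᶠ +ᶠ t ≢ 0ᶠ × B ∋ σ t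
                        ; _∋?_ = λ t → ¬? (t ≟ 0ᶠ) ×-dec ¬? ((1ᶠ +ᶠ t) ≟ 0ᶠ) ×-dec (B ∋? σ t) }

    -- Scaling by 1 + t removes the denominator of the ordinate. The set is empty for t outside
    -- `parameters`, so that its size is bounded for every t.
    sums : K → Subset
    sums t = record { _∋_ = λ z → parameters ∋ t × A (σ t) ∋ (z *ᶠ inv (1ᶠ +ᶠ t))
                    ; _∋?_ = λ z → (parameters ∋? t) ×-dec (A (σ t) ∋? (z *ᶠ inv (1ᶠ +ᶠ t))) }

    sums≤n : ∀ t → # (sums t) ≤ n
    sums≤n t = go (parameters ∋? t)
      where
      go : Dec (parameters ∋ t) → # (sums t) ≤ n
      go (no h) = ≤-trans (≤-reflexive (trans (∑-cong U λ z → ⟦⟧-no (sums t ∋? z) λ { (p , _) → h p }) (∑-zero U))) z≤n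
      go (yes (_ , 1+t≢0 , _)) = ≤-trans (#-injection {sums t} {A (σ t)} (_*ᶠ inv (1ᶠ +ᶠ t)) proj₂ (λ _ _ → *-cancelʳᶠ (inv≢0 1+t≢0))) (A≤n (σ t))

    -- The cross-multiplied form of t = (s₀ - u) / (u - s₁) for u = σ t, from which σ is injective.
    σ-spec : ∀ {t} → 1ᶠ +ᶠ t ≢ 0ᶠ → t *ᶠ (σ t -ᶠ s₁) ≡ s₀ -ᶠ σ t
    σ-spec {t} h = trans (solve 3 (λ t u s → t :* (u :- s) := (u :* (:1 :+ t) :- t :* s) :- u) refl t (σ t) s₁)
      (trans (cong (λ w → w -ᶠ t *ᶠ s₁ -ᶠ σ t) (trans (solve 3 (λ a i u → a :* i :* u := a :* u :* i) refl (s₀ +ᶠ t *ᶠ s₁) (inv (1ᶠ +ᶠ t)) (1ᶠ +ᶠ t)) (/-cancel (s₀ +ᶠ t *ᶠ s₁) h)))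
      (solve 3 (λ a b u → a :+ b :- b :- u := a :- u) refl s₀ (t *ᶠ s₁) (σ t)))

    parameters≤n : # parameters ≤ n
    parameters≤n = ≤-trans (#-injection {parameters} {B} σ (λ { (_ , _ , b) → b }) λ { {t} {t′} (_ , h , _) (_ , h′ , _) e → *-cancelʳᶠ (off h)
        (trans (σ-spec h) (trans (cong (λ u → s₀ -ᶠ u) e) (trans (sym (σ-spec h′)) (cong (λ u → t′ *ᶠ (u -ᶠ s₁)) (sym e))))) }) B≤n
      where
      off : ∀ {t} → 1ᶠ +ᶠ t ≢ 0ᶠ → σ t -ᶠ s₁ ≢ 0ᶠ
      off {t} h e = s₁≢s₀ (trans (sym (sub≡0 e)) (sym (sub≡0 (trans (sym (σ-spec h)) (trans (cong (t *ᶠ_) e) (solve 1 (λ t → t :* :0 := :0) refl t))))))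

    private
      τ : K → K
      τ s = (s -ᶠ s₀) *ᶠ inv (s₁ -ᶠ s)

      module At {s : K} (s≢s₀ : s ≢ s₀) (s≢s₁ : s ≢ s₁) where
        s₁-s≢0 : s₁ -ᶠ s ≢ 0ᶠ
        s₁-s≢0 e = s≢s₁ (sym (sub≡0 e))
        τ-spec : τ s *ᶠ (s₁ -ᶠ s) ≡ s -ᶠ s₀
        τ-spec = trans (solve 3 (λ a i u → a :* i :* u := a :* u :* i) refl (s -ᶠ s₀) (inv (s₁ -ᶠ s)) (s₁ -ᶠ s)) (/-cancel (s -ᶠ s₀) s₁-s≢0)
        zero* : ∀ u → 0ᶠ *ᶠ u ≡ 0ᶠ
        zero* u = solve 1 (λ u → :0 :* u := :0) refl u
        τ≢0 : τ s ≢ 0ᶠ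
        τ≢0 e = s≢s₀ (sub≡0 (trans (sym τ-spec) (trans (cong (_*ᶠ (s₁ -ᶠ s)) e) (zero* _))))
        1+τ≢0 : 1ᶠ +ᶠ τ s ≢ 0ᶠ
        1+τ≢0 e = s₁≢s₀ (sub≡0 (trans (solve 3 (λ s s₀ s₁ → s₁ :- s₀ := (s₁ :- s) :+ (s :- s₀)) refl s s₀ s₁)
          (trans (cong (s₁ -ᶠ s +ᶠ_) (sym τ-spec)) (trans (solve 2 (λ u t → u :+ t :* u := (:1 :+ t) :* u) refl (s₁ -ᶠ s) (τ s))
          (trans (cong (_*ᶠ (s₁ -ᶠ s)) e) (zero* _))))))
        combine : ∀ α β → ev (α , β) s₀ +ᶠ τ s *ᶠ ev (α , β) s₁ ≡ ev (α , β) s *ᶠ (1ᶠ +ᶠ τ s)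
        combine α β = trans (solve 6 (λ α β s s₀ s₁ t → (α :+ β :* s₀) :+ t :* (α :+ β :* s₁) := (α :+ β :* s) :* (:1 :+ t) :+ β :* (t :* (s₁ :- s) :- (s :- s₀))) refl α β s s₀ s₁ (τ s))
          (trans (cong (λ w → ev (α , β) s *ᶠ (1ᶠ +ᶠ τ s) +ᶠ β *ᶠ (w -ᶠ (s -ᶠ s₀))) τ-spec)
          (solve 3 (λ a β w → a :+ β :* (w :- w) := a) refl (ev (α , β) s *ᶠ (1ᶠ +ᶠ τ s)) β (s -ᶠ s₀)))
        σ∘τ : σ (τ s) ≡ s
        σ∘τ = trans (cong (_*ᶠ inv (1ᶠ +ᶠ τ s)) (trans (solve 3 (λ t s₀ s₁ → s₀ :+ t :* s₁ := (:0 :+ :1 :* s₀) :+ t :* (:0 :+ :1 :* s₁)) refl (τ s) s₀ s₁)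
          (combine 0ᶠ 1ᶠ))) (trans (/-cancel (ev (0ᶠ , 1ᶠ) s) 1+τ≢0) (solve 1 (λ s → :0 :+ :1 :* s := s) refl s))

    -- A line with distinct hits over s₀, s₁ and s is an edge x + t y ∈ sums t.
    collinear≤edges : ∀ Ls → Unique Ls →
      ∑ (cartesianProduct Ls (el B)) (λ { (ℓ , s) → ⟦ ((A s₀ ∋? ev ℓ s₀) ×-dec (A s₁ ∋? ev ℓ s₁) ×-dec ¬? (s₁ ≟ s₀)) ×-dec ((A s ∋? ev ℓ s) ×-dec ¬? (s ≟ s₀)) ×-dec ¬? (s ≟ s₁) ⟧ })
      ≤ ∑ (cartesianProduct (el (A s₀)) (cartesianProduct (el (A s₁)) (el parameters))) λ { (x , y , t) → ⟦ sums t ∋? (x +ᶠ t *ᶠ y) ⟧ }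
    collinear≤edges Ls u = ∑-injection _ _ (≡-dec _≟_ _≟²_) _ _ (cartesianProduct⁺ u (el-unique B))
      (λ { (ℓ , s) → ev ℓ s₀ , ev ℓ s₁ , τ s })
      (λ { {(α , β) , s} m ((h₀ , h₁ , _) , (h , s≢s₀) , s≢s₁) →
        ∈-cartesianProduct⁺ (∈-el⁺ {A s₀} h₀) (∈-cartesianProduct⁺ (∈-el⁺ {A s₁} h₁) (∈-el⁺ {parameters} (parameter (s∈ m) s≢s₀ s≢s₁))) ,
        parameter (s∈ m) s≢s₀ s≢s₁ ,
        subst₂ (λ s z → A s ∋ z) (sym (At.σ∘τ s≢s₀ s≢s₁))
          (sym (trans (cong (_*ᶠ inv (1ᶠ +ᶠ τ s)) (At.combine s≢s₀ s≢s₁ α β)) (/-cancel (ev (α , β) s) (At.1+τ≢0 s≢s₀ s≢s₁)))) h })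
      (λ { {(α , β) , s} {(α′ , β′) , s′} _ _ (_ , (_ , p) , q) (_ , (_ , p′) , q′) e →
        cong₂ _,_ (determined (cong proj₁ e) (cong (λ w → proj₁ (proj₂ w)) e))
          (trans (sym (At.σ∘τ p q)) (trans (cong σ (cong (λ w → proj₂ (proj₂ w)) e)) (At.σ∘τ p′ q′))) })
      where
      s∈ : ∀ {ℓ s} → (ℓ , s) ∈ cartesianProduct Ls (el B) → B ∋ s
      s∈ h = ∈-el⁻ {B} (proj₂ (∈-cartesianProduct⁻ Ls (el B) h))
      parameter : ∀ {s} → B ∋ s → s ≢ s₀ → s ≢ s₁ → parameters ∋ τ s
      parameter b p q = At.τ≢0 p q , At.1+τ≢0 p q , subst (B ∋_) (sym (At.σ∘τ p q)) b
      determined : ∀ {α β α′ β′} → ev (α , β) s₀ ≡ ev (α′ , β′) s₀ → ev (α , β) s₁ ≡ ev (α′ , β′) s₁ → (α , β) ≡ (α′ , β′)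
      determined {α} {β} {α′} {β′} e₀ e₁ = cong₂ _,_ (+-cancelʳᶠ (trans e₀ (cong (λ b → α′ +ᶠ b *ᶠ s₀) (sym β≡)))) β≡
        where
        diff : ∀ α β → β *ᶠ (s₁ -ᶠ s₀) ≡ ev (α , β) s₁ -ᶠ ev (α , β) s₀
        diff α β = solve 4 (λ α β s₀ s₁ → β :* (s₁ :- s₀) := (α :+ β :* s₁) :- (α :+ β :* s₀)) refl α β s₀ s₁
        β≡ : β ≡ β′
        β≡ = *-cancelʳᶠ (λ e → s₁≢s₀ (sub≡0 e)) (trans (diff α β) (trans (cong₂ _-ᶠ_ e₁ e₀) (sym (diff α′ β′))))

  module _ (B : Subset) (A : K → Subset) (n k : ℕ) (1≤n : 1 ≤ n) (1≤k : 1 ≤ k) (8k≤n : 8 * k ≤ n)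
    (A≤n : ∀ s → # (A s) ≤ n) (B≤n : # B ≤ n) (n²≤p : n * n ≤ length U)
    (Ls : List (K × K)) (u : Unique Ls) (Ls≤ : length Ls ≤ k * (n * n))
    (hits : n * n * n ≤ ∑ Ls λ ℓ → ∑ (el B) λ s → ⟦ A s ∋? ev ℓ s ⟧) where
    private
      open ≤-Reasoning

      hit? : ∀ ℓ s → Dec (A s ∋ ev ℓ s)
      hit? ℓ s = A s ∋? ev ℓ s

      c : K × K → ℕ
      c ℓ = ∑ (el B) λ s → ⟦ hit? ℓ s ⟧

      collinear? : ∀ ℓ s₀ s₁ s → Dec (Distinct _≟_ (el B) (el-unique B) (hit? ℓ) s₀ s₁ s)
      collinear? ℓ = distinct? _≟_ (el B) (el-unique B) (hit? ℓ)

      triples : K × K → ℕ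
      triples ℓ = ∑ (el B) λ s₀ → ∑ (el B) λ s₁ → ∑ (el B) λ s → ⟦ collinear? ℓ s₀ s₁ s ⟧

      -- The threshold is n / 2k. Poorer lines, of which there are at most k n², carry at most half
      -- of the hits; a richer line has c ≥ 4 because 8k ≤ n, so its triples number at least c³ / 4.
      per-line : ∀ c t → (4 ≤ c → c * c * c ≤ 4 * t) → 2 * k * (n * n) * c ≤ 32 * (k * k * k) * t + n * n * n
      per-line c t h with ≤-total n (2 * k * c)
      ... | inj₁ rich = ≤-trans (begin
        2 * k * (n * n) * c  ≤⟨ *-monoˡ-≤ c (*-monoʳ-≤ (2 * k) (*-mono-≤ rich rich)) ⟩
        2 * k * (2 * k * c * (2 * k * c)) * c  ≡⟨ e₁ k c ⟩
        8 * (k * k * k) * (c * c * c)  ≤⟨ *-monoʳ-≤ (8 * (k * k * k)) (h 4≤c) ⟩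
        8 * (k * k * k) * (4 * t)  ≡⟨ e₂ (k * k * k) t ⟩
        32 * (k * k * k) * t ∎) (m≤m+n _ _)
        where
        e₁ : ∀ k c → 2 * k * (2 * k * c * (2 * k * c)) * c ≡ 8 * (k * k * k) * (c * c * c)
        e₁ = solve-∀
        e₂ : ∀ q t → 8 * q * (4 * t) ≡ 32 * q * t
        e₂ = solve-∀
        e₃ : ∀ k → 2 * k * 4 ≡ 8 * k
        e₃ = solve-∀
        4≤c : 4 ≤ c
        4≤c = *-cancelˡ-≤ (2 * k) {{>-nonZero (*-mono-≤ {1} {2} (s≤s z≤n) 1≤k)}} (≤-trans (≤-reflexive (e₃ k)) (≤-trans 8k≤n rich))
      ... | inj₂ poor = begin
        2 * k * (n * n) * c  ≡⟨ e₁ k n c ⟩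
        n * n * (2 * k * c)  ≤⟨ *-monoʳ-≤ (n * n) poor ⟩
        n * n * n  ≤⟨ m≤n+m _ _ ⟩
        32 * (k * k * k) * t + n * n * n ∎
        where
        e₁ : ∀ k n c → 2 * k * (n * n) * c ≡ n * n * (2 * k * c)
        e₁ = solve-∀

      -- The loss 32 k² from hits to collinear triples has the same form as the loss from edges to
      -- links, so one opaque function serves for both.
      Λ : ℕ
      Λ = link-loss k

      many-triples : n * n * (n * n * n) ≤ Λ * ∑ Ls triples
      many-triples = subst (λ l → n * n * (n * n * n) ≤ l * ∑ Ls triples) (sym (link-loss-def k))
        (*-cancelˡ-≤ k {{>-nonZero 1≤k}} (+-cancelʳ-≤ (k * (n * n) * (n * n * n)) _ _ (begin
        k * (n * n * (n * n * n)) + k * (n * n) * (n * n * n)  ≡⟨ e₁ k (n * n) (n * n * n) ⟩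
        2 * k * (n * n) * (n * n * n)  ≤⟨ *-monoʳ-≤ (2 * k * (n * n)) hits ⟩
        2 * k * (n * n) * ∑ Ls c  ≡⟨ sym (∑-*ˡ Ls (2 * k * (n * n)) c) ⟩
        ∑ Ls (λ ℓ → 2 * k * (n * n) * c ℓ)  ≤⟨ ∑-mono Ls (λ ℓ → per-line (c ℓ) (triples ℓ) (distinct-triples _≟_ (el B) (el-unique B) (hit? ℓ))) ⟩
        ∑ Ls (λ ℓ → 32 * (k * k * k) * triples ℓ + n * n * n)  ≡⟨ trans (∑-+ Ls _ _) (cong₂ _+_ (∑-*ˡ Ls (32 * (k * k * k)) triples) (∑-const Ls (n * n * n))) ⟩
        32 * (k * k * k) * ∑ Ls triples + length Ls * (n * n * n)  ≤⟨ +-mono-≤ (≤-reflexive (e₂ k (∑ Ls triples))) (*-monoˡ-≤ (n * n * n) Ls≤) ⟩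
        k * (32 * (k * k) * ∑ Ls triples) + k * (n * n) * (n * n * n) ∎)))
        where
        e₁ : ∀ k q r → k * (q * r) + k * q * r ≡ 2 * k * q * r
        e₁ = solve-∀
        e₂ : ∀ k s → 32 * (k * k * k) * s ≡ k * (32 * (k * k) * s)
        e₂ = solve-∀

      lines : K → K → ℕ
      lines s₀ s₁ = ∑ (cartesianProduct Ls (el B)) λ { (ℓ , s) → ⟦ collinear? ℓ s₀ s₁ s ⟧ }

      triples-by-rows : ∑ Ls triples ≡ ∑ (cartesianProduct (el B) (el B)) λ { (s₀ , s₁) → lines s₀ s₁ }
      triples-by-rows = trans (∑-swap Ls (el B) _) (trans (∑-cong (el B) λ s₀ → trans (∑-swap Ls (el B) _)
        (∑-cong (el B) λ s₁ → sym (∑-cartesian Ls (el B) _))) (sym (∑-cartesian (el B) (el B) _)))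

      rows : List (K × K)
      rows = cartesianProduct (el B) (el B)

      rows≤n² : ∀ m → ∑ rows (λ _ → m) ≤ n * n * m
      rows≤n² m = begin
        ∑ rows (λ _ → m)  ≡⟨ trans (∑-cartesian (el B) (el B) _) (trans (∑-cong (el B) λ _ → ∑-const (el B) m) (∑-const (el B) _)) ⟩
        length (el B) * (length (el B) * m)  ≤⟨ *-mono-≤ elB≤n (*-monoˡ-≤ m elB≤n) ⟩
        n * (n * m)  ≡⟨ sym (*-assoc n n m) ⟩
        n * n * m ∎
        where
        elB≤n : length (el B) ≤ n
        elB≤n = ≤-trans (≤-reflexive (length-el B)) B≤n

      1≤n³ : 1 ≤ n * n * n
      1≤n³ = *-mono-≤ (*-mono-≤ 1≤n 1≤n) 1≤n

      two-rows : ∃ λ (r : K × K) → r ∈ rows × n * n * n ≤ Λ * lines (proj₁ r) (proj₂ r)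
      two-rows = ∑-exists≤ rows (nonempty rows (λ r → lines (proj₁ r) (proj₂ r)) (positive {c = Λ} (*-mono-≤ (*-mono-≤ 1≤n 1≤n) 1≤n³)
          (≤-trans many-triples (≤-reflexive (cong (Λ *_) triples-by-rows))))) (begin
        ∑ rows (λ _ → n * n * n)  ≤⟨ rows≤n² (n * n * n) ⟩
        n * n * (n * n * n)  ≤⟨ many-triples ⟩
        Λ * ∑ Ls triples  ≡⟨ trans (cong (Λ *_) triples-by-rows) (sym (∑-*ˡ rows Λ _)) ⟩
        ∑ rows (λ r → Λ * lines (proj₁ r) (proj₂ r)) ∎)

      same-row : ∀ s → lines s s ≡ 0
      same-row s = trans (∑-cong (cartesianProduct Ls (el B)) λ { (ℓ , s′) → ⟦⟧-no (collinear? ℓ s s s′) λ { ((_ , _ , ne) , _) → ne refl } })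
        (∑-zero (cartesianProduct Ls (el B)))

      1≤Λ : 1 ≤ Λ
      1≤Λ = subst (1 ≤_) (sym (link-loss-def k)) (*-mono-≤ {1} {32} (m≤m+n 1 31) (*-mono-≤ 1≤k 1≤k))

    grid-bound : n ≤ 512 * (link-loss k * link-loss k) * pivot-loss (doubling (link-loss k) (difference-loss (link-loss k)))
    grid-bound = from two-rows
      where
      from : (∃ λ (r : K × K) → r ∈ rows × n * n * n ≤ Λ * lines (proj₁ r) (proj₂ r)) → n ≤ 512 * (Λ * Λ) * pivot-loss (doubling Λ (difference-loss Λ))
      from ((s₀ , s₁) , _ , many) = Sums.sums-bound (A s₀) (A s₁) (parameters B A n A≤n B≤n s₀ s₁ s₁≢s₀) (sums B A n A≤n B≤n s₀ s₁ s₁≢s₀)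
        n Λ 1≤n 1≤Λ proj₁ (A≤n s₀) (A≤n s₁) (parameters≤n B A n A≤n B≤n s₀ s₁ s₁≢s₀) (sums≤n B A n A≤n B≤n s₀ s₁ s₁≢s₀) n²≤p
        (≤-trans many (*-monoʳ-≤ Λ (≤-trans (collinear≤edges B A n A≤n B≤n s₀ s₁ s₁≢s₀ Ls u) (≤-reflexive (∑-cartesian (el (A s₀)) _ _)))))
        where
        s₁≢s₀ : s₁ ≢ s₀
        -- Equal rows carry no triple, whereas the chosen pair carries at least n³ / Λ.
        s₁≢s₀ refl = <⇒≱ 1≤n³ (≤-trans many (≤-reflexive (trans (cong (Λ *_) (same-row s₀)) (*-zeroʳ Λ))))

-- Reduction of point-line incidences to rows

∑-take≤ : ∀ {A : Set} n (xs : List A) f → ∑ (take n xs) f ≤ ∑ xs f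
∑-take≤ zero xs f = z≤n
∑-take≤ (suc n) [] f = z≤n
∑-take≤ (suc n) (x ∷ xs) f = +-monoʳ-≤ (f x) (∑-take≤ n xs f)

∈-take : ∀ {A : Set} n {xs : List A} {x} → x ∈ take n xs → x ∈ xs
∈-take (suc n) {_ ∷ _} (here e) = here e
∈-take (suc n) {_ ∷ _} (there h) = there (∈-take n h)

distinct-injective : ∀ {A : Set} {R : A → A → Set} → (∀ {x y} → R x y → R y x) → ∀ {xs} → AllPairs (λ x y → ¬ R x y) xs →
  ∀ {x y} → x ∈ xs → y ∈ xs → R x y → x ≡ y
distinct-injective sym′ (_ ∷ _) (here refl) (here refl) r = refl
distinct-injective sym′ (h ∷ _) (here refl) (there y∈) r = ⊥-elim (All.lookup h y∈ r)
distinct-injective sym′ (h ∷ _) (there x∈) (here refl) r = ⊥-elim (All.lookup h x∈ (sym′ r))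
distinct-injective sym′ (_ ∷ hs) (there x∈) (there y∈) r = distinct-injective sym′ hs x∈ y∈ r

AllPairs-map∈ : ∀ {A : Set} {R S : A → A → Set} {xs} → (∀ {x y} → x ∈ xs → y ∈ xs → R x y → S x y) → AllPairs R xs → AllPairs S xs
AllPairs-map∈ f [] = []
AllPairs-map∈ f (h ∷ hs) = All.tabulate (λ y∈ → f (here refl) (there y∈) (All.lookup h y∈)) ∷ AllPairs-map∈ (λ x∈ y∈ → f (there x∈) (there y∈)) hs

module _ {A B : Set} {Inc : A → B → Set} (inc? : ∀ a b → Dec (Inc a b)) (D : ℕ) where

  incidences : List A → List B → ℕ
  incidences P L = ∑ P λ a → ∑ L λ b → ⟦ inc? a b ⟧

  private
    -- Each discarded element takes away fewer than D incidences, so the surplus over D per point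
    -- and line survives.
    trim : ∀ {A : Set} (P : List A) (f : A → ℕ) l → D * (length P + l) < ∑ P f →
      D * (length (filter (λ a → D ≤? f a) P) + l) < ∑ (filter (λ a → D ≤? f a) P) f
    trim P f l h = +-cancelˡ-< (D * length P) _ _ (begin-strict
      D * length P + D * (length P′ + l)  ≡⟨ e₁ D (length P) (length P′) l ⟩
      D * (length P + l) + D * length P′  <⟨ +-monoˡ-< (D * length P′) h ⟩
      ∑ P f + D * length P′  ≡⟨ trans (cong (λ x → ∑ P f + D * x) (length-filter good? P)) (trans (cong (∑ P f +_) (sym (∑-*ˡ P D _))) (sym (∑-+ P f _))) ⟩
      ∑ P (λ a → f a + D * ⟦ good? a ⟧)  ≤⟨ ∑-mono P (λ a → each a (good? a)) ⟩
      ∑ P (λ a → D + ⟦ good? a ⟧ * f a)  ≡⟨ trans (∑-+ P _ _) (cong₂ _+_ (trans (∑-const P D) (*-comm (length P) D)) (sym (∑-filter good? P f))) ⟩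
      D * length P + ∑ P′ f ∎)
      where
      open ≤-Reasoning
      good? : ∀ a → Dec (D ≤ f a)
      good? a = D ≤? f a
      P′ = filter good? P
      e₁ : ∀ d p q l → d * p + d * (q + l) ≡ d * (p + l) + d * q
      e₁ = solve-∀
      each : ∀ a (d : Dec (D ≤ f a)) → f a + D * ⟦ d ⟧ ≤ D + ⟦ d ⟧ * f a
      each a (yes _) = ≤-reflexive (trans (cong (f a +_) (*-identityʳ D)) (trans (+-comm (f a) D) (cong (D +_) (sym (+-identityʳ (f a))))))
      each a (no h) = ≤-trans (≤-reflexive (trans (cong (f a +_) (*-zeroʳ D)) (+-identityʳ (f a)))) (≤-trans (<⇒≤ (≰⇒> h)) (m≤m+n D 0))

  module _ (R : A → A → Set) (S : B → B → Set) where

    record Pruned (P : List A) (L : List B) : Set where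
      field
        P′ : List A
        L′ : List B
        P′≤ : length P′ ≤ length P
        L′≤ : length L′ ≤ length L
        P′-pairs : AllPairs R P′
        L′-pairs : AllPairs S L′
        remains : 1 ≤ incidences P′ L′
        rich-points : ∀ {a} → a ∈ P′ → D ≤ ∑ L′ λ b → ⟦ inc? a b ⟧
        rich-lines : ∀ {b} → b ∈ L′ → D ≤ ∑ P′ λ a → ⟦ inc? a b ⟧

    -- The surplus is the invariant and also shows that something remains. The fuel is the number of
    -- points and lines, which every round lowers.
    prune : ∀ P L → AllPairs R P → AllPairs S L → D * (length P + length L) < incidences P L → Pruned P L
    prune P L RP SL h = go (length P + length L) P L ≤-refl RP SL h
      where
      go : ∀ fuel P L → length P + length L ≤ fuel → AllPairs R P → AllPairs S L → D * (length P + length L) < incidences P L → Pruned P L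
      go fuel P L enough RP SL h with All.all? (λ a → D ≤? ∑ L λ b → ⟦ inc? a b ⟧) P | All.all? (λ b → D ≤? ∑ P λ a → ⟦ inc? a b ⟧) L
      ... | yes richP | yes richL = record
        { P′ = P ; L′ = L ; P′≤ = ≤-refl ; L′≤ = ≤-refl ; P′-pairs = RP ; L′-pairs = SL
        ; remains = ≤-trans (s≤s z≤n) h ; rich-points = All.lookup richP ; rich-lines = All.lookup richL }
      go zero P L enough RP SL h | no poor | _ = ⊥-elim (<⇒≱ (≤-<-trans z≤n (filter-notAll (λ a → D ≤? ∑ L λ b → ⟦ inc? a b ⟧) P (¬All⇒Any¬ (λ a → D ≤? ∑ L λ b → ⟦ inc? a b ⟧) P poor))) (≤-trans (m≤m+n _ _) enough))
      go (suc fuel) P L enough RP SL h | no poor | _ =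
        let shorter = filter-notAll _ P (¬All⇒Any¬ (λ a → D ≤? ∑ L λ b → ⟦ inc? a b ⟧) P poor)
            open Pruned (go fuel (filter (λ a → D ≤? ∑ L λ b → ⟦ inc? a b ⟧) P) L (≤-pred (≤-trans (+-monoˡ-< (length L) shorter) enough))
                   (AllPairsₚ.filter⁺ _ RP) SL (trim P (λ a → ∑ L λ b → ⟦ inc? a b ⟧) (length L) h))
        in record { P′ = P′ ; L′ = L′ ; P′≤ = ≤-trans P′≤ (<⇒≤ shorter) ; L′≤ = L′≤ ; P′-pairs = P′-pairs ; L′-pairs = L′-pairs
                  ; remains = remains ; rich-points = rich-points ; rich-lines = rich-lines }
      go zero P L enough RP SL h | yes _ | no poor = ⊥-elim (<⇒≱ (≤-<-trans z≤n (filter-notAll (λ b → D ≤? ∑ P λ a → ⟦ inc? a b ⟧) L (¬All⇒Any¬ (λ b → D ≤? ∑ P λ a → ⟦ inc? a b ⟧) L poor))) (≤-trans (m≤n+m _ (length P)) enough))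
      go (suc fuel) P L enough RP SL h | yes _ | no poor =
        let shorter = filter-notAll _ L (¬All⇒Any¬ (λ b → D ≤? ∑ P λ a → ⟦ inc? a b ⟧) L poor)
            L₁ = filter (λ b → D ≤? ∑ P λ a → ⟦ inc? a b ⟧) L
            open Pruned (go fuel P L₁ (≤-pred (≤-trans (+-monoʳ-< (length P) shorter) enough)) RP (AllPairsₚ.filter⁺ _ SL)
                   (subst₂ (λ x y → D * x < y) (+-comm (length L₁) (length P)) (∑-swap L₁ P _)
                     (trim L (λ b → ∑ P λ a → ⟦ inc? a b ⟧) (length P) (subst₂ (λ x y → D * x < y) (+-comm (length P) (length L)) (∑-swap P L _) h))))
        in record { P′ = P′ ; L′ = L′ ; P′≤ = P′≤ ; L′≤ = ≤-trans L′≤ (<⇒≤ shorter) ; P′-pairs = P′-pairs ; L′-pairs = L′-pairs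
                  ; remains = remains ; rich-points = rich-points ; rich-lines = rich-lines }

-- Lines in the plane and projection from a point

module Geometry (F : PrimeField) (X : Set) (a b c : X → PrimeField.K F)
  (nondegenerate : ∀ ℓ → ¬ (a ℓ ≡ PrimeField.0ᶠ F × b ℓ ≡ PrimeField.0ᶠ F)) where
  open PrimeField F
  open RingSolver isCommutativeRing using (solve; _:=_; _:+_; _:*_; :-_; _:-_; :0; :1)
  open Sets F
  open Pivot F
  open Multipliers-of-sums F
  open Grid F

  Incident : K × K → X → Set
  Incident (x , y) ℓ = a ℓ *ᶠ x +ᶠ b ℓ *ᶠ y ≡ c ℓ

  incident? : ∀ q ℓ → Dec (Incident q ℓ)
  incident? (x , y) ℓ = (a ℓ *ᶠ x +ᶠ b ℓ *ᶠ y) ≟ c ℓ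

  Same : X → X → Set
  Same ℓ ℓ′ = ∀ q → (Incident q ℓ → Incident q ℓ′) × (Incident q ℓ′ → Incident q ℓ)

  same-sym : ∀ {ℓ ℓ′} → Same ℓ ℓ′ → Same ℓ′ ℓ
  same-sym s q = swap (s q)

  factor≡0 : ∀ {x y} → x ≢ 0ᶠ → x *ᶠ y ≡ 0ᶠ → y ≡ 0ᶠ
  factor≡0 {x} x≢0 e = *-cancelˡᶠ x≢0 (trans e (solve 1 (λ x → :0 := x :* :0) refl x))

  one≢0 : ∀ {x} → x ≢ 0ᶠ → 1ᶠ ≢ 0ᶠ
  one≢0 {x} x≢0 e = x≢0 (trans (solve 1 (λ x → x := x :* :1) refl x) (trans (cong (x *ᶠ_) e) (solve 1 (λ x → x :* :0 := :0) refl x)))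

  cancelling : ∀ {u v u′ v′} p p′ → u ≡ v → u′ ≡ v′ → p *ᶠ (u -ᶠ v) -ᶠ p′ *ᶠ (u′ -ᶠ v′) ≡ 0ᶠ
  cancelling {u} {_} {u′} p p′ refl refl = solve 4 (λ u u′ p p′ → p :* (u :- u) :- p′ :* (u′ :- u′) := :0) refl u u′ p p′

  module _ {ℓ ℓ′ : X} {x y x′ y′ : K} (o₁ : Incident (x , y) ℓ) (o₂ : Incident (x′ , y′) ℓ)
    (o₁′ : Incident (x , y) ℓ′) (o₂′ : Incident (x′ , y′) ℓ′) (distinct : (x , y) ≢ (x′ , y′)) where
    private
      det : K
      det = a ℓ *ᶠ b ℓ′ -ᶠ a ℓ′ *ᶠ b ℓ

      e = trans o₁ (sym o₂)
      e′ = trans o₁′ (sym o₂′)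

      det-x : det *ᶠ (x -ᶠ x′) ≡ 0ᶠ
      det-x = trans (solve 8 (λ a b a′ b′ x y x′ y′ → (a :* b′ :- a′ :* b) :* (x :- x′) :=
          b′ :* ((a :* x :+ b :* y) :- (a :* x′ :+ b :* y′)) :- b :* ((a′ :* x :+ b′ :* y) :- (a′ :* x′ :+ b′ :* y′))) refl (a ℓ) (b ℓ) (a ℓ′) (b ℓ′) x y x′ y′)
        (cancelling (b ℓ′) (b ℓ) e e′)

      det-y : det *ᶠ (y -ᶠ y′) ≡ 0ᶠ
      det-y = trans (solve 8 (λ a b a′ b′ x y x′ y′ → (a :* b′ :- a′ :* b) :* (y :- y′) :=
          a :* ((a′ :* x :+ b′ :* y) :- (a′ :* x′ :+ b′ :* y′)) :- a′ :* ((a :* x :+ b :* y) :- (a :* x′ :+ b :* y′))) refl (a ℓ) (b ℓ) (a ℓ′) (b ℓ′) x y x′ y′)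
        (cancelling (a ℓ) (a ℓ′) e′ e)

      det≡0 : det ≡ 0ᶠ
      det≡0 with x ≟ x′ | y ≟ y′
      ... | no x≢x′ | _ = factor≡0 (λ z → x≢x′ (sub≡0 z)) (trans (solve 2 (λ u v → u :* v := v :* u) refl (x -ᶠ x′) det) det-x)
      ... | yes _ | no y≢y′ = factor≡0 (λ z → y≢y′ (sub≡0 z)) (trans (solve 2 (λ u v → u :* v := v :* u) refl (y -ᶠ y′) det) det-y)
      ... | yes p | yes q = ⊥-elim (distinct (cong₂ _,_ p q))

    -- Two distinct common points make the determinant of the normals vanish, so the equations are
    -- proportional. The difference `G` is shown to vanish after multiplication by `a ℓ` and by
    -- `b ℓ`, one of which is not zero.
    two-points : ∀ r → Incident r ℓ → Incident r ℓ′
    two-points (z , w) o = trans (sub≡0 (go (a ℓ ≟ 0ᶠ) (b ℓ ≟ 0ᶠ))) o₁′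
      where
      G = (a ℓ′ *ᶠ z +ᶠ b ℓ′ *ᶠ w) -ᶠ (a ℓ′ *ᶠ x +ᶠ b ℓ′ *ᶠ y)
      a*G : a ℓ *ᶠ G ≡ 0ᶠ
      a*G = trans (solve 8 (λ a b a′ b′ x y z w → a :* ((a′ :* z :+ b′ :* w) :- (a′ :* x :+ b′ :* y)) :=
          a′ :* ((a :* z :+ b :* w) :- (a :* x :+ b :* y)) :- (y :- w) :* ((a :* b′ :- a′ :* b) :- :0)) refl (a ℓ) (b ℓ) (a ℓ′) (b ℓ′) x y z w)
        (cancelling (a ℓ′) (y -ᶠ w) (trans o (sym o₁)) det≡0)
      b*G : b ℓ *ᶠ G ≡ 0ᶠ
      b*G = trans (solve 8 (λ a b a′ b′ x y z w → b :* ((a′ :* z :+ b′ :* w) :- (a′ :* x :+ b′ :* y)) :=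
          b′ :* ((a :* z :+ b :* w) :- (a :* x :+ b :* y)) :- (z :- x) :* ((a :* b′ :- a′ :* b) :- :0)) refl (a ℓ) (b ℓ) (a ℓ′) (b ℓ′) x y z w)
        (cancelling (b ℓ′) (z -ᶠ x) (trans o (sym o₁)) det≡0)
      go : Dec (a ℓ ≡ 0ᶠ) → Dec (b ℓ ≡ 0ᶠ) → G ≡ 0ᶠ
      go (no h) _ = factor≡0 h a*G
      go (yes _) (no h) = factor≡0 h b*G
      go (yes p) (yes q) = ⊥-elim (nondegenerate ℓ (p , q))

  same-line : ∀ {ℓ ℓ′ q q′} → Incident q ℓ → Incident q′ ℓ → Incident q ℓ′ → Incident q′ ℓ′ → q ≢ q′ → Same ℓ ℓ′
  same-line o₁ o₂ o₁′ o₂′ d r = two-points o₁ o₂ o₁′ o₂′ d r , two-points o₁′ o₂′ o₁ o₂ d r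

  -- Projective coordinates with q at infinity: the row of slope s through q is the vertical line of abscissa s,
  -- and the point (x , y) on it has ordinate 1 / (x − q₁).
  module Centre (q₁ q₂ : K) where
    q : K × K
    q = q₁ , q₂

    offset : X → K
    offset ℓ = c ℓ -ᶠ (a ℓ *ᶠ q₁ +ᶠ b ℓ *ᶠ q₂)

    slope : X → K
    slope ℓ = -ᶠ a ℓ *ᶠ inv (b ℓ)

    ordinate : K × K → K
    ordinate (x , _) = inv (x -ᶠ q₁)

    coordinates : X → K × K
    coordinates ℓ = a ℓ *ᶠ inv (offset ℓ) , b ℓ *ᶠ inv (offset ℓ)

    offset≢0 : ∀ {ℓ} → ¬ Incident q ℓ → offset ℓ ≢ 0ᶠ
    offset≢0 no-q e = no-q (sym (sub≡0 e))

    b*slope : ∀ {r} → b r ≢ 0ᶠ → b r *ᶠ slope r ≡ -ᶠ a r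
    b*slope {r} b≢0 = trans (solve 3 (λ a b i → b :* ((:- a) :* i) := (:- a) :* (b :* i)) refl (a r) (b r) (inv (b r)))
      (trans (cong (-ᶠ a r *ᶠ_) (inverse b≢0)) (solve 1 (λ a → (:- a) :* :1 := :- a) refl (a r)))

    relative : ∀ {x y ℓ} → Incident (x , y) ℓ → a ℓ *ᶠ (x -ᶠ q₁) +ᶠ b ℓ *ᶠ (y -ᶠ q₂) ≡ offset ℓ
    relative {x} {y} {ℓ} o = trans (solve 6 (λ a b x y q₁ q₂ → a :* (x :- q₁) :+ b :* (y :- q₂) := (a :* x :+ b :* y) :- (a :* q₁ :+ b :* q₂)) refl (a ℓ) (b ℓ) x y q₁ q₂)
      (cong (_-ᶠ (a ℓ *ᶠ q₁ +ᶠ b ℓ *ᶠ q₂)) o)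

    absolute : ∀ {x y ℓ} → a ℓ *ᶠ (x -ᶠ q₁) +ᶠ b ℓ *ᶠ (y -ᶠ q₂) ≡ offset ℓ → Incident (x , y) ℓ
    absolute {x} {y} {ℓ} e = trans (solve 6 (λ a b x y q₁ q₂ → a :* x :+ b :* y := (a :* (x :- q₁) :+ b :* (y :- q₂)) :+ (a :* q₁ :+ b :* q₂)) refl (a ℓ) (b ℓ) x y q₁ q₂)
      (trans (cong (_+ᶠ (a ℓ *ᶠ q₁ +ᶠ b ℓ *ᶠ q₂)) e) (solve 2 (λ c w → c :- w :+ w := c) refl (c ℓ) (a ℓ *ᶠ q₁ +ᶠ b ℓ *ᶠ q₂)))

    module _ {x y : K} {r : X} (o : Incident (x , y) r) (oq : Incident q r) (b≢0 : b r ≢ 0ᶠ) where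
      on-row : y -ᶠ q₂ ≡ slope r *ᶠ (x -ᶠ q₁)
      on-row = *-cancelˡᶠ b≢0 (trans (solve 4 (λ a b u v → b :* v := (a :* u :+ b :* v) :- a :* u) refl (a r) (b r) (x -ᶠ q₁) (y -ᶠ q₂))
        (trans (cong (_-ᶠ a r *ᶠ (x -ᶠ q₁)) (trans (relative o) (trans (cong (λ w → c r -ᶠ w) oq) (solve 1 (λ c → c :- c := :0) refl (c r)))))
        (trans (solve 2 (λ a u → :0 :- a :* u := (:- a) :* u) refl (a r) (x -ᶠ q₁))
        (trans (cong (_*ᶠ (x -ᶠ q₁)) (sym (b*slope b≢0))) (solve 3 (λ b s u → b :* s :* u := b :* (s :* u)) refl (b r) (slope r) (x -ᶠ q₁))))))

      x≢q₁ : (x , y) ≢ q → x -ᶠ q₁ ≢ 0ᶠ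
      x≢q₁ i≢q e = i≢q (cong₂ _,_ (sub≡0 e) (sub≡0 (trans on-row (trans (cong (slope r *ᶠ_) e) (solve 1 (λ s → s :* :0 := :0) refl (slope r))))))

      -- With q as origin, the line a u + b v = offset restricted to the row v = s u becomes 1 / u =
      -- (a + b s) / offset, which is affine in the slope s.
      hit : ∀ {ℓ} → (x , y) ≢ q → Incident (x , y) ℓ → ¬ Incident q ℓ → ev (coordinates ℓ) (slope r) ≡ ordinate (x , y)
      hit {ℓ} i≢q oℓ no-q = trans (sym (/-cancel (ev (coordinates ℓ) (slope r)) (x≢q₁ i≢q)))
        (trans (cong (_*ᶠ inv (x -ᶠ q₁)) unit) (solve 1 (λ i → :1 :* i := i) refl (inv (x -ᶠ q₁))))
        where
        unit : ev (coordinates ℓ) (slope r) *ᶠ (x -ᶠ q₁) ≡ 1ᶠ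
        unit = trans (solve 5 (λ a b i s u → (a :* i :+ b :* i :* s) :* u := (a :* u :+ b :* (s :* u)) :* i) refl (a ℓ) (b ℓ) (inv (offset ℓ)) (slope r) (x -ᶠ q₁))
          (trans (cong (λ v → (a ℓ *ᶠ (x -ᶠ q₁) +ᶠ b ℓ *ᶠ v) *ᶠ inv (offset ℓ)) (sym on-row))
          (trans (cong (_*ᶠ inv (offset ℓ)) (relative oℓ)) (inverse (offset≢0 no-q))))

    -- Such a row also contains q + (1 , slope), and two points determine the line.
    slope-injective : ∀ {r r′} → Incident q r → Incident q r′ → b r ≢ 0ᶠ → b r′ ≢ 0ᶠ → slope r ≡ slope r′ → Same r r′
    slope-injective {r} {r′} o o′ b≢0 b′≢0 e = same-line o (next o b≢0 refl) o′ (next o′ b′≢0 (sym e))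
      λ eq → one≢0 b≢0 (+-cancelˡᶠ (trans (sym (cong proj₁ eq)) (solve 1 (λ x → x := x :+ :0) refl q₁)))
      where
      next : ∀ {r′} → Incident q r′ → b r′ ≢ 0ᶠ → slope r′ ≡ slope r → Incident (q₁ +ᶠ 1ᶠ , q₂ +ᶠ slope r) r′
      next {r′} o b≢0 e = trans (solve 5 (λ a b x y s → a :* (x :+ :1) :+ b :* (y :+ s) := (a :* x :+ b :* y) :+ (a :+ b :* s)) refl (a r′) (b r′) q₁ q₂ (slope r))
        (trans (cong₂ (λ w s → w +ᶠ (a r′ +ᶠ b r′ *ᶠ s)) o (sym e)) (trans (cong (λ w → c r′ +ᶠ (a r′ +ᶠ w)) (b*slope b≢0))
        (solve 2 (λ c a → c :+ (a :- a) := c) refl (c r′) (a r′))))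

    vertical : ∀ {r r′} → Incident q r → Incident q r′ → b r ≡ 0ᶠ → b r′ ≡ 0ᶠ → Same r r′
    vertical {r} {r′} o o′ b≡0 b′≡0 = same-line o (above o b≡0) o′ (above o′ b′≡0)
      λ eq → one≢0 (λ a≡0 → nondegenerate r (a≡0 , b≡0)) (+-cancelˡᶠ (trans (sym (cong proj₂ eq)) (solve 1 (λ x → x := x :+ :0) refl q₂)))
      where
      above : ∀ {r} → Incident q r → b r ≡ 0ᶠ → Incident (q₁ , q₂ +ᶠ 1ᶠ) r
      above {r} o b≡0 = trans (solve 4 (λ a b x y → a :* x :+ b :* (y :+ :1) := (a :* x :+ b :* y) :+ b) refl (a r) (b r) q₁ q₂)
        (trans (cong₂ _+ᶠ_ o b≡0) (solve 1 (λ c → c :+ :0 := c) refl (c r)))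

    -- After translating q to the origin, the coordinates are the coefficients of the equation
    -- normalised to right-hand side 1.
    coordinates-injective : ∀ {ℓ ℓ′} → ¬ Incident q ℓ → ¬ Incident q ℓ′ → coordinates ℓ ≡ coordinates ℓ′ → Same ℓ ℓ′
    coordinates-injective {ℓ} {ℓ′} no-q no-q′ e r = transfer no-q no-q′ e , transfer no-q′ no-q (sym e)
      where
      transfer : ∀ {ℓ ℓ′ x y} → ¬ Incident q ℓ → ¬ Incident q ℓ′ → coordinates ℓ ≡ coordinates ℓ′ → Incident (x , y) ℓ → Incident (x , y) ℓ′
      transfer {ℓ} {ℓ′} {x} {y} no-q no-q′ e o = absolute (*-cancelʳᶠ (inv≢0 (offset≢0 no-q′))
        (trans (pull ℓ′) (trans (cong (λ w → proj₁ w *ᶠ (x -ᶠ q₁) +ᶠ proj₂ w *ᶠ (y -ᶠ q₂)) (sym e))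
          (trans (sym (pull ℓ)) (trans (cong (_*ᶠ inv (offset ℓ)) (relative o)) (trans (inverse (offset≢0 no-q)) (sym (inverse (offset≢0 no-q′)))))))))
        where
        pull : ∀ ℓ → (a ℓ *ᶠ (x -ᶠ q₁) +ᶠ b ℓ *ᶠ (y -ᶠ q₂)) *ᶠ inv (offset ℓ) ≡ proj₁ (coordinates ℓ) *ᶠ (x -ᶠ q₁) +ᶠ proj₂ (coordinates ℓ) *ᶠ (y -ᶠ q₂)
        pull ℓ = solve 5 (λ a b i u v → (a :* u :+ b :* v) :* i := a :* i :* u :+ b :* i :* v) refl (a ℓ) (b ℓ) (inv (offset ℓ)) (x -ᶠ q₁) (y -ᶠ q₂)

    image : {I : Set} → (I → K) → List I → Subset
    image f xs = record { _∋_ = λ z → Any (λ i → z ≡ f i) xs ; _∋?_ = λ z → Any.any? (λ i → z ≟ f i) xs }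

    #-image : {I : Set} (f : I → K) (xs : List I) → # (image f xs) ≤ length xs
    #-image f [] = ≤-reflexive (∑-zero U)
    #-image f (x ∷ xs) = begin
      # (image f (x ∷ xs))  ≤⟨ ∑-mono U (λ z → cover (image f (x ∷ xs) ∋? z) (z ≟ f x) (image f xs ∋? z)) ⟩
      ∑ U (λ z → ⟦ z ≟ f x ⟧ + ⟦ image f xs ∋? z ⟧)  ≡⟨ ∑-+ U _ _ ⟩
      ∑ U (λ z → ⟦ z ≟ f x ⟧) + # (image f xs)  ≤⟨ +-mono-≤ (∑-at-most-one (_≟ f x) U U-unique λ _ _ e e′ → trans e (sym e′)) (#-image f xs) ⟩
      suc (length xs) ∎
      where
      open ≤-Reasoning
      cover : ∀ {z} (p : Dec (Any (λ i → z ≡ f i) (x ∷ xs))) (q : Dec (z ≡ f x)) (r : Dec (Any (λ i → z ≡ f i) xs)) → ⟦ p ⟧ ≤ ⟦ q ⟧ + ⟦ r ⟧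
      cover (no _) q r = z≤n
      cover (yes _) (yes _) r = s≤s z≤n
      cover (yes _) (no _) (yes _) = s≤s z≤n
      cover (yes (here h)) (no nh) (no _) = ⊥-elim (nh h)
      cover (yes (there h)) (no _) (no nh) = ⊥-elim (nh h)

    private
      -- The source of `suc n` in the hypotheses: each selection discards at most one item, namely
      -- the vertical row, the point q on a row, or the line joining a point to q.
      leftover : ∀ {I : Set} {P Q : I → Set} (P? : Decidable P) (Q? : Decidable Q) xs n → suc n ≤ ∑ xs (λ i → ⟦ P? i ⟧) →
        ∑ xs (λ i → ⟦ P? i ×-dec Q? i ⟧) ≤ 1 → n ≤ ∑ xs (λ i → ⟦ P? i ×-dec ¬? (Q? i) ⟧)
      leftover P? Q? xs n many few = ≤-pred (≤-trans many (≤-trans (≤-reflexive (trans (∑-cong xs λ i → ⟦⟧-split (P? i) (Q? i)) (∑-+ xs _ _))) (+-monoˡ-≤ _ few)))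

      length-take-filter : ∀ {I : Set} {P : I → Set} (P? : Decidable P) xs n → n ≤ ∑ xs (λ i → ⟦ P? i ⟧) → length (take n (filter P? xs)) ≡ n
      length-take-filter P? xs n h = trans (length-take n (filter P? xs)) (m≤n⇒m⊓n≡m (≤-trans h (≤-reflexive (sym (length-filter P? xs)))))

    module _ (P : List (K × K)) (P-unique : Unique P) (L : List X) (L-distinct : AllPairs (λ ℓ ℓ′ → ¬ Same ℓ ℓ′) L)
      (n : ℕ) (q∈P : q ∈ P)
      (rich-points : ∀ {i} → i ∈ P → suc n ≤ ∑ L λ ℓ → ⟦ incident? i ℓ ⟧)
      (rich-lines : ∀ {ℓ} → ℓ ∈ L → suc n ≤ ∑ P λ i → ⟦ incident? i ℓ ⟧) where
      private
        open ≤-Reasoning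

        L-unique : Unique L
        L-unique = AllPairs.map (λ { ¬s refl → ¬s λ _ → (λ o → o) , (λ o → o) }) L-distinct

        same⇒≡ : ∀ {ℓ ℓ′} → ℓ ∈ L → ℓ′ ∈ L → Same ℓ ℓ′ → ℓ ≡ ℓ′
        same⇒≡ = distinct-injective same-sym L-distinct

        row? : ∀ r → Dec (Incident q r × b r ≢ 0ᶠ)
        row? r = incident? q r ×-dec ¬? (b r ≟ 0ᶠ)

        -- Cut down to exactly n, as are the points on each row: the grid then has sizes at most n,
        -- while the count of hits is still n³.
        rows : List X
        rows = take n (filter row? L)

        rows-unique : Unique rows
        rows-unique = take⁺ n (filter⁺ row? L-unique)

        row-spec : ∀ {r} → r ∈ rows → r ∈ L × Incident q r × b r ≢ 0ᶠ
        row-spec r∈ = ∈-filter⁻ row? {xs = L} (∈-take n r∈)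

        length-rows : length rows ≡ n
        length-rows = length-take-filter row? L n (leftover (incident? q) (λ r → b r ≟ 0ᶠ) L n (rich-points q∈P)
          (∑-at-most-one (λ r → incident? q r ×-dec (b r ≟ 0ᶠ)) L L-unique λ r∈ r′∈ (o , z) (o′ , z′) → same⇒≡ r∈ r′∈ (vertical o o′ z z′)))

        slope-injective∈ : ∀ {r r′} → r ∈ rows → r′ ∈ rows → slope r ≡ slope r′ → r ≡ r′
        slope-injective∈ r∈ r′∈ e = let m , o , z = row-spec r∈ ; m′ , o′ , z′ = row-spec r′∈ in same⇒≡ m m′ (slope-injective o o′ z z′ e)

        point? : ∀ r i → Dec (Incident i r × i ≢ q)
        point? r i = incident? i r ×-dec ¬? (i ≟² q)

        points : X → List (K × K)
        points r = take n (filter (point? r) P)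

        point-spec : ∀ {r i} → i ∈ points r → i ∈ P × Incident i r × i ≢ q
        point-spec {r} i∈ = ∈-filter⁻ (point? r) {xs = P} (∈-take n i∈)

        length-points : ∀ {r} → r ∈ L → length (points r) ≡ n
        length-points {r} r∈ = length-take-filter (point? r) P n (leftover (λ i → incident? i r) (_≟² q) P n (rich-lines r∈)
          (∑-at-most-one (λ i → incident? i r ×-dec (i ≟² q)) P P-unique λ _ _ (_ , e) (_ , e′) → trans e (sym e′)))

        line? : ∀ i ℓ → Dec (Incident i ℓ × ¬ Incident q ℓ)
        line? i ℓ = incident? i ℓ ×-dec ¬? (incident? q ℓ)

        many-lines : ∀ {i} → i ∈ P → i ≢ q → n ≤ ∑ L λ ℓ → ⟦ line? i ℓ ⟧
        many-lines {i} i∈ i≢q = leftover (incident? i) (incident? q) L n (rich-points i∈)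
          (∑-at-most-one (λ ℓ → incident? i ℓ ×-dec incident? q ℓ) L L-unique λ m m′ (o , oq) (o′ , oq′) → same⇒≡ m m′ (same-line o oq o′ oq′ i≢q))

        B : Subset
        B = image slope rows

        -- A union over the rows of slope s; since the slope determines the row, at most one row
        -- contributes.
        A : K → Subset
        A s = record { _∋_ = λ z → Any (λ r → s ≡ slope r × Any (λ i → z ≡ ordinate i) (points r)) rows
                     ; _∋?_ = λ z → Any.any? (λ r → (s ≟ slope r) ×-dec Any.any? (λ i → z ≟ ordinate i) (points r)) rows }

        B≤n : # B ≤ n
        B≤n = ≤-trans (#-image slope rows) (≤-reflexive length-rows)

        A≤n : ∀ s → # (A s) ≤ n
        A≤n s = go (Any.any? (λ r → s ≟ slope r) rows)
          where
          go : Dec (Any (λ r → s ≡ slope r) rows) → # (A s) ≤ n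
          go (no h) = ≤-trans (≤-reflexive (trans (∑-cong U λ z → ⟦⟧-no (A s ∋? z) λ m → h (Any.map proj₁ m)) (∑-zero U))) z≤n
          go (yes h) = let r , r∈ , e = find h in
            ≤-trans (#-mono {A s} {image ordinate (points r)} λ m → let r′ , r′∈ , e′ , i∈ = find m in
              subst (λ r → Any _ (points r)) (slope-injective∈ r′∈ r∈ (trans (sym e′) e)) i∈)
            (≤-trans (#-image ordinate (points r)) (≤-trans (≤-reflexive (length-take n (filter (point? r) P))) (m⊓n≤m n _)))

        away? : ∀ ℓ → Dec (¬ Incident q ℓ)
        away? ℓ = ¬? (incident? q ℓ)

        Ls : List (K × K)
        Ls = map coordinates (filter away? L)

        Ls-unique : Unique Ls
        Ls-unique = AllPairsₚ.map⁺ (AllPairs-map∈ (λ m m′ ¬s e → ¬s (coordinates-injective (proj₂ (∈-filter⁻ away? {xs = L} m)) (proj₂ (∈-filter⁻ away? {xs = L} m′)) e))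
          (AllPairsₚ.filter⁺ away? L-distinct))

        -- Two points in common with the row would make the line equal to it, but the row passes
        -- through q.
        at-row : ∀ {ℓ r} → ℓ ∈ L → r ∈ rows → ¬ Incident q ℓ →
          ∑ (points r) (λ i → ⟦ line? i ℓ ⟧) ≤ ⟦ A (slope r) ∋? ev (coordinates ℓ) (slope r) ⟧
        at-row {ℓ} {r} ℓ∈ r∈ no-q = go (A (slope r) ∋? ev (coordinates ℓ) (slope r))
          where
          spec = row-spec r∈
          go : (d : Dec (A (slope r) ∋ ev (coordinates ℓ) (slope r))) → ∑ (points r) (λ i → ⟦ line? i ℓ ⟧) ≤ ⟦ d ⟧
          go (yes _) = ∑-at-most-one (λ i → line? i ℓ) (points r) (take⁺ n (filter⁺ (point? r) P-unique)) λ {i} {j} i∈ j∈ (o , _) (o′ , _) → same i j i∈ j∈ o o′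
            where
            same : ∀ i j → i ∈ points r → j ∈ points r → Incident i ℓ → Incident j ℓ → i ≡ j
            same i j i∈ j∈ o o′ with i ≟² j
            ... | yes e = e
            ... | no ne = ⊥-elim (no-q (proj₁ (same-line (proj₁ (proj₂ (point-spec i∈))) (proj₁ (proj₂ (point-spec j∈))) o o′ ne q) (proj₁ (proj₂ spec))))
          go (no h) = ≤-trans (∑-mono∈ (points r) λ i i∈ → ≤-reflexive (⟦⟧-no (line? i ℓ) λ { (o , _) →
              h (lose r∈ (refl , lose i∈ (hit (proj₁ (proj₂ (point-spec i∈))) (proj₁ (proj₂ spec)) (proj₂ (proj₂ spec)) (proj₂ (proj₂ (point-spec i∈))) o no-q))) }))
            (≤-reflexive (∑-zero (points r)))

        at-line : ∀ {ℓ} → ℓ ∈ L → ∑ rows (λ r → ∑ (points r) λ i → ⟦ line? i ℓ ⟧) ≤ ⟦ away? ℓ ⟧ * ∑ (el B) (λ s → ⟦ A s ∋? ev (coordinates ℓ) s ⟧)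
        at-line {ℓ} ℓ∈ = go (incident? q ℓ) (away? ℓ)
          where
          go : Dec (Incident q ℓ) → (d : Dec (¬ Incident q ℓ)) →
            ∑ rows (λ r → ∑ (points r) λ i → ⟦ line? i ℓ ⟧) ≤ ⟦ d ⟧ * ∑ (el B) (λ s → ⟦ A s ∋? ev (coordinates ℓ) s ⟧)
          go (no no-q) (no h) = ⊥-elim (h no-q)
          go (yes oq) _ = ≤-trans (∑-mono rows λ r → ≤-trans (∑-mono (points r) λ i → ≤-reflexive (⟦⟧-no (line? i ℓ) λ { (_ , no-q) → no-q oq }))
            (≤-reflexive (∑-zero (points r)))) (≤-trans (≤-reflexive (∑-zero rows)) z≤n)
          go (no no-q) (yes _) = begin
            ∑ rows (λ r → ∑ (points r) λ i → ⟦ line? i ℓ ⟧)  ≤⟨ ∑-mono∈ rows (λ r r∈ → at-row ℓ∈ r∈ no-q) ⟩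
            ∑ rows (λ r → ⟦ A (slope r) ∋? ev (coordinates ℓ) (slope r) ⟧)  ≤⟨ ∑-injection (λ r → A (slope r) ∋? ev (coordinates ℓ) (slope r)) (λ s → A s ∋? ev (coordinates ℓ) s)
              _≟_ rows (el B) rows-unique slope (λ r∈ h → ∈-el⁺ {B} (lose r∈ refl) , h) (λ m m′ _ _ → slope-injective∈ m m′) ⟩
            ∑ (el B) (λ s → ⟦ A s ∋? ev (coordinates ℓ) s ⟧)  ≡⟨ sym (*-identityˡ _) ⟩
            1 * ∑ (el B) (λ s → ⟦ A s ∋? ev (coordinates ℓ) s ⟧) ∎

        hits : n * n * n ≤ ∑ Ls λ ℓ → ∑ (el B) λ s → ⟦ A s ∋? ev ℓ s ⟧
        hits = begin
          n * n * n  ≡⟨ trans (*-assoc n n n) (trans (cong (_* (n * n)) (sym length-rows)) (sym (∑-const rows (n * n)))) ⟩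
          ∑ rows (λ r → n * n)  ≤⟨ ∑-mono∈ rows (λ r r∈ → ≤-trans (≤-reflexive (trans (cong (_* n) (sym (length-points (proj₁ (row-spec r∈))))) (sym (∑-const (points r) n))))
              (∑-mono∈ (points r) λ i i∈ → many-lines (proj₁ (point-spec i∈)) (proj₂ (proj₂ (point-spec i∈))))) ⟩
          ∑ rows (λ r → ∑ (points r) λ i → ∑ L λ ℓ → ⟦ line? i ℓ ⟧)  ≡⟨ trans (∑-cong rows λ r → ∑-swap (points r) L _) (∑-swap rows L _) ⟩
          ∑ L (λ ℓ → ∑ rows λ r → ∑ (points r) λ i → ⟦ line? i ℓ ⟧)  ≤⟨ ∑-mono∈ L (λ ℓ ℓ∈ → at-line ℓ∈) ⟩
          ∑ L (λ ℓ → ⟦ away? ℓ ⟧ * ∑ (el B) λ s → ⟦ A s ∋? ev (coordinates ℓ) s ⟧) ≡⟨ trans (sym (∑-filter away? L _)) (sym (∑-map coordinates (filter away? L) _)) ⟩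
          ∑ Ls (λ ℓ → ∑ (el B) λ s → ⟦ A s ∋? ev ℓ s ⟧) ∎

      -- Different rows share no point but q. This bounds n² by N, and thereby by p.
      square≤points : n * n ≤ length P
      square≤points = begin
        n * n  ≡⟨ trans (cong (_* n) (sym length-rows)) (sym (∑-const rows n)) ⟩
        ∑ rows (λ r → n)  ≤⟨ ∑-mono∈ rows (λ r r∈ → ≤-reflexive (sym (length-points (proj₁ (row-spec r∈))))) ⟩
        ∑ rows (λ r → length (points r))  ≤⟨ ∑-mono rows (λ r → ≤-trans (≤-trans (≤-reflexive (length-take n (filter (point? r) P))) (m⊓n≤n n _)) (≤-reflexive (length-filter (point? r) P))) ⟩
        ∑ rows (λ r → ∑ P λ i → ⟦ point? r i ⟧)  ≡⟨ ∑-swap rows P _ ⟩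
        ∑ P (λ i → ∑ rows λ r → ⟦ point? r i ⟧)  ≤⟨ ∑-mono P (λ i → ∑-at-most-one (λ r → point? r i) rows rows-unique λ r∈ r′∈ (o , i≢q) (o′ , _) →
            same⇒≡ (proj₁ (row-spec r∈)) (proj₁ (row-spec r′∈)) (same-line o (proj₁ (proj₂ (row-spec r∈))) o′ (proj₁ (proj₂ (row-spec r′∈))) i≢q)) ⟩
        ∑ P (λ i → 1)  ≡⟨ trans (∑-const P 1) (*-identityʳ _) ⟩
        length P ∎

      module _ (k : ℕ) (1≤n : 1 ≤ n) (1≤k : 1 ≤ k) (8k≤n : 8 * k ≤ n) (L≤ : length L ≤ k * (n * n)) (P≤p : length P ≤ length U) where
        private
          Ls≤ : length Ls ≤ k * (n * n)
          Ls≤ = ≤-trans (≤-reflexive (trans (length-map coordinates (filter away? L)) (length-filter away? L)))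
            (≤-trans (∑-mono L λ ℓ → ⟦⟧≤1 (away? ℓ)) (≤-trans (≤-reflexive (trans (∑-const L 1) (*-identityʳ _))) L≤))

        configuration-bound : n ≤ 512 * (link-loss k * link-loss k) * pivot-loss (doubling (link-loss k) (difference-loss (link-loss k)))
        configuration-bound = grid-bound B A n k 1≤n 1≤k 8k≤n A≤n B≤n (≤-trans square≤points P≤p) Ls Ls-unique Ls≤ hits

-- Exponents

^-distribʳ-* : ∀ m n o → (m * n) ^ o ≡ m ^ o * n ^ o
^-distribʳ-* m n zero = refl
^-distribʳ-* m n (suc o) = trans (cong (m * n *_) (^-distribʳ-* m n o)) (e m n (m ^ o) (n ^ o))
  where
  e : ∀ m n p q → m * n * (p * q) ≡ m * p * (n * q)
  e = solve-∀

root : ∀ e x y → x ^ suc e ≤ y ^ suc e → x ≤ y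
root e x y h with x ≤? y
... | yes le = le
... | no nle = ⊥-elim (<⇒≱ (^-monoˡ-< (suc e) (≰⇒> nle)) h)

module _ (a c d e f : ℕ) where
  private
    E = e * (d * (c * c) * (d * (c * c)))

    thirteenth : ∀ c d e l → e * (l * l * l) * (d * l * (c * (l * l) * (c * (l * l))) * (d * l * (c * (l * l) * (c * (l * l))))) ≡
      e * (d * (c * c) * (d * (c * c))) * (l * (l * (l * (l * (l * (l * (l * (l * (l * (l * (l * (l * (l * 1)))))))))))))
    thirteenth = solve-∀

  loss-constant : ℕ
  loss-constant = a * f * E ^ 7 * c ^ 93

  private
    gather : ∀ a l f g x → a * (l * l) * (f * (g * x)) ≡ a * f * g * (l * (l * x))
    gather = solve-∀

  -- The numerical factors are parameters, so that the ring solver meets variables in their place.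
  -- The exponents are 13 = 3 + 2 · 5, then 93 = 2 + 7 · 13 and 186 = 2 · 93.
  total-loss : ∀ k l → l ≡ c * (k * k) →
    a * (l * l) * (f * (e * (l * l * l) * (d * l * (c * (l * l) * (c * (l * l))) * (d * l * (c * (l * l) * (c * (l * l)))))) ^ 7) ≡ loss-constant * k ^ 186
  total-loss k l l≡ = begin
    a * (l * l) * (f * (e * (l * l * l) * (M * M)) ^ 7)  ≡⟨ cong (λ x → a * (l * l) * (f * x ^ 7)) (thirteenth c d e l) ⟩
    a * (l * l) * (f * (E * l ^ 13) ^ 7)  ≡⟨ cong (λ x → a * (l * l) * (f * x)) (trans (^-distribʳ-* E (l ^ 13) 7) (cong (E ^ 7 *_) (^-*-assoc l 13 7))) ⟩
    a * (l * l) * (f * (E ^ 7 * l ^ 91))  ≡⟨ gather a l f (E ^ 7) (l ^ 91) ⟩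
    a * f * E ^ 7 * l ^ 93  ≡⟨ cong (λ x → a * f * E ^ 7 * x) (trans (cong (_^ 93) l≡) (trans (^-distribʳ-* c (k * k) 93)
              (cong (c ^ 93 *_) (trans (cong (_^ 93) (cong (k *_) (sym (*-identityʳ k)))) (^-*-assoc k 2 93))))) ⟩
    a * f * E ^ 7 * (c ^ 93 * k ^ 186)  ≡⟨ sym (*-assoc (a * f * E ^ 7) (c ^ 93) (k ^ 186)) ⟩
    a * f * E ^ 7 * c ^ 93 * k ^ 186 ∎
    where
    open ≡-Reasoning
    M = d * l * (c * (l * l) * (c * (l * l)))

configuration-loss : ℕ → ℕ
configuration-loss k = 512 * (link-loss k * link-loss k) * pivot-loss (doubling (link-loss k) (difference-loss (link-loss k)))

abstract
  configuration-constant : Σ ℕ λ C → ∀ k → configuration-loss k ≡ C * k ^ 186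
  configuration-constant = loss-constant 512 32 4 1024 4096 , λ k → trans (cong (512 * (link-loss k * link-loss k) *_)
      (trans (pivot-loss-def (doubling (link-loss k) (difference-loss (link-loss k)))) (cong (λ x → 4096 * x ^ 7)
        (trans (doubling-def (link-loss k) (difference-loss (link-loss k)))
          (cong (λ θ → 1024 * (link-loss k * link-loss k * link-loss k) * (4 * link-loss k * (θ * θ) * (4 * link-loss k * (θ * θ)))) (link-loss-def (link-loss k)))))))
    (total-loss 512 32 4 1024 4096 k (link-loss k) (link-loss-def k))

-- Multiplying by (n²)^e completes k^e to (k n²)^e, which removes k.
eliminate : ∀ C e n k N → n ≤ C * k ^ e → k * (n * n) ≤ 2 * N → n ^ suc (e + e) ≤ C * 2 ^ e * N ^ e
eliminate C e n k N n≤ kn²≤ = begin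
  n * n ^ (e + e)  ≤⟨ *-monoˡ-≤ _ n≤ ⟩
  C * k ^ e * n ^ (e + e)  ≡⟨ cong (C * k ^ e *_) (trans (^-distribˡ-+-* n e e) (sym (^-distribʳ-* n n e))) ⟩
  C * k ^ e * (n * n) ^ e  ≡⟨ trans (*-assoc C _ _) (cong (C *_) (sym (^-distribʳ-* k (n * n) e))) ⟩
  C * (k * (n * n)) ^ e  ≤⟨ *-monoʳ-≤ C (^-monoˡ-≤ e kn²≤) ⟩
  C * (2 * N) ^ e  ≡⟨ trans (cong (C *_) (^-distribʳ-* 2 N e)) (sym (*-assoc C _ _)) ⟩
  C * 2 ^ e * N ^ e ∎
  where open ≤-Reasoning

-- Compares the exponents t / (s + 1) and v / u through integral powers; extra powers of `C` only
-- enlarge the right side.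
compare-powers : ∀ C I N s t u v → 1 ≤ C → 1 ≤ N → t * u ≤ v * suc s → I ^ suc s ≤ C * N ^ t → I ^ u ≤ C ^ u * N ^ v
compare-powers C I N s t u v 1≤C 1≤N tu≤vs h = root s _ _ (begin
  (I ^ u) ^ suc s  ≡⟨ trans (^-*-assoc I u (suc s)) (trans (cong (I ^_) (*-comm u (suc s))) (sym (^-*-assoc I (suc s) u))) ⟩
  (I ^ suc s) ^ u  ≤⟨ ^-monoˡ-≤ u h ⟩
  (C * N ^ t) ^ u  ≡⟨ trans (^-distribʳ-* C (N ^ t) u) (cong (C ^ u *_) (^-*-assoc N t u)) ⟩
  C ^ u * N ^ (t * u)  ≤⟨ *-mono-≤ C^u≤ (^-monoʳ-≤ N {{>-nonZero 1≤N}} tu≤vs) ⟩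
  (C ^ u) ^ suc s * N ^ (v * suc s) ≡⟨ trans (cong ((C ^ u) ^ suc s *_) (sym (^-*-assoc N v (suc s)))) (sym (^-distribʳ-* (C ^ u) (N ^ v) (suc s))) ⟩
  (C ^ u * N ^ v) ^ suc s ∎)
  where
  open ≤-Reasoning
  1≤C^u : 1 ≤ C ^ u
  1≤C^u = m^n>0 C {{>-nonZero 1≤C}} u
  C^u≤ : C ^ u ≤ (C ^ u) ^ suc s
  C^u≤ = ≤-trans (≤-reflexive (sym (*-identityʳ (C ^ u)))) (*-monoʳ-≤ (C ^ u) (m^n>0 (C ^ u) {{>-nonZero 1≤C^u}} s))

with-epsilon : ∀ C I N u v m n → 1 ≤ N → I ^ u ≤ C ^ u * N ^ v → I ^ (u * suc n) ≤ C ^ (u * suc n) * N ^ (v * suc n + u * suc m)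
with-epsilon C I N u v m n 1≤N h = begin
  I ^ (u * suc n)  ≡⟨ sym (^-*-assoc I u (suc n)) ⟩
  (I ^ u) ^ suc n  ≤⟨ ^-monoˡ-≤ (suc n) h ⟩
  (C ^ u * N ^ v) ^ suc n  ≡⟨ trans (^-distribʳ-* (C ^ u) (N ^ v) (suc n)) (cong₂ _*_ (^-*-assoc C u (suc n)) (^-*-assoc N v (suc n))) ⟩
  C ^ (u * suc n) * N ^ (v * suc n)  ≤⟨ *-monoʳ-≤ (C ^ (u * suc n)) (^-monoʳ-≤ N {{>-nonZero 1≤N}} (m≤m+n (v * suc n) (u * suc m))) ⟩
  C ^ (u * suc n) * N ^ (v * suc n + u * suc m) ∎
  where open ≤-Reasoning

length-filterᵇ : ∀ {A : Set} {P : A → Set} (f : A → Bool) (P? : Decidable P) → (∀ x → T (f x) → P x) → (∀ x → P x → T (f x)) →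
  ∀ xs → length (filterᵇ f xs) ≡ ∑ xs λ x → ⟦ P? x ⟧
length-filterᵇ f P? to from [] = refl
length-filterᵇ f P? to from (x ∷ xs) with f x | to x | from x | P? x
... | true  | _ | _ | yes _ = cong suc (length-filterᵇ f P? to from xs)
... | true  | t | _ | no ¬p = ⊥-elim (¬p (t tt))
... | false | _ | g | yes p = ⊥-elim (g p)
... | false | _ | _ | no _ = length-filterᵇ f P? to from xs

first : ∀ {A : Set} (xs : List A) f → 1 ≤ ∑ xs f → ∃ λ x → x ∈ xs
first (x ∷ xs) f _ = x , here refl

abstract
  -- Abstract, so that powers with this exponent are never evaluated.
  half-exponent : ℕ
  half-exponent = 186

  -- 559 / 373 = 3/2 - 1/746 is at most 604 / 403 = 3/2 - 1/806.
  exponents≤ : (suc (half-exponent + half-exponent) + half-exponent) * 403 ≤ 604 * suc (half-exponent + half-exponent)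
  exponents≤ = ≤ᵇ⇒≤ (559 * 403) (604 * 373) tt

  1≤half-exponent : 1 ≤ half-exponent
  1≤half-exponent = s≤s z≤n

  -- The 8 provides for the case n < 8k, where the grid argument does not apply.
  C₀ : ℕ
  C₀ = proj₁ configuration-constant + 8

  configuration-loss≤ : ∀ k → configuration-loss k ≤ C₀ * k ^ half-exponent
  configuration-loss≤ k = ≤-trans (≤-reflexive (proj₂ configuration-constant k)) (*-monoˡ-≤ (k ^ half-exponent) (m≤m+n (proj₁ configuration-constant) 8))

  8k≤ : ∀ k → 1 ≤ k → 8 * k ≤ C₀ * k ^ half-exponent
  8k≤ k 1≤k = *-mono-≤ {8} {C₀} (m≤n+m 8 (proj₁ configuration-constant))
    (≤-trans (≤-reflexive (sym (*-identityʳ k))) (^-monoʳ-≤ k {{>-nonZero 1≤k}} {1} {half-exponent} 1≤half-exponent))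

  C₂ : ℕ
  C₂ = C₀ * 2 ^ half-exponent

  C₂-def : C₂ ≡ C₀ * 2 ^ half-exponent
  C₂-def = refl

  1≤C₂ : 1 ≤ C₂
  1≤C₂ = *-mono-≤ {1} {C₀} (≤-trans (s≤s z≤n) (m≤n+m 8 (proj₁ configuration-constant))) (m^n>0 2 half-exponent)

-- Incidences modulo p

module Incidences (p : ℕ) .{{_ : NonZero p}} (prime : Prime p) where
  open Residues p using (𝔽; 0#; ⟨⟩-+; toℕ-⟨⟩; _+ᵖ_; _*ᵖ_)
  open ≤-Reasoning

  private
    zero-residue : ∀ {x} → x ≡ 0# → toℕ x ≡ 0
    zero-residue refl = trans (toℕ-⟨⟩ 0) (m<n⇒m%n≡m (>-nonZero⁻¹ p))

    nondegenerate : ∀ (ℓ : Line p) → ¬ (Line.a ℓ ≡ 0# × Line.b ℓ ≡ 0#)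
    nondegenerate ℓ (a≡0 , b≡0) = Line.nondeg ℓ (zero-residue a≡0 , zero-residue b≡0)

  open Geometry (𝔽 prime) (Line p) Line.a Line.b Line.c nondegenerate

  private
    value : ∀ x y (ℓ : Line p) → toℕ (Line.a ℓ *ᵖ x +ᵖ Line.b ℓ *ᵖ y) ≡ (toℕ (Line.a ℓ) * toℕ x + toℕ (Line.b ℓ) * toℕ y) % p
    value x y ℓ = trans (cong toℕ (⟨⟩-+ (toℕ (Line.a ℓ) * toℕ x) (toℕ (Line.b ℓ) * toℕ y))) (toℕ-⟨⟩ (toℕ (Line.a ℓ) * toℕ x + toℕ (Line.b ℓ) * toℕ y))

    to-incident : ∀ q ℓ → On q ℓ → Incident q ℓ
    to-incident (x , y) ℓ o = Finₚ.toℕ-injective (trans (value x y ℓ) o)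

    from-incident : ∀ q ℓ → Incident q ℓ → On q ℓ
    from-incident (x , y) ℓ e = trans (sym (value x y ℓ)) (cong toℕ e)

    same⇒sameLine : ∀ {ℓ ℓ′} → Same ℓ ℓ′ → SameLine ℓ ℓ′
    same⇒sameLine {ℓ} {ℓ′} s q = mk⇔ (λ o → from-incident q ℓ′ (proj₁ (s q) (to-incident q ℓ o))) (λ o → from-incident q ℓ (proj₂ (s q) (to-incident q ℓ′ o)))

    I≡incidences : ∀ P L → I P L ≡ incidences incident? 0 P L
    I≡incidences P L = trans (length-filterᵇ _ (λ { (q , ℓ) → incident? q ℓ })
        (λ { (q , ℓ) t → to-incident q ℓ (≡ᵇ⇒≡ _ _ t) }) (λ { (q , ℓ) e → ≡⇒≡ᵇ _ _ (from-incident q ℓ e) }) (cartesianProduct P L))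
      (∑-cartesian P L _)

  module _ (N : ℕ) (1≤N : 1 ≤ N) (N<p : N < p) (P : List (Point p)) (P-unique : Unique P) (P≤N : length P ≤ N)
    (L : List (Line p)) (L-distinct : AllPairs (λ ℓ ℓ′ → ¬ SameLine ℓ ℓ′) L) (L≤N : length L ≤ N) where
    private
      module Rich (n : ℕ) (1≤n : 1 ≤ n) (many : suc n * (2 * N) < incidences incident? 0 P L) where
        pruned : Pruned incident? (suc n) _≢_ (λ ℓ ℓ′ → ¬ Same ℓ ℓ′) P L
        pruned = prune incident? (suc n) _≢_ (λ ℓ ℓ′ → ¬ Same ℓ ℓ′) P L P-unique (AllPairs.map (λ {ℓ} {ℓ′} ¬s s → ¬s (same⇒sameLine {ℓ} {ℓ′} s)) L-distinct)
          (≤-<-trans (*-monoʳ-≤ (suc n) (≤-trans (+-mono-≤ P≤N L≤N) (≤-reflexive (cong (N +_) (sym (+-identityʳ N)))))) many)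

        open Pruned pruned

        centre : ∃ λ q → q ∈ P′
        centre = first P′ _ remains

        open Centre (proj₁ (proj₁ centre)) (proj₂ (proj₁ centre))

        instance
          n²≢0 : NonZero (n * n)
          n²≢0 = >-nonZero (*-mono-≤ 1≤n 1≤n)

        n²≤N : n * n ≤ N
        n²≤N = ≤-trans (square≤points P′ P′-pairs L′ L′-pairs n (proj₂ centre) rich-points rich-lines) (≤-trans P′≤ P≤N)

        -- N / n² rounded up, so that all lines fit into k n²; since n² ≤ N, the rounding keeps k n²
        -- ≤ 2N.
        k : ℕ
        k = suc (N / (n * n))

        N≤kn² : N ≤ k * (n * n)
        N≤kn² = begin
          N  ≡⟨ m≡m%n+[m/n]*n N (n * n) ⟩
          N % (n * n) + N / (n * n) * (n * n)  ≤⟨ +-monoˡ-≤ _ (<⇒≤ (m%n<n N (n * n))) ⟩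
          n * n + N / (n * n) * (n * n) ∎

        kn²≤2N : k * (n * n) ≤ 2 * N
        kn²≤2N = begin
          n * n + N / (n * n) * (n * n)  ≤⟨ +-mono-≤ n²≤N (m/n*n≤m N (n * n)) ⟩
          N + N  ≡⟨ cong (N +_) (sym (+-identityʳ N)) ⟩
          2 * N ∎

        n≤ : n ≤ C₀ * k ^ half-exponent
        n≤ = go (8 * k ≤? n)
          where
          go : Dec (8 * k ≤ n) → n ≤ C₀ * k ^ half-exponent
          go (no h) = ≤-trans (<⇒≤ (≰⇒> h)) (8k≤ k (s≤s z≤n))
          go (yes 8k≤n) = ≤-trans (configuration-bound P′ P′-pairs L′ L′-pairs n (proj₂ centre) rich-points rich-lines k 1≤n (s≤s z≤n) 8k≤n
            (≤-trans (≤-trans L′≤ L≤N) N≤kn²) (≤-trans (≤-trans P′≤ P≤N) (≤-trans (<⇒≤ N<p) (≤-reflexive (sym (length-tabulate {n = p} (λ i → i)))))))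
            (configuration-loss≤ k)

        size : n ^ suc (half-exponent + half-exponent) ≤ C₂ * N ^ half-exponent
        size = subst (λ c → n ^ suc (half-exponent + half-exponent) ≤ c * N ^ half-exponent) (sym C₂-def) (eliminate C₀ half-exponent n k N n≤ kn²≤2N)

    few-or-rich : I P L ≤ 6 * N ⊎ ∃ λ n → I P L ≤ 6 * N * n × n ^ suc (half-exponent + half-exponent) ≤ C₂ * N ^ half-exponent
    few-or-rich = split (I P L) (I≡incidences P L)
      where
      instance
        2N≢0 : NonZero (2 * N)
        2N≢0 = >-nonZero (*-mono-≤ {1} {2} (s≤s z≤n) 1≤N)

      degree : ∀ J D → 6 * N ≤ J → D ≡ J / (2 * N) → suc J ≡ incidences incident? 0 P L →
        ∃ λ n → suc J ≤ 6 * N * n × n ^ suc (half-exponent + half-exponent) ≤ C₂ * N ^ half-exponent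
      degree J D 6N≤J D≡ J≡ = go D below above
        where
        below : D * (2 * N) ≤ J
        below = subst (λ d → d * (2 * N) ≤ J) (sym D≡) (m/n*n≤m J (2 * N))
        above : J < suc D * (2 * N)
        above = begin-strict
          J  ≡⟨ m≡m%n+[m/n]*n J (2 * N) ⟩
          J % (2 * N) + J / (2 * N) * (2 * N)  <⟨ +-monoˡ-< _ (m%n<n J (2 * N)) ⟩
          2 * N + J / (2 * N) * (2 * N)  ≡⟨ cong (λ d → 2 * N + d * (2 * N)) (sym D≡) ⟩
          suc D * (2 * N) ∎
        6N≡ : ∀ N → 6 * N ≡ 3 * (2 * N)
        6N≡ = solve-∀
        expand : ∀ n N → suc (suc (suc n)) * (2 * N) + 4 * n * N ≡ 6 * N * suc n
        expand = solve-∀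
        go : ∀ D → D * (2 * N) ≤ J → J < suc D * (2 * N) →
          ∃ λ n → suc J ≤ 6 * N * n × n ^ suc (half-exponent + half-exponent) ≤ C₂ * N ^ half-exponent
        go zero _ h = ⊥-elim (<⇒≱ h (≤-trans (*-monoˡ-≤ (2 * N) {1} {3} (s≤s z≤n)) (≤-trans (≤-reflexive (sym (6N≡ N))) 6N≤J)))
        go (suc zero) _ h = ⊥-elim (<⇒≱ h (≤-trans (*-monoˡ-≤ (2 * N) {2} {3} (s≤s (s≤s z≤n))) (≤-trans (≤-reflexive (sym (6N≡ N))) 6N≤J)))
        -- The pruning threshold is D = n + 2 and the grid has size D - 1. As D ≥ 2, the bound I ≤
        -- 2N (D + 1) is at most 6N (D - 1).
        go (suc (suc n)) b h = suc n , ≤-trans h (≤-trans (m≤m+n _ (4 * n * N)) (≤-reflexive (expand n N))) ,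
          Rich.size (suc n) (s≤s z≤n) (≤-<-trans b (subst (J <_) J≡ ≤-refl))

      split : ∀ i → i ≡ incidences incident? 0 P L → i ≤ 6 * N ⊎ ∃ λ n → i ≤ 6 * N * n × n ^ suc (half-exponent + half-exponent) ≤ C₂ * N ^ half-exponent
      split zero _ = inj₁ z≤n
      split (suc J) J≡ = by (suc J ≤? 6 * N)
        where
        by : Dec (suc J ≤ 6 * N) → suc J ≤ 6 * N ⊎ ∃ λ n → suc J ≤ 6 * N * n × n ^ suc (half-exponent + half-exponent) ≤ C₂ * N ^ half-exponent
        by (yes le) = inj₁ le
        by (no nle) = inj₂ (degree J (J / (2 * N)) (≤-pred (≰⇒> nle)) refl J≡)

private
  shape : ∀ a b c d → a * b * (c * d) ≡ a * c * (b * d)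
  shape = solve-∀

combine : ∀ e C → 1 ≤ C → ∀ i N → 1 ≤ N → i ≤ 6 * N ⊎ (∃ λ n → i ≤ 6 * N * n × n ^ suc (e + e) ≤ C * N ^ e) →
  i ^ suc (e + e) ≤ 6 ^ suc (e + e) * C * N ^ (suc (e + e) + e)
-- The sparse case is the other one with n = 1.
combine e C 1≤C i N 1≤N (inj₁ le) = combine e C 1≤C i N 1≤N (inj₂ (1 , ≤-trans le (≤-reflexive (sym (*-identityʳ (6 * N)))) ,
  ≤-trans (≤-reflexive (^-zeroˡ (suc (e + e)))) (*-mono-≤ 1≤C (m^n>0 N {{>-nonZero 1≤N}} e))))
combine e C 1≤C i N 1≤N (inj₂ (n , i≤ , n≤)) = begin
  i ^ s  ≤⟨ ^-monoˡ-≤ s i≤ ⟩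
  (6 * N * n) ^ s  ≡⟨ trans (^-distribʳ-* (6 * N) n s) (cong (_* n ^ s) (^-distribʳ-* 6 N s)) ⟩
  6 ^ s * N ^ s * n ^ s  ≤⟨ *-monoʳ-≤ (6 ^ s * N ^ s) n≤ ⟩
  6 ^ s * N ^ s * (C * N ^ e)  ≡⟨ trans (shape (6 ^ s) (N ^ s) C (N ^ e)) (cong (6 ^ s * C *_) (sym (^-distribˡ-+-* N s e))) ⟩
  6 ^ s * C * N ^ (s + e) ∎
  where
  open ≤-Reasoning
  s = suc (e + e)

abstract
  C₃ : ℕ
  C₃ = 6 ^ suc (half-exponent + half-exponent) * C₂

  C₃-def : C₃ ≡ 6 ^ suc (half-exponent + half-exponent) * C₂
  C₃-def = refl

  1≤C₃ : 1 ≤ C₃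
  1≤C₃ = *-mono-≤ {1} {6 ^ suc (half-exponent + half-exponent)} (m^n>0 6 (suc (half-exponent + half-exponent))) 1≤C₂

-- With δ = (m + 1) / (n + 1) this is I ≤ C N^(604/403 + δ) raised to the power 403 (n + 1), where
-- 604/403 = 3/2 - 1/806. Rational δ suffice because a smaller δ gives a stronger bound.
theorem3 : (m n : ℕ) → Σ ℕ λ C →
    (p : ℕ) .{{_ : NonZero p}} → Prime p →
    (N : ℕ) → 1 ≤ N → N < p →
    (P : List (Point p)) → Unique P → length P ≤ N →
    (L : List (Line p)) → AllPairs (λ ℓ ℓ′ → ¬ SameLine ℓ ℓ′) L → length L ≤ N →
    I P L ^ (403 * suc n) ≤ C ^ (403 * suc n) * N ^ (604 * suc n + 403 * suc m)
theorem3 m n = C₃ , λ p prime N 1≤N N<p P P-unique P≤N L L-distinct L≤N →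
  with-epsilon C₃ (I P L) N 403 604 m n 1≤N
    (compare-powers C₃ (I P L) N (half-exponent + half-exponent) (suc (half-exponent + half-exponent) + half-exponent) 403 604 1≤C₃ 1≤N exponents≤
      (subst (λ C → I P L ^ suc (half-exponent + half-exponent) ≤ C * N ^ (suc (half-exponent + half-exponent) + half-exponent)) (sym C₃-def)
      (combine half-exponent C₂ 1≤C₂ (I P L) N 1≤N (Incidences.few-or-rich p prime N 1≤N N<p P P-unique P≤N L L-distinct L≤N))))
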